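{- For every integer $r\geq 4$ we have $g(n,r)=r^{n/2+o(n)}$ as $n\to\infty$. Moreover, for every $\varepsilon>0$ there exist $\delta,n_0>0$ such that for all integers $n\geq n_0$ the following holds. If $A\subseteq[n]$ satisfies $g(A,r)\geq r^{n/2-\delta n}$, then (i) if $r\geq 5$, either $|A\triangle O|\leq \varepsilon n$ or $|A\triangle I_0|\leq\varepsilon n$; (ii) if $r=4$, either $|A\triangle[n]|\leq\varepsilon n$, or $|A\triangle O|\leq\varepsilon n$, or $|A\triangle I_0|\leq\varepsilon n$.
   Context: $[n]=\{1,\dots,n\}$; $O=\{1,3,5,\dots,2\lceil n/2\rceil-1\}$ is the set of odd numbers in $[n]$, and $I_0=[\lfloor n/2\rfloor+1,n]=\{\lfloor n/2\rfloor+1,\dots,n\}$. An $r$-coloring of $A$ is a map $A\to[r]$. A rainbow sum is a triple of three distinct elements $x,y,z$ with $x+y=z$ colored with three different colors; a coloring is rainbow sum-free if it has no rainbow sum. $g(A,r)$ is the number of rainbow sum-free $r$-colorings of $A$, and $g(n,r)=\max_{A\subseteq[n]}g(A,r)$. $\triangle$ denotes symmetric difference. -}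

module Defs where

open import Data.Nat using (ℕ; zero; suc; _+_; _*_; _/_; _%_; _≤ᵇ_; _≡ᵇ_; _⊔_)
open import Data.Bool using (Bool; true; false; not; _∧_; _xor_)
open import Data.Fin using (Fin; toℕ)
import Data.Fin as F
open import Data.List using (List; []; _∷_; map; concatMap; length; filterᵇ; foldr)
open import Data.Vec using (Vec; []; _∷_; tabulate; zipWith)
open import Data.Fin.Subset using (Subset; ∣_∣)
open import Data.Product using (_×_; _,_)
open import Relation.Nullary.Decidable using (⌊_⌋)

-- Convention: a subset A ⊆ [n] = {1,…,n} is a 'Subset n' (a Vec Bool n);
-- index i : Fin n stands for the integer (toℕ i + 1).

elems : ∀ {n} → Subset n → List ℕ
elems {n} A = go A 1
  where
  go : ∀ {k} → Vec Bool k → ℕ → List ℕ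
  go [] _ = []
  go (true ∷ v) m = m ∷ go v (suc m)
  go (false ∷ v) m = go v (suc m)

-- An r-coloring of a finite set X of integers (given as a list) is represented
-- by its graph: the list of pairs (x , colour of x), one for each x in X.
allColorings : (r : ℕ) → List ℕ → List (List (ℕ × Fin r))
allColorings r [] = [] ∷ []
allColorings r (x ∷ xs) =
  concatMap (λ c → map ((x , c) ∷_) (allColorings r xs)) (Data.List.allFin r)

_≠ℕ_ : ℕ → ℕ → Bool
x ≠ℕ y = not (x ≡ᵇ y)

_≠F_ : ∀ {r} → Fin r → Fin r → Bool
a ≠F b = not ⌊ a F.≟ b ⌋

isRainbowSum : ∀ {r} → (ℕ × Fin r) → (ℕ × Fin r) → (ℕ × Fin r) → Bool
isRainbowSum (x , a) (y , b) (z , d) =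
  (x ≠ℕ y) ∧ (x ≠ℕ z) ∧ (y ≠ℕ z) ∧ ((x + y) ≡ᵇ z)
  ∧ (a ≠F b) ∧ (a ≠F d) ∧ (b ≠F d)

allᵇ : {X : Set} → (X → Bool) → List X → Bool
allᵇ p [] = true
allᵇ p (x ∷ xs) = p x ∧ allᵇ p xs

rainbowSumFree : ∀ {r} → List (ℕ × Fin r) → Bool
rainbowSumFree c =
  allᵇ (λ p → allᵇ (λ q → allᵇ (λ s → not (isRainbowSum p q s)) c) c) c

g : ∀ {n} → Subset n → ℕ → ℕ
g A r = length (filterᵇ rainbowSumFree (allColorings r (elems A)))

allSubsets : (n : ℕ) → List (Subset n)
allSubsets zero = [] ∷ []
allSubsets (suc n) = concatMap (λ v → (true ∷ v) ∷ (false ∷ v) ∷ []) (allSubsets n)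

gMax : ℕ → ℕ → ℕ
gMax n r = foldr _⊔_ 0 (map (λ A → g A r) (allSubsets n))

_△_ : ∀ {n} → Subset n → Subset n → Subset n
A △ B = zipWith _xor_ A B

-- O: odd numbers in [n]  (index i ↔ integer i+1, odd iff i even)
oddSet : (n : ℕ) → Subset n
oddSet n = tabulate (λ i → (toℕ i % 2) ≡ᵇ 0)

-- I₀ = [⌊n/2⌋+1, n]  (integer i+1 ≥ ⌊n/2⌋+1 iff ⌊n/2⌋ ≤ i)
I₀ : (n : ℕ) → Subset n
I₀ n = tabulate (λ i → (n / 2) ≤ᵇ toℕ i)

fullSet : (n : ℕ) → Subset n
fullSet n = tabulate (λ _ → true)

{-# OPTIONS --safe #-}
module Submission where

-- The colourings are counted with containers. A template allows some of the colours at every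
-- element. Repeatedly ask whether a colouring uses a vertex (element, colour) that either lies in
-- many rainbow sums of the template, or is joined by rainbow sums to many vertices of the template
-- through vertices already known to be used. Few answers can be "yes", so 2^o(n) templates are
-- reached, and in each of them every allowed vertex with an alternative lies in few rainbow sums.
-- Such a template gives sets B ⊆ C ⊆ A (at least three, two, one colours) with few sums
-- x + y = z having a term in B and another in C. Reflecting in max B gives |B| + |C| ≤ n + o(n), and
-- the template has at most r^((|B| + |C|) / 2) colourings because r ≥ 4.
-- In case of near equality, B = ∅ (only possible if r = 4) or max B ≈ n, A ≈ B, and reflection
-- in max B nearly complements B. If moreover B has an element well below n / 2, every translation
-- either nearly preserves or nearly complements B; this is additive in the translation, hence given
-- by parity, and B consists of odd numbers. Otherwise B lies in the upper half.

-- The rainbow sums form a 3-uniform hypergraph on the vertices (element, colour) in which two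
-- vertices leave only three candidates for the third element. A boundedly large set of vertices
-- known to be used therefore turns it into a graph, kept at bounded degree, with O(n) edges. Each
-- used vertex lying in many sums brings at least Δ edges, Δ being a fixed fraction of n, so this
-- happens boundedly often. A "yes" about a vertex of large degree in the graph rules out T² others.
-- With weight T/(T+1) for "no" and 1/(T+1) for "yes" both effects fit one induction, because
-- (T/(T+1))^(T²) ≤ 1/(T+1).
--
-- Three, two and one colours are what a greedy choice asks for: picking colours for the element
-- with one, then two, then three makes every sum of integers rainbow in some way. The condition r ≥
-- 4 is used as 2² ≤ r: an element with two colours weighs at most √r. For r = 4 two colours
-- everywhere reach r^(n/2), hence the third extremal set [n]; for r ≥ 5 they lose an exponential
-- factor.
--
-- Real numbers never occur: inequalities are squared, or raised to a power that clears the
-- denominators of the exponents.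

open import Defs
open import Data.Bool.Base using (Bool; true; false; not; _∧_; _∨_; _xor_; if_then_else_; T)
open import Data.Empty using (⊥; ⊥-elim)
open import Data.Fin.Base using (Fin; zero; suc; toℕ)
import Data.Fin.Properties as Fin
open import Data.Fin.Subset using (Subset; ∣_∣)
open import Data.List.Base using (List; []; _∷_; _++_; map; concatMap; length; foldr; replicate; filterᵇ; allFin)
import Data.List.Base as List
open import Data.List.Membership.Propositional using (_∈_; find; lose)
open import Data.List.Membership.Propositional.Properties using (∈-allFin; ∈-tabulate⁻; ∈-map⁺; ∈-map⁻; ∈-concatMap⁺; ∈-concatMap⁻)
open import Data.List.Properties using (length-tabulate)
open import Data.List.Relation.Unary.Any using (here; there)
open import Data.Nat using (ℕ; _+_; _*_; _∸_; _^_; _≤_; _<_)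
open import Data.Nat.Base using (zero; suc; z≤n; s≤s; _≡ᵇ_; _≤ᵇ_; _⊔_; _/_; _%_; NonZero; >-nonZero)
open import Data.Nat.DivMod using (m/n*n≤m; m%n<n; m≡m%n+[m/n]*n; m≥n⇒m/n>0; [m+n]%n≡m%n)
open import Data.Nat.Properties
import Data.Nat.Solver as ℕ-Solver
open import Data.Product using (_×_; _,_; proj₁; proj₂; ∃-syntax)
open import Data.Sum using (_⊎_; inj₁; inj₂)
open import Data.Unit.Base using (⊤; tt)
open import Data.Vec.Base using (Vec; []; _∷_; lookup; tabulate; zipWith)
open import Data.Vec.N-ary using (N-ary; _$ⁿ_)
open import Function.Base using (id)
open import Relation.Binary.PropositionalEquality using (_≡_; refl; sym; trans; cong; cong₂; subst; module ≡-Reasoning)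
open import Relation.Nullary using (Dec; yes; no)
open import Relation.Nullary.Decidable using (⌊_⌋)
open ℕ-Solver.+-*-Solver using (solve; _:=_; con) renaming (_:+_ to _⊹_; _:*_ to _⊛_)

-- Linear arithmetic over ℕ: Fourier–Motzkin elimination searches for multipliers
-- of the hypotheses, and a separate check, the only verified part, accepts them.

infixl 6 _:+_
infixl 7 _:*_
infix 4 _:≤_
infix 3 _⊢_

data Lin (n : ℕ) : Set where
  var  : Fin n → Lin n
  lit  : ℕ → Lin n
  _:+_ : Lin n → Lin n → Lin n
  _:*_ : ℕ → Lin n → Lin n

data Ineq (n : ℕ) : Set where
  _:≤_ : Lin n → Lin n → Ineq n

data Problem (n : ℕ) : Set where
  _⊢_ : List (Ineq n) → Ineq n → Problem n

⟦_⟧ : ∀ {n} → Lin n → Vec ℕ n → ℕ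
⟦ var i ⟧ ρ = lookup ρ i
⟦ lit k ⟧ ρ = k
⟦ e :+ f ⟧ ρ = ⟦ e ⟧ ρ + ⟦ f ⟧ ρ
⟦ k :* e ⟧ ρ = k * ⟦ e ⟧ ρ

⟦_⟧≤ : ∀ {n} → Ineq n → Vec ℕ n → Set
⟦ e :≤ f ⟧≤ ρ = ⟦ e ⟧ ρ ≤ ⟦ f ⟧ ρ

⟦_⟧⊢ : ∀ {n} → Problem n → Vec ℕ n → Set
⟦ [] ⊢ g ⟧⊢ ρ = ⟦ g ⟧≤ ρ
⟦ h ∷ hs ⊢ g ⟧⊢ ρ = ⟦ h ⟧≤ ρ → ⟦ hs ⊢ g ⟧⊢ ρ

-- A constant term followed by coefficients, padded with zeros.
Coeffs : Set
Coeffs = List ℕ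

_⊞_ : Coeffs → Coeffs → Coeffs
[] ⊞ ds = ds
(c ∷ cs) ⊞ [] = c ∷ cs
(c ∷ cs) ⊞ (d ∷ ds) = c + d ∷ cs ⊞ ds

_⊠_ : ℕ → Coeffs → Coeffs
k ⊠ cs = map (k *_) cs

unit : ∀ {n} → Fin n → Coeffs
unit zero = 1 ∷ []
unit (suc i) = 0 ∷ unit i

coeffs : ∀ {n} → Lin n → Coeffs
coeffs (var i) = 0 ∷ unit i
coeffs (lit k) = k ∷ []
coeffs (e :+ f) = coeffs e ⊞ coeffs f
coeffs (k :* e) = k ⊠ coeffs e

evalᶜ : ∀ {n} → Coeffs → Vec ℕ n → ℕ
evalᶜ [] ρ = 0
evalᶜ (c ∷ cs) [] = c
evalᶜ (c ∷ cs) (x ∷ ρ) = c * x + evalᶜ cs ρ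

eval : ∀ {n} → Coeffs → Vec ℕ n → ℕ
eval cs ρ = evalᶜ cs (1 ∷ ρ)

evalᶜ-⊞ : ∀ {n} cs ds (ρ : Vec ℕ n) → evalᶜ (cs ⊞ ds) ρ ≡ evalᶜ cs ρ + evalᶜ ds ρ
evalᶜ-⊞ [] ds ρ = refl
evalᶜ-⊞ (c ∷ cs) [] ρ = sym (+-identityʳ _)
evalᶜ-⊞ (c ∷ cs) (d ∷ ds) [] = refl
evalᶜ-⊞ (c ∷ cs) (d ∷ ds) (x ∷ ρ) rewrite evalᶜ-⊞ cs ds ρ =
  solve 5 (λ c d x u v → (c ⊹ d) ⊛ x ⊹ (u ⊹ v) := c ⊛ x ⊹ u ⊹ (d ⊛ x ⊹ v)) refl
    c d x (evalᶜ cs ρ) (evalᶜ ds ρ)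

evalᶜ-⊠ : ∀ {n} k cs (ρ : Vec ℕ n) → evalᶜ (k ⊠ cs) ρ ≡ k * evalᶜ cs ρ
evalᶜ-⊠ k [] ρ = sym (*-zeroʳ k)
evalᶜ-⊠ k (c ∷ cs) [] = refl
evalᶜ-⊠ k (c ∷ cs) (x ∷ ρ) rewrite evalᶜ-⊠ k cs ρ =
  solve 4 (λ k c x u → k ⊛ c ⊛ x ⊹ k ⊛ u := k ⊛ (c ⊛ x ⊹ u)) refl k c x (evalᶜ cs ρ)

evalᶜ-unit : ∀ {n} i (ρ : Vec ℕ n) → evalᶜ (unit i) ρ ≡ lookup ρ i
evalᶜ-unit zero (x ∷ ρ) = trans (+-identityʳ _) (*-identityˡ x)
evalᶜ-unit (suc i) (x ∷ ρ) = evalᶜ-unit i ρ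

eval-coeffs : ∀ {n} (e : Lin n) ρ → eval (coeffs e) ρ ≡ ⟦ e ⟧ ρ
eval-coeffs (var i) ρ = evalᶜ-unit i ρ
eval-coeffs (lit k) ρ = trans (+-identityʳ _) (*-identityʳ k)
eval-coeffs (e :+ f) ρ = trans (evalᶜ-⊞ (coeffs e) (coeffs f) (1 ∷ ρ))
  (cong₂ _+_ (eval-coeffs e ρ) (eval-coeffs f ρ))
eval-coeffs (k :* e) ρ = trans (evalᶜ-⊠ k (coeffs e) (1 ∷ ρ)) (cong (k *_) (eval-coeffs e ρ))

_≼_ : Coeffs → Coeffs → Bool
[] ≼ ds = true
(c ∷ cs) ≼ [] = (c ≡ᵇ 0) ∧ (cs ≼ [])
(c ∷ cs) ≼ (d ∷ ds) = (c ≤ᵇ d) ∧ (cs ≼ ds)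

∧-T : ∀ {x y} → T (x ∧ y) → T x × T y
∧-T {true} {true} _ = tt , tt

≼-sound : ∀ {n} cs ds (ρ : Vec ℕ n) → T (cs ≼ ds) → evalᶜ cs ρ ≤ evalᶜ ds ρ
≼-sound [] ds ρ t = z≤n
≼-sound (c ∷ cs) [] ρ t with ∧-T {c ≡ᵇ 0} t
≼-sound (c ∷ cs) [] [] t | c0 , _ = ≤-reflexive (≡ᵇ⇒≡ c 0 c0)
≼-sound (c ∷ cs) [] (x ∷ ρ) t | c0 , t′ rewrite ≡ᵇ⇒≡ c 0 c0 = ≼-sound cs [] ρ t′
≼-sound (c ∷ cs) (d ∷ ds) ρ t with ∧-T {c ≤ᵇ d} t
≼-sound (c ∷ cs) (d ∷ ds) [] t | c≤d , _ = ≤ᵇ⇒≤ c d c≤d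
≼-sound (c ∷ cs) (d ∷ ds) (x ∷ ρ) t | c≤d , t′ =
  +-mono-≤ (*-monoˡ-≤ x (≤ᵇ⇒≤ c d c≤d)) (≼-sound cs ds ρ t′)

-- An inequality `lhs` ≤ `rhs` met during elimination. `mult` records how often the negated goal
-- (first entry) and each hypothesis enter it, so a contradictory row carries its own certificate.
record Row : Set where
  constructor row
  field
    mult : Coeffs
    lhs rhs : Coeffs
open Row

combine : ∀ {n} → List ℕ → List (Ineq n) → Coeffs × Coeffs
combine [] _ = [] , []
combine (k ∷ ks) [] = [] , []
combine (k ∷ ks) ((e :≤ f) ∷ hs) with combine ks hs
... | l , r = (k ⊠ coeffs e) ⊞ l , (k ⊠ coeffs f) ⊞ r

data Holds {n} (ρ : Vec ℕ n) : List (Ineq n) → Set where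
  []  : Holds ρ []
  _∷_ : ∀ {h hs} → ⟦ h ⟧≤ ρ → Holds ρ hs → Holds ρ (h ∷ hs)

combine-sound : ∀ {n} ks hs (ρ : Vec ℕ n) → Holds ρ hs →
  eval (proj₁ (combine ks hs)) ρ ≤ eval (proj₂ (combine ks hs)) ρ
combine-sound [] hs ρ H = z≤n
combine-sound (k ∷ ks) [] ρ H = z≤n
combine-sound (k ∷ ks) ((e :≤ f) ∷ hs) ρ (p ∷ H)
  rewrite evalᶜ-⊞ (k ⊠ coeffs e) (proj₁ (combine ks hs)) (1 ∷ ρ)
        | evalᶜ-⊞ (k ⊠ coeffs f) (proj₂ (combine ks hs)) (1 ∷ ρ)
        | evalᶜ-⊠ k (coeffs e) (1 ∷ ρ) | evalᶜ-⊠ k (coeffs f) (1 ∷ ρ)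
        | eval-coeffs e ρ | eval-coeffs f ρ
  = +-mono-≤ (*-monoʳ-≤ k p) (combine-sound ks hs ρ H)

-- The summand k on the right (against k + 1 copies of the goal) accounts for integrality.
accepts : ∀ {n} → ℕ → List ℕ → Problem n → Bool
accepts k ks (hs ⊢ x :≤ y) with combine ks hs
... | l , r = ((suc k ⊠ coeffs x) ⊞ r) ≼ (((suc k ⊠ coeffs y) ⊞ l) ⊞ (k ∷ []))

accepts-sound : ∀ {n} k ks hs x y (ρ : Vec ℕ n) → T (accepts k ks (hs ⊢ x :≤ y)) → Holds ρ hs →
  ⟦ x ⟧ ρ ≤ ⟦ y ⟧ ρ
accepts-sound k ks hs x y ρ t H = *-cancelˡ-≤′ (+-cancelʳ-≤ R _ _ main)
  where
  L = eval (proj₁ (combine ks hs)) ρ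
  R = eval (proj₂ (combine ks hs)) ρ
  l = proj₁ (combine ks hs)
  r = proj₂ (combine ks hs)
  *-cancelˡ-≤′ : ∀ {u v} → suc k * u ≤ suc k * v + k → u ≤ v
  *-cancelˡ-≤′ {u} {v} p = ≤-pred (*-cancelˡ-< (suc k) u (suc v)
    (≤-trans (s≤s p) (≤-reflexive (solve 2 (λ k v →
      con 1 ⊹ ((con 1 ⊹ k) ⊛ v ⊹ k) := (con 1 ⊹ k) ⊛ (con 1 ⊹ v)) refl k v))))
  left : eval ((suc k ⊠ coeffs x) ⊞ r) ρ ≡ suc k * ⟦ x ⟧ ρ + R
  left = trans (evalᶜ-⊞ (suc k ⊠ coeffs x) r (1 ∷ ρ))
    (cong (_+ R) (trans (evalᶜ-⊠ (suc k) (coeffs x) (1 ∷ ρ)) (cong (suc k *_) (eval-coeffs x ρ))))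
  right : eval (((suc k ⊠ coeffs y) ⊞ l) ⊞ (k ∷ [])) ρ ≡ suc k * ⟦ y ⟧ ρ + L + k
  right = trans (evalᶜ-⊞ ((suc k ⊠ coeffs y) ⊞ l) (k ∷ []) (1 ∷ ρ)) (cong₂ _+_
    (trans (evalᶜ-⊞ (suc k ⊠ coeffs y) l (1 ∷ ρ)) (cong (_+ L)
      (trans (evalᶜ-⊠ (suc k) (coeffs y) (1 ∷ ρ)) (cong (suc k *_) (eval-coeffs y ρ)))))
    (trans (+-identityʳ _) (*-identityʳ k)))
  main : suc k * ⟦ x ⟧ ρ + R ≤ (suc k * ⟦ y ⟧ ρ + k) + R
  main = begin
    suc k * ⟦ x ⟧ ρ + R      ≡⟨ left ⟨
    eval ((suc k ⊠ coeffs x) ⊞ r) ρ ≤⟨ ≼-sound ((suc k ⊠ coeffs x) ⊞ r) (((suc k ⊠ coeffs y) ⊞ l) ⊞ (k ∷ [])) (1 ∷ ρ) t ⟩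
    eval (((suc k ⊠ coeffs y) ⊞ l) ⊞ (k ∷ [])) ρ ≡⟨ right ⟩
    suc k * ⟦ y ⟧ ρ + L + k  ≤⟨ +-monoˡ-≤ k (+-monoʳ-≤ (suc k * ⟦ y ⟧ ρ) (combine-sound ks hs ρ H)) ⟩
    suc k * ⟦ y ⟧ ρ + R + k  ≡⟨ solve 3 (λ u v w → u ⊹ v ⊹ w := u ⊹ w ⊹ v) refl (suc k * ⟦ y ⟧ ρ) R k ⟩
    (suc k * ⟦ y ⟧ ρ + k) + R ∎
    where open ≤-Reasoning

refutes : ∀ {n} → List ℕ → Problem n → Bool
refutes ks (hs ⊢ _) with combine ks hs
... | l , r = ((1 ∷ []) ⊞ r) ≼ l

refutes-sound : ∀ {n} ks hs g (ρ : Vec ℕ n) → T (refutes ks (hs ⊢ g)) → Holds ρ hs → ⊥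
refutes-sound ks hs g ρ t H = <-irrefl refl (begin-strict
  eval r ρ                 <⟨ ≤-refl ⟩
  1 + eval r ρ             ≡⟨ evalᶜ-⊞ (1 ∷ []) r (1 ∷ ρ) ⟨
  eval ((1 ∷ []) ⊞ r) ρ    ≤⟨ ≼-sound ((1 ∷ []) ⊞ r) l (1 ∷ ρ) t ⟩
  eval l ρ                 ≤⟨ combine-sound ks hs ρ H ⟩
  eval r ρ                 ∎)
  where
  open ≤-Reasoning
  l = proj₁ (combine ks hs)
  r = proj₂ (combine ks hs)

coeffAt : ℕ → Coeffs → ℕ
coeffAt _ [] = 0
coeffAt zero (c ∷ cs) = c
coeffAt (suc i) (c ∷ cs) = coeffAt i cs

_⊟_ : Coeffs → Coeffs → Coeffs
[] ⊟ ds = []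
(c ∷ cs) ⊟ [] = c ∷ cs
(c ∷ cs) ⊟ (d ∷ ds) = c ∸ d ∷ cs ⊟ ds

reduce : Row → Row
reduce (row m l r) = row m (l ⊟ r) (r ⊟ l)

resolve : ℕ → Row → Row → Row
resolve i p q = reduce (row ((b ⊠ mult p) ⊞ (a ⊠ mult q)) ((b ⊠ lhs p) ⊞ (a ⊠ lhs q)) ((b ⊠ rhs p) ⊞ (a ⊠ rhs q)))
  where
  a = coeffAt i (lhs p)
  b = coeffAt i (rhs q)

-- Rows with the i-th variable on the right only are dropped: ρ i ≥ 0 is used via
-- weakening a row by erasing the variable from its left-hand side.
erase : ℕ → Row → Row
erase i (row m l r) = row m (go i l) r
  where
  go : ℕ → Coeffs → Coeffs
  go _ [] = []
  go zero (c ∷ cs) = 0 ∷ cs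
  go (suc i) (c ∷ cs) = c ∷ go i cs

select : (Row → Bool) → List Row → List Row
select p [] = []
select p (x ∷ xs) = if p x then x ∷ select p xs else select p xs

contradictory : Row → Bool
contradictory (row m l r) = (r ≼ l) ∧ (1 ≤ᵇ coeffAt 0 l)

eliminate : ℕ → List Row → List Row
eliminate i rs = concatMap (λ p → erase i p ∷ map (resolve i p) neg) pos ++ rest
  where
  pos = select (λ r → 1 ≤ᵇ coeffAt i (lhs r)) rs
  neg = select (λ r → 1 ≤ᵇ coeffAt i (rhs r)) rs
  rest = select (λ r → (coeffAt i (lhs r) ≡ᵇ 0) ∧ (coeffAt i (rhs r) ≡ᵇ 0)) rs

firstContradiction : List Row → List Row → Coeffs
firstContradiction [] rs = []
firstContradiction (x ∷ xs) rs = if contradictory x then mult x else firstContradiction xs rs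

cost : ℕ → List Row → ℕ
cost i rs = length (select (λ r → 1 ≤ᵇ coeffAt i (lhs r)) rs) * length (select (λ r → 1 ≤ᵇ coeffAt i (rhs r)) rs)

-- Eliminating first the variable with the fewest pairs of opposite occurrences limits the growth of
-- the system.
cheapest : ℕ → List ℕ → List Row → ℕ × List ℕ
cheapest i [] rs = i , []
cheapest i (j ∷ js) rs with cheapest j js rs
... | k , ks = if cost i rs ≤ᵇ cost k rs then (i , k ∷ ks) else (k , i ∷ ks)

search : ℕ → List ℕ → List Row → Coeffs
search zero _ rs = firstContradiction rs rs
search (suc fuel) [] rs = firstContradiction rs rs
search (suc fuel) (i ∷ is) rs with cheapest i is rs
... | j , js = search fuel js (eliminate j rs)

rows : ∀ {n} → ℕ → List (Ineq n) → List Row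
rows i [] = []
rows i ((e :≤ f) ∷ hs) = reduce (row (replicate i 0 ++ 1 ∷ []) (coeffs e) (coeffs f)) ∷ rows (suc i) hs

multipliers : ∀ {n} → Problem n → Coeffs
multipliers {n} (hs ⊢ x :≤ y) = search n (variables n)
  (reduce (row (1 ∷ []) ((1 ∷ []) ⊞ coeffs y) (coeffs x)) ∷ rows 1 hs)
  where
  variables : ℕ → List ℕ
  variables zero = []
  variables (suc i) = suc i ∷ variables i

-- The leading multiplier belongs to the negated goal: if it is zero the hypotheses contradict each
-- other, and if it is `suc k` they imply `suc k` times the goal up to the rounding term k.
decide : ∀ {n} → Problem n → Bool
decide P with multipliers P
... | [] = accepts 0 [] P
... | zero ∷ ks = refutes ks P
... | suc k ∷ ks = accepts k ks P

abstract
  decide-sound : ∀ {n} hs x y (ρ : Vec ℕ n) → T (decide (hs ⊢ x :≤ y)) → Holds ρ hs → ⟦ x ⟧ ρ ≤ ⟦ y ⟧ ρ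
  decide-sound hs x y ρ t H with multipliers (hs ⊢ x :≤ y)
  ... | [] = accepts-sound 0 [] hs x y ρ t H
  ... | zero ∷ ks = ⊥-elim (refutes-sound ks hs (x :≤ y) ρ t H)
  ... | suc k ∷ ks = accepts-sound k ks hs x y ρ t H

  curry-Holds : ∀ {n} hs g (ρ : Vec ℕ n) → (Holds ρ hs → ⟦ g ⟧≤ ρ) → ⟦ hs ⊢ g ⟧⊢ ρ
  curry-Holds [] g ρ f = f []
  curry-Holds (h ∷ hs) g ρ f = λ p → curry-Holds hs g ρ (λ H → f (p ∷ H))

vars : ∀ {n} → Vec (Lin n) n
vars = tabulate var

abstract
  curry-decide-sound : ∀ {n} (P : Problem n) (ρ : Vec ℕ n) → T (decide P) → ⟦ P ⟧⊢ ρ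
  curry-decide-sound (hs ⊢ x :≤ y) ρ t = curry-Holds hs (x :≤ y) ρ (decide-sound hs x y ρ t)

lin : ∀ {n} (ρ : Vec ℕ n) (P : N-ary n (Lin n) (Problem n)) → {T (decide (P $ⁿ vars))} → ⟦ P $ⁿ vars ⟧⊢ ρ
lin ρ P {t} = curry-decide-sound (P $ⁿ vars) ρ t

-- Truth tables, and sums and counts over initial segments of ℕ.

χ : Bool → ℕ
χ true = 1
χ false = 0

-- Most set estimates below are sums of pointwise inequalities between indicators of memberships,
-- and those are settled by running through all truth values.
tautᵇ : ∀ n → N-ary n Bool ℕ → N-ary n Bool ℕ → Bool
tautᵇ zero f g = f ≤ᵇ g
tautᵇ (suc n) f g = tautᵇ n (f true) (g true) ∧ tautᵇ n (f false) (g false)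

abstract
  taut : ∀ {n} (ρ : Vec Bool n) (f g : N-ary n Bool ℕ) → {T (tautᵇ n f g)} → (f $ⁿ ρ) ≤ (g $ⁿ ρ)
  taut [] f g {t} = ≤ᵇ⇒≤ f g t
  taut {suc n} (true ∷ ρ) f g {t} = taut ρ (f true) (g true) {proj₁ (∧-T {tautᵇ n (f true) (g true)} t)}
  taut {suc n} (false ∷ ρ) f g {t} = taut ρ (f false) (g false) {proj₂ (∧-T {tautᵇ n (f true) (g true)} t)}

sum< : (ℕ → ℕ) → ℕ → ℕ
sum< f zero = 0
sum< f (suc n) = sum< f n + f n

cnt : (ℕ → Bool) → ℕ → ℕ
cnt p = sum< (λ i → χ (p i))

sum<-mono : ∀ f g n → (∀ i → i < n → f i ≤ g i) → sum< f n ≤ sum< g n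
sum<-mono f g zero H = z≤n
sum<-mono f g (suc n) H = +-mono-≤ (sum<-mono f g n (λ i i<n → H i (m<n⇒m<1+n i<n))) (H n ≤-refl)

sum<-cong : ∀ f g n → (∀ i → i < n → f i ≡ g i) → sum< f n ≡ sum< g n
sum<-cong f g n H = ≤-antisym (sum<-mono f g n (λ i l → ≤-reflexive (H i l)))
  (sum<-mono g f n (λ i l → ≤-reflexive (sym (H i l))))

interchange : ∀ a b c d → (a + b) + (c + d) ≡ (a + c) + (b + d)
interchange = solve 4 (λ a b c d → (a ⊹ b) ⊹ (c ⊹ d) := (a ⊹ c) ⊹ (b ⊹ d)) refl

sum<-+ : ∀ f g n → sum< (λ i → f i + g i) n ≡ sum< f n + sum< g n
sum<-+ f g zero = refl
sum<-+ f g (suc n) rewrite sum<-+ f g n = interchange (sum< f n) (sum< g n) (f n) (g n)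

sum<-const : ∀ c n → sum< (λ _ → c) n ≡ n * c
sum<-const c zero = refl
sum<-const c (suc n) rewrite sum<-const c n = +-comm (n * c) c

sum<-1 : ∀ n → sum< (λ _ → 1) n ≡ n
sum<-1 n = trans (sum<-const 1 n) (*-identityʳ n)

sum<-split : ∀ f m n → sum< f (m + n) ≡ sum< f m + sum< (λ i → f (m + i)) n
sum<-split f m zero = trans (cong (sum< f) (+-identityʳ m)) (sym (+-identityʳ _))
sum<-split f m (suc n) = trans (cong (sum< f) (+-suc m n))
  (trans (cong (_+ f (m + n)) (sum<-split f m n)) (+-assoc (sum< f m) _ _))

sum<-shift : ∀ f m n l → m + n ≤ l → sum< (λ i → f (m + i)) n ≤ sum< f l
sum<-shift f m n l m+n≤l with m≤n⇒∃[o]m+o≡n m+n≤l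
... | o , refl rewrite sum<-split f (m + n) o | sum<-split f m n =
  ≤-trans (m≤n+m _ (sum< f m)) (m≤m+n _ _)

sum<-monoʳ : ∀ f {m n} → m ≤ n → sum< f m ≤ sum< f n
sum<-monoʳ f {m} {n} m≤n = sum<-shift f 0 m n m≤n

sum<-suc : ∀ f n → sum< f (suc n) ≡ f 0 + sum< (λ i → f (suc i)) n
sum<-suc f n = sum<-split f 1 n

sum<-reverse : ∀ f m → sum< (λ i → f (m ∸ i)) (suc m) ≡ sum< f (suc m)
sum<-reverse f zero = refl
sum<-reverse f (suc m) = begin
  sum< (λ i → f (suc m ∸ i)) (2 + m)                ≡⟨ sum<-suc (λ i → f (suc m ∸ i)) (suc m) ⟩
  f (suc m) + sum< (λ i → f (m ∸ i)) (suc m)        ≡⟨ cong (f (suc m) +_) (sum<-reverse f m) ⟩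
  f (suc m) + sum< f (suc m)                        ≡⟨ +-comm (f (suc m)) _ ⟩
  sum< f (suc m) + f (suc m)                        ∎
  where open ≡-Reasoning

sum<-2 : ∀ f g k n → (∀ i → i < n → f i ≤ g i + k i) → sum< f n ≤ sum< g n + sum< k n
sum<-2 f g k n H = ≤-trans (sum<-mono f (λ i → g i + k i) n H) (≤-reflexive (sum<-+ g k n))

sum<-3 : ∀ f g k l n → (∀ i → i < n → f i ≤ g i + k i + l i) → sum< f n ≤ sum< g n + sum< k n + sum< l n
sum<-3 f g k l n H = ≤-trans (sum<-2 f (λ i → g i + k i) l n H)
  (+-monoˡ-≤ (sum< l n) (≤-reflexive (sum<-+ g k n)))

sum<-2-2 : ∀ f g k l n → (∀ i → i < n → f i + g i ≤ k i + l i) → sum< f n + sum< g n ≤ sum< k n + sum< l n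
sum<-2-2 f g k l n H = ≤-trans (≤-reflexive (sym (sum<-+ f g n)))
  (sum<-2 (λ i → f i + g i) k l n H)

cnt≤ : ∀ p n → cnt p n ≤ n
cnt≤ p n = ≤-trans (sum<-mono _ (λ _ → 1) n (λ i _ → taut (p i ∷ []) χ (λ _ → 1))) (≤-reflexive (sum<-1 n))

cnt-not : ∀ p n → cnt p n + cnt (λ i → not (p i)) n ≡ n
cnt-not p n = trans (sym (sum<-+ _ _ n)) (trans (sum<-cong _ (λ _ → 1) n (λ i _ → χ-not (p i))) (sum<-1 n))
  where
  χ-not : ∀ x → χ x + χ (not x) ≡ 1
  χ-not true = refl
  χ-not false = refl

cnt-false : ∀ p n → (∀ i → i < n → p i ≡ false) → cnt p n ≡ 0
cnt-false p n H = trans (sum<-cong _ (λ _ → 0) n (λ i l → cong χ (H i l))) (trans (sum<-const 0 n) (*-zeroʳ n))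

χ-≤ : ∀ {x y} → (x ≡ true → y ≡ true) → χ x ≤ χ y
χ-≤ {false} H = z≤n
χ-≤ {true} H rewrite H refl = ≤-refl

cnt-⊆ : ∀ p q n → (∀ i → i < n → p i ≡ true → q i ≡ true) → cnt p n ≤ cnt q n
cnt-⊆ p q n H = sum<-mono _ _ n (λ i l → χ-≤ (H i l))

∧-true : ∀ {x y} → x ≡ true → y ≡ true → x ∧ y ≡ true
∧-true refl refl = refl

∧-true⁻ : ∀ {x y} → x ∧ y ≡ true → x ≡ true × y ≡ true
∧-true⁻ {true} {true} refl = refl , refl

false≢true : false ≡ true → ⊥
false≢true ()

not-true : ∀ {x} → not x ≡ true → x ≡ false
not-true {false} _ = refl

not-false : ∀ {x} → x ≡ false → not x ≡ true
not-false refl = refl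

bool? : (x : Bool) → x ≡ true ⊎ x ≡ false
bool? true = inj₁ refl
bool? false = inj₂ refl

cnt-witness : ∀ p n → 0 < cnt p n → ∃[ i ] (i < n × p i ≡ true)
cnt-witness p (suc n) c>0 with bool? (p n)
... | inj₁ pn = n , ≤-refl , pn
... | inj₂ ¬pn with cnt-witness p n (subst (0 <_) (trans (cong (λ x → cnt p n + χ x) ¬pn) (+-identityʳ _)) c>0)
...   | i , i<n , pi = i , m<n⇒m<1+n i<n , pi

greatest : ∀ (p : ℕ → Bool) n → (∀ i → i ≤ n → p i ≡ false) ⊎ ∃[ m ] (m ≤ n × p m ≡ true × (∀ i → m < i → i ≤ n → p i ≡ false))
greatest p n with bool? (p n)
... | inj₁ pn = inj₂ (n , ≤-refl , pn , λ i n<i i≤n → ⊥-elim (<⇒≱ n<i i≤n))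
greatest p zero | inj₂ ¬p0 = inj₁ λ { zero _ → ¬p0 }
greatest p (suc n) | inj₂ ¬pn with greatest p n
... | inj₁ none = inj₁ λ i i≤ → case i (m≤n⇒m<n∨m≡n i≤) none ¬pn
  where
  case : ∀ i → i < suc n ⊎ i ≡ suc n → (∀ i → i ≤ n → p i ≡ false) → p (suc n) ≡ false → p i ≡ false
  case i (inj₁ i<) none _ = none i (≤-pred i<)
  case i (inj₂ refl) _ q = q
... | inj₂ (m , m≤n , pm , above) = inj₂ (m , m≤n⇒m≤1+n m≤n , pm , λ i m<i i≤ → case i m<i (m≤n⇒m<n∨m≡n i≤))
  where
  case : ∀ i → m < i → i < suc n ⊎ i ≡ suc n → p i ≡ false
  case i m<i (inj₁ i<) = above i m<i (≤-pred i<)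
  case i m<i (inj₂ refl) = ¬pn

least : ∀ (p : ℕ → Bool) m → p m ≡ true → ∃[ x ] (x ≤ m × p x ≡ true × (∀ i → i < x → p i ≡ false))
least p m pm with bool? (p 0)
... | inj₁ p0 = 0 , z≤n , p0 , λ i ()
least p zero pm | inj₂ ¬p0 = ⊥-elim (false≢true (trans (sym ¬p0) pm))
least p (suc m) pm | inj₂ ¬p0 with least (λ i → p (suc i)) m pm
... | x , x≤m , px , below = suc x , s≤s x≤m , px , λ { zero _ → ¬p0 ; (suc i) i< → below i (≤-pred i<) }

-- Sets with few sums: reflection in the largest element.

_⊆_ : (P Q : ℕ → Bool) → Set
P ⊆ Q = ∀ x → P x ≡ true → Q x ≡ true

cnt-≤χ : ∀ {P Q} n → P ⊆ Q → cnt P n ≤ cnt Q n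
cnt-≤χ n P⊆Q = cnt-⊆ _ _ n (λ i _ → P⊆Q i)

-- An element b of B occurs either as the total of a sum, or as a summand; in both cases y in C is a
-- summand and the remaining term is in A. In `differences` y stops at b, so that the truncated
-- `b ∸ y` is a true difference.
record FewSums (A B C : ℕ → Bool) (n K : ℕ) : Set where
  field
    B⊆C : B ⊆ C
    C⊆A : C ⊆ A
    differences : ∀ b → B b ≡ true → cnt (λ y → C y ∧ A (b ∸ y)) (suc b) ≤ K
    sums : ∀ b → B b ≡ true → cnt (λ y → C y ∧ A (y + b)) (suc n) ≤ K
  B⊆A : B ⊆ A
  B⊆A x Bx = C⊆A x (B⊆C x Bx)

-- Here n = m + h, and m is the largest element of B up to n. The counts `a`, `b`, `c` refer to
-- [0, m]; `c′` refers to the gap of length h above m, where B is empty.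
module Top (A B C : ℕ → Bool) (m h K E : ℕ) (few : FewSums A B C (m + h) K)
  (top : B m ≡ true) (above : ∀ x → m < x → x ≤ m + h → B x ≡ false)
  (large : m + h ≤ cnt B (suc (m + h)) + cnt C (suc (m + h)) + E) where
  open FewSums few

  -- The common error unit. Its 1 comes from [0, m] having m + 1 elements.
  e : ℕ
  e = 1 + K + E

  a b c c′ : ℕ
  a = cnt A (suc m)
  b = cnt B (suc m)
  c = cnt C (suc m)
  c′ = cnt (λ i → C (suc m + i)) h

  -- The reflected set m - A meets C in at most K points, and both lie in [0, m].
  a+c : a + c ≤ suc m + K
  a+c = begin
    a + c ≡⟨ cong (_+ c) (sum<-reverse (λ y → χ (A y)) m) ⟨
    cnt (λ y → A (m ∸ y)) (suc m) + c
      ≤⟨ sum<-2-2 _ _ (λ _ → 1) (λ y → χ (C y ∧ A (m ∸ y))) (suc m) (λ y _ →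
         taut (C y ∷ A (m ∸ y) ∷ []) (λ c a → χ a + χ c) (λ c a → 1 + χ (c ∧ a))) ⟩
    sum< (λ _ → 1) (suc m) + cnt (λ y → C y ∧ A (m ∸ y)) (suc m)
      ≤⟨ +-mono-≤ (≤-reflexive (sum<-1 (suc m))) (differences m top) ⟩
    suc m + K ∎
    where open ≤-Reasoning

  b≤c : b ≤ c
  b≤c = cnt-≤χ (suc m) B⊆C

  c≤a : c ≤ a
  c≤a = cnt-≤χ (suc m) C⊆A

  large′ : m + h ≤ b + c + c′ + E
  large′ = lin (m + h ∷ cnt B (suc (m + h)) ∷ cnt C (suc (m + h)) ∷ E ∷ b ∷ c ∷ c′ ∷ cnt (λ i → B (suc m + i)) h ∷ [])
    (λ m B C E b c c′ b′ → (m :≤ B :+ C :+ E) ∷ (B :≤ b :+ b′) ∷ (C :≤ c :+ c′) ∷ (b′ :≤ lit 0) ∷ [] ⊢ m :≤ b :+ c :+ c′ :+ E)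
    large (≤-reflexive (sum<-split _ (suc m) h)) (≤-reflexive (sum<-split _ (suc m) h))
    (≤-reflexive (cnt-false _ h (λ i i<h → above (suc m + i) (s≤s (m≤m+n m i))
      (≤-trans (≤-reflexive (sym (+-suc m i))) (+-monoʳ-≤ m i<h)))))

  -- Since b ≤ a, the bound on a + c also bounds b + c, which leaves the gap to supply all but e of
  -- h. The following estimates exploit the same lack of slack.
  missC : cnt (λ i → not (C (suc m + i))) h ≤ e
  missC = lin (m ∷ h ∷ a ∷ b ∷ c ∷ c′ ∷ cnt (λ i → not (C (suc m + i))) h ∷ K ∷ E ∷ [])
    (λ m h a b c c′ k K E → (m :+ h :≤ b :+ c :+ c′ :+ E) ∷ (a :+ c :≤ lit 1 :+ m :+ K) ∷ (b :≤ c) ∷ (c :≤ a)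
       ∷ (c′ :+ k :≤ h) ∷ [] ⊢ k :≤ lit 1 :+ K :+ E)
    large′ a+c b≤c c≤a (≤-reflexive (cnt-not _ h))

  missA : cnt (λ i → not (A (suc m + i))) h ≤ e
  missA = ≤-trans (sum<-mono _ _ h (λ i _ → not-χ (C⊆A (suc m + i)))) missC
    where
    not-χ : ∀ {x y} → (x ≡ true → y ≡ true) → χ (not y) ≤ χ (not x)
    not-χ {false} {y} H = taut (y ∷ []) (λ y → χ (not y)) (λ _ → 1)
    not-χ {true} H rewrite H refl = z≤n

  c′≤h : c′ ≤ h
  c′≤h = cnt≤ _ h

  a≤b+e : a ≤ b + e
  a≤b+e = lin (m ∷ h ∷ a ∷ b ∷ c ∷ c′ ∷ K ∷ E ∷ [])
    (λ m h a b c c′ K E → (m :+ h :≤ b :+ c :+ c′ :+ E) ∷ (a :+ c :≤ lit 1 :+ m :+ K) ∷ (c′ :≤ h) ∷ []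
       ⊢ a :≤ b :+ (lit 1 :+ K :+ E))
    large′ a+c c′≤h

  A∖B : cnt (λ y → A y ∧ not (B y)) (suc m) ≤ e
  A∖B = +-cancelˡ-≤ b _ _ (begin
    b + cnt (λ y → A y ∧ not (B y)) (suc m) ≡⟨ sum<-+ _ _ (suc m) ⟨
    sum< (λ y → χ (B y) + χ (A y ∧ not (B y))) (suc m) ≤⟨ sum<-mono _ _ (suc m) (λ y _ → pointwise (B⊆A y)) ⟩
    a ≤⟨ a≤b+e ⟩
    b + e ∎)
    where
    open ≤-Reasoning
    pointwise : ∀ {x y} → (x ≡ true → y ≡ true) → χ x + χ (y ∧ not x) ≤ χ y
    pointwise {false} {y} H = taut (y ∷ []) (λ y → χ (y ∧ true)) χ
    pointwise {true} H rewrite H refl = ≤-refl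

  m≤2b : m ≤ 2 * b + 2 * e
  m≤2b = lin (m ∷ h ∷ a ∷ b ∷ c ∷ c′ ∷ K ∷ E ∷ [])
    (λ m h a b c c′ K E → (m :+ h :≤ b :+ c :+ c′ :+ E) ∷ (c :≤ a) ∷ (a :≤ b :+ (lit 1 :+ K :+ E)) ∷ (c′ :≤ h) ∷ []
       ⊢ m :≤ 2 :* b :+ 2 :* (lit 1 :+ K :+ E))
    large′ c≤a a≤b+e c′≤h

  neither : ℕ → Bool
  neither y = not (B y) ∧ not (B (m ∸ y))

  B-sums : ∀ t → B t ≡ true → cnt (λ y → B y ∧ B (y + t)) (suc (m + h)) ≤ K
  B-sums t Bt = ≤-trans (cnt-⊆ _ _ _ (λ y _ p → ∧-true (B⊆C y (proj₁ (∧-true⁻ p))) (B⊆A _ (proj₂ (∧-true⁻ {B y} p))))) (sums t Bt)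

  B-differences : ∀ t → B t ≡ true → cnt (λ y → B y ∧ B (t ∸ y)) (suc t) ≤ K
  B-differences t Bt = ≤-trans (cnt-⊆ _ _ _ (λ y _ p → ∧-true (B⊆C y (proj₁ (∧-true⁻ p))) (B⊆A _ (proj₂ (∧-true⁻ {B y} p))))) (differences t Bt)

  -- Inclusion and exclusion for B and its reflection m - B: their sizes add up to nearly m and they
  -- hardly meet, so together they nearly cover [0, m].
  few-neither : cnt neither (suc m) ≤ 2 * e
  few-neither = lin (m ∷ h ∷ a ∷ b ∷ c ∷ c′ ∷ K ∷ E ∷ cnt neither (suc m) ∷ cnt (λ y → B y ∧ B (m ∸ y)) (suc m) ∷ [])
    (λ m h a b c c′ K E N D → (m :+ h :≤ b :+ c :+ c′ :+ E) ∷ (c :≤ a) ∷ (a :≤ b :+ (lit 1 :+ K :+ E)) ∷ (c′ :≤ h)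
       ∷ (b :+ b :+ N :≤ lit 1 :+ m :+ D) ∷ (D :≤ K) ∷ []
       ⊢ N :≤ 2 :* (lit 1 :+ K :+ E))
    large′ c≤a a≤b+e c′≤h incl-excl (B-differences m top)
    where
    open ≤-Reasoning
    incl-excl : b + b + cnt neither (suc m) ≤ suc m + cnt (λ y → B y ∧ B (m ∸ y)) (suc m)
    incl-excl = begin
      b + b + cnt neither (suc m)
        ≡⟨ cong (λ x → b + x + cnt neither (suc m)) (sum<-reverse (λ y → χ (B y)) m) ⟨
      b + cnt (λ y → B (m ∸ y)) (suc m) + cnt neither (suc m)
        ≡⟨ cong (_+ cnt neither (suc m)) (sum<-+ _ _ (suc m)) ⟨
      sum< (λ y → χ (B y) + χ (B (m ∸ y))) (suc m) + cnt neither (suc m)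
        ≤⟨ sum<-2-2 _ _ (λ _ → 1) (λ y → χ (B y ∧ B (m ∸ y))) (suc m) (λ y _ →
           taut (B y ∷ B (m ∸ y) ∷ []) (λ x y → χ x + χ y + χ (not x ∧ not y)) (λ x y → 1 + χ (x ∧ y))) ⟩
      sum< (λ _ → 1) (suc m) + cnt (λ y → B y ∧ B (m ∸ y)) (suc m) ≡⟨ cong (_+ cnt (λ y → B y ∧ B (m ∸ y)) (suc m)) (sum<-1 (suc m)) ⟩
      suc m + cnt (λ y → B y ∧ B (m ∸ y)) (suc m) ∎

  -- The q integers from m + 1 - x on reflect to integers below x, the least element of B, so nearly
  -- all of them are in B themselves. Adding x carries them into the gap, which A nearly fills, so x
  -- is a summand about q times.
  short-overlap : ∀ x q → B x ≡ true → (∀ i → i < x → B i ≡ false) → x ≤ m → q ≤ x → q ≤ h → q ≤ 4 * e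
  short-overlap x q Bx below x≤m q≤x q≤h = lin (q ∷ N ∷ M ∷ S ∷ K ∷ E ∷ [])
    (λ q N M S K E → (q :≤ N :+ M :+ S) ∷ (N :≤ 2 :* (lit 1 :+ K :+ E)) ∷ (M :≤ lit 1 :+ K :+ E) ∷ (S :≤ K) ∷ []
       ⊢ q :≤ 4 :* (lit 1 :+ K :+ E))
    cover
    (≤-trans (sum<-shift _ s q (suc m) (≤-trans (+-monoʳ-≤ s q≤x) (≤-reflexive s+x))) few-neither)
    (≤-trans (sum<-monoʳ _ q≤h) missA)
    (≤-trans (sum<-shift _ s q (suc (m + h)) (≤-trans (+-monoʳ-≤ s q≤x) (≤-trans (≤-reflexive s+x) (s≤s (m≤m+n m h))))) (sums x Bx))
    where
    s = suc m ∸ x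
    s+x : s + x ≡ suc m
    s+x = m∸n+n≡m (m≤n⇒m≤1+n x≤m)
    N = cnt (λ j → neither (s + j)) q
    M = cnt (λ j → not (A (suc m + j))) q
    S = cnt (λ j → C (s + j) ∧ A (s + j + x)) q
    s+j+x : ∀ j → s + j + x ≡ suc m + j
    s+j+x j = trans (solve 3 (λ s j x → s ⊹ j ⊹ x := s ⊹ x ⊹ j) refl s j x) (cong (_+ j) s+x)
    reflected< : ∀ j → j < q → m ∸ (s + j) < x
    reflected< j j<q = +-cancelˡ-< (s + j) _ _ (begin-strict
      s + j + (m ∸ (s + j)) ≡⟨ m+[n∸m]≡n (≤-pred (begin
         suc (s + j) ≡⟨ +-suc s j ⟨
         s + suc j ≤⟨ +-monoʳ-≤ s (≤-trans j<q q≤x) ⟩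
         s + x ≡⟨ s+x ⟩
         suc m ∎)) ⟩
      m <⟨ s≤s (m≤m+n m j) ⟩
      suc m + j ≡⟨ s+j+x j ⟨
      s + j + x ∎)
      where open ≤-Reasoning
    pointwise : ∀ {b b′ a a′ c} → b′ ≡ false → a′ ≡ a → (b ≡ true → c ≡ true) → 1 ≤ χ (not b ∧ not b′) + χ (not a) + χ (c ∧ a′)
    pointwise {false} refl refl H = s≤s z≤n
    pointwise {true} {a = a} refl refl H rewrite H refl = taut (a ∷ []) (λ _ → 1) (λ a → χ (not a) + χ a)
    cover : q ≤ N + M + S
    cover = ≤-trans (≤-reflexive (sym (sum<-1 q))) (sum<-3 _ _ _ _ q (λ j j<q →
      pointwise {b = B (s + j)} (below _ (reflected< j j<q)) (cong A (s+j+x j)) (B⊆C (s + j))))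

  -- Both C and A nearly fill the gap, so a translation by x that stays inside the gap gives a sum
  -- with summand x at almost every place.
  gap-after : ∀ x h′ → B x ≡ true → x + h′ ≡ h → h′ ≤ 3 * e
  gap-after x h′ Bx x+h′ = lin (h′ ∷ N ∷ M ∷ S ∷ K ∷ E ∷ [])
    (λ q N M S K E → (q :≤ N :+ M :+ S) ∷ (N :≤ lit 1 :+ K :+ E) ∷ (M :≤ lit 1 :+ K :+ E) ∷ (S :≤ K) ∷ []
       ⊢ q :≤ 3 :* (lit 1 :+ K :+ E))
    (≤-trans (≤-reflexive (sym (sum<-1 h′))) (sum<-3 _ _ _ _ h′ (λ i _ →
      taut (C (suc m + i) ∷ A (suc m + i + x) ∷ []) (λ _ _ → 1) (λ c a → χ (not c) + χ (not a) + χ (c ∧ a)))))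
    (≤-trans (sum<-monoʳ _ (≤-trans (m≤n+m h′ x) (≤-reflexive x+h′))) missC)
    (≤-trans (sum<-mono _ _ h′ (λ i _ → ≤-reflexive (cong (λ z → χ (not (A z))) (swap i))))
       (≤-trans (sum<-shift (λ i → χ (not (A (suc m + i)))) x h′ h (≤-reflexive x+h′)) missA))
    (≤-trans (sum<-shift _ (suc m) h′ (suc (m + h)) (s≤s (+-monoʳ-≤ m (≤-trans (m≤n+m h′ x) (≤-reflexive x+h′))))) (sums x Bx))
    where
    N = cnt (λ i → not (C (suc m + i))) h′
    M = cnt (λ i → not (A (suc m + i + x))) h′
    S = cnt (λ i → C (suc m + i) ∧ A (suc m + i + x)) h′
    swap : ∀ i → suc m + i + x ≡ suc m + (x + i)
    swap i = solve 3 (λ m i x → m ⊹ i ⊹ x := m ⊹ (x ⊹ i)) refl (suc m) i x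

  -- The gap is cut at length min(x, h) for the least element x of B: 4e for the first piece, 3e for
  -- the second.
  short-gap : h ≤ 7 * e
  short-gap with least B m top
  ... | x , x≤m , Bx , below with ≤-total x h
  ...   | inj₂ h≤x = ≤-trans (short-overlap x h Bx below x≤m h≤x ≤-refl) (*-monoˡ-≤ e {4} {7} (≤ᵇ⇒≤ 4 7 tt))
  ...   | inj₁ x≤h with m≤n⇒∃[o]m+o≡n x≤h
  ...     | h′ , refl = lin (x ∷ h′ ∷ e ∷ []) (λ x h′ e → (x :≤ 4 :* e) ∷ (h′ :≤ 3 :* e) ∷ [] ⊢ x :+ h′ :≤ 7 :* e)
    (short-overlap x x Bx below x≤m ≤-refl x≤h) (gap-after x h′ Bx refl)

-- Translations of B and parity.

sum<-4 : ∀ f g k l o n → (∀ i → i < n → f i ≤ g i + k i + l i + o i) →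
  sum< f n ≤ sum< g n + sum< k n + sum< l n + sum< o n
sum<-4 f g k l o n H = ≤-trans (sum<-2 f (λ i → g i + k i + l i) o n H)
  (+-monoˡ-≤ (sum< o n) (sum<-3 _ g k l n (λ _ _ → ≤-refl)))

sum<-shiftʳ : ∀ f m n l → n + m ≤ l → sum< (λ i → f (i + m)) n ≤ sum< f l
sum<-shiftʳ f m n l n+m≤l = ≤-trans (≤-reflexive (sum<-cong _ _ n (λ i _ → cong f (+-comm i m))))
  (sum<-shift f m n l (≤-trans (≤-reflexive (+-comm m n)) n+m≤l))

odd : ℕ → Bool
odd zero = false
odd (suc n) = not (odd n)

odd-+ : ∀ m n → odd (m + n) ≡ odd m xor odd n
odd-+ zero n = refl
odd-+ (suc m) n rewrite odd-+ m n = not-xor (odd m) (odd n)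
  where
  not-xor : ∀ x y → not (x xor y) ≡ not x xor y
  not-xor true true = refl
  not-xor true false = refl
  not-xor false y = refl

∸-from-+ : ∀ x y {m} → x + y ≡ m → m ∸ x ≡ y
∸-from-+ x y refl = m+n∸m≡n x y

-- Translation by t is studied on windows [0, l] with t + l + a = m: the reserve a leaves room for
-- one further translation by the fixed element a of B.
module Parity (B : ℕ → Bool) (m e a : ℕ) (Ba : B a ≡ true)
  (few-both : cnt (λ y → B y ∧ B (m ∸ y)) (suc m) ≤ e)
  (few-neither : cnt (λ y → not (B y) ∧ not (B (m ∸ y))) (suc m) ≤ 2 * e)
  (sums : ∀ t → B t ≡ true → cnt (λ y → B y ∧ B (y + t)) (suc m) ≤ e)
  (differences : ∀ t → B t ≡ true → cnt (λ y → B y ∧ B (t ∸ y)) (suc t) ≤ e) where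

  unmirrored : ℕ → Bool
  unmirrored y = not (B y xor B (m ∸ y))

  few-unmirrored : cnt unmirrored (suc m) ≤ 3 * e
  few-unmirrored = lin (e ∷ cnt unmirrored (suc m) ∷ _ ∷ _ ∷ [])
    (λ e u x y → (u :≤ x :+ y) ∷ (x :≤ e) ∷ (y :≤ 2 :* e) ∷ [] ⊢ u :≤ 3 :* e)
    (sum<-2 _ _ _ (suc m) (λ y _ → taut (B y ∷ B (m ∸ y) ∷ []) (λ x y → χ (not (x xor y)))
      (λ x y → χ (x ∧ y) + χ (not x ∧ not y)))) few-both few-neither

  -- If y and y + t are both in B, then t is a summand. If neither is, their mirror images in m
  -- usually both are, and these differ by t as well.
  flips : ∀ t l → B t ≡ true → t + l ≡ m → cnt (λ y → not (B y xor B (y + t))) (suc l) ≤ 8 * e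
  flips t l Bt t+l = lin (e ∷ cnt (λ y → not (B y xor B (y + t))) (suc l) ∷ w ∷ x ∷ y ∷ z ∷ [])
    (λ e c w x y z → (c :≤ w :+ x :+ y :+ z) ∷ (w :≤ e) ∷ (x :≤ 3 :* e) ∷ (y :≤ 3 :* e) ∷ (z :≤ e) ∷ [] ⊢ c :≤ 8 :* e)
    (sum<-4 _ (λ y → χ (B y ∧ B (y + t))) (λ y → χ (unmirrored y)) (λ y → χ (unmirrored (y + t)))
      (λ y → χ (B (l ∸ y) ∧ B (l ∸ y + t))) (suc l) pointwise)
    (≤-trans (sum<-monoʳ _ suc-l≤) (sums t Bt))
    (≤-trans (sum<-monoʳ _ suc-l≤) few-unmirrored)
    (≤-trans (sum<-shiftʳ _ t (suc l) (suc m) (≤-reflexive (cong suc (trans (+-comm l t) t+l)))) few-unmirrored)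
    (≤-trans (≤-reflexive (sum<-reverse (λ y → χ (B y ∧ B (y + t))) l)) (≤-trans (sum<-monoʳ _ suc-l≤) (sums t Bt)))
    where
    w = cnt (λ y → B y ∧ B (y + t)) (suc l)
    x = cnt unmirrored (suc l)
    y = cnt (λ y → unmirrored (y + t)) (suc l)
    z = cnt (λ y → B (l ∸ y) ∧ B (l ∸ y + t)) (suc l)
    suc-l≤ : suc l ≤ suc m
    suc-l≤ = s≤s (≤-trans (m≤n+m l t) (≤-reflexive t+l))
    pointwise : ∀ y → y < suc l → χ (not (B y xor B (y + t))) ≤
      χ (B y ∧ B (y + t)) + χ (unmirrored y) + χ (unmirrored (y + t)) + χ (B (l ∸ y) ∧ B (l ∸ y + t))
    pointwise y y≤l with m≤n⇒∃[o]m+o≡n (≤-pred y≤l)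
    ... | o , refl rewrite m+n∸m≡n y o
        | ∸-from-+ y (o + t) {m} (trans (solve 3 (λ y o t → y ⊹ (o ⊹ t) := t ⊹ (y ⊹ o)) refl y o t) t+l)
        | ∸-from-+ (y + t) o {m} (trans (solve 3 (λ y o t → y ⊹ t ⊹ o := t ⊹ (y ⊹ o)) refl y o t) t+l) =
      taut (B y ∷ B (y + t) ∷ B (o + t) ∷ B o ∷ []) (λ p q p′ q′ → χ (not (p xor q)))
        (λ p q p′ q′ → χ (p ∧ q) + χ (not (p xor p′)) + χ (not (q xor q′)) + χ (q′ ∧ p′))

  -- The mirror image of y + d is t - y. If y + d is missing from B, that image is usually present,
  -- and t = y + (t - y) is a sum inside B.
  rises : ∀ d t → B t ≡ true → d + t ≡ m → cnt (λ y → B y ∧ not (B (y + d))) (suc t) ≤ 4 * e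
  rises d t Bt d+t = lin (e ∷ cnt (λ y → B y ∧ not (B (y + d))) (suc t) ∷ cnt (λ y → unmirrored (y + d)) (suc t) ∷ cnt (λ y → B y ∧ B (t ∸ y)) (suc t) ∷ [])
    (λ e c x y → (c :≤ x :+ y) ∷ (x :≤ 3 :* e) ∷ (y :≤ e) ∷ [] ⊢ c :≤ 4 :* e)
    (sum<-2 _ (λ y → χ (unmirrored (y + d))) (λ y → χ (B y ∧ B (t ∸ y))) (suc t) pointwise)
    (≤-trans (sum<-shiftʳ _ d (suc t) (suc m) (≤-reflexive (cong suc (trans (+-comm t d) d+t)))) few-unmirrored)
    (differences t Bt)
    where
    pointwise : ∀ y → y < suc t → χ (B y ∧ not (B (y + d))) ≤ χ (unmirrored (y + d)) + χ (B y ∧ B (t ∸ y))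
    pointwise y y≤t with m≤n⇒∃[o]m+o≡n (≤-pred y≤t)
    ... | o , refl rewrite m+n∸m≡n y o
        | ∸-from-+ (y + d) o {m} (trans (solve 3 (λ y o t → y ⊹ t ⊹ o := t ⊹ (y ⊹ o)) refl y o d) d+t) =
      taut (B y ∷ B (y + d) ∷ B o ∷ []) (λ p q r → χ (p ∧ not q)) (λ p q r → χ (not (q xor r)) + χ (p ∧ r))

  -- Besides `rises`, the case y outside B, y + d in B has to be excluded. By `flips`, y + a is then
  -- in B; by `rises`, so is y + a + d; but y + d and y + d + a are then two elements of B at
  -- distance a.
  preserves : ∀ d t l → B t ≡ true → d + t ≡ m → d + l + a ≡ m → cnt (λ y → B y xor B (y + d)) (suc l) ≤ 17 * e
  preserves d t l Bt d+t d+l+a = lin (e ∷ cnt (λ y → B y xor B (y + d)) (suc l) ∷ w ∷ x ∷ y ∷ z ∷ [])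
    (λ e c w x y z → (c :≤ w :+ x :+ y :+ z) ∷ (w :≤ 4 :* e) ∷ (x :≤ 8 :* e) ∷ (y :≤ 4 :* e) ∷ (z :≤ e) ∷ [] ⊢ c :≤ 17 :* e)
    (sum<-4 _ (λ y → χ (B y ∧ not (B (y + d)))) (λ y → χ (not (B y xor B (y + a))))
      (λ y → χ (B (y + a) ∧ not (B (y + a + d)))) (λ y → χ (B (y + d) ∧ B (y + d + a))) (suc l)
      (λ y _ → pointwise y))
    (≤-trans (sum<-monoʳ _ (s≤s (≤-trans (m≤m+n l a) (≤-reflexive (sym t≡))))) (rises d t Bt d+t))
    (≤-trans (sum<-monoʳ _ (s≤s (m≤n+m l d))) (flips a (d + l) Ba (trans (+-comm a (d + l)) d+l+a)))
    (≤-trans (sum<-shiftʳ (λ y → χ (B y ∧ not (B (y + d)))) a (suc l) (suc t) (≤-reflexive (cong suc (sym t≡)))) (rises d t Bt d+t))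
    (≤-trans (sum<-shiftʳ (λ y → χ (B y ∧ B (y + a))) d (suc l) (suc m) (s≤s (≤-trans (m≤m+n (l + d) a) (≤-reflexive (trans (cong (_+ a) (+-comm l d)) d+l+a))))) (sums a Ba))
    where
    w = cnt (λ y → B y ∧ not (B (y + d))) (suc l)
    x = cnt (λ y → not (B y xor B (y + a))) (suc l)
    y = cnt (λ y → B (y + a) ∧ not (B (y + a + d))) (suc l)
    z = cnt (λ y → B (y + d) ∧ B (y + d + a)) (suc l)
    t≡ : t ≡ l + a
    t≡ = +-cancelˡ-≡ d t (l + a) (trans d+t (trans (sym d+l+a) (+-assoc d l a)))
    pointwise : ∀ y → χ (B y xor B (y + d)) ≤ χ (B y ∧ not (B (y + d))) + χ (not (B y xor B (y + a)))
      + χ (B (y + a) ∧ not (B (y + a + d))) + χ (B (y + d) ∧ B (y + d + a))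
    pointwise y rewrite solve 3 (λ y a d → y ⊹ a ⊹ d := y ⊹ d ⊹ a) refl y a d =
      taut (B y ∷ B (y + d) ∷ B (y + a) ∷ B (y + d + a) ∷ []) (λ p q r s → χ (p xor q))
        (λ p q r s → χ (p ∧ not q) + χ (not (p xor r)) + χ (r ∧ not s) + χ (q ∧ s))

  -- The sign ε of a translation is true if it complements B and false if it preserves B; irregular
  -- places are the exceptions.
  irregular : ℕ → Bool → ℕ → Bool
  irregular s ε y = (B y xor B (y + s)) xor ε

  neither : ℕ → Bool
  neither y = not (B y) ∧ not (B (m ∸ y))

  -- One of t and m - t is in B: the first case is `flips`, the second `preserves`.
  shift-by-member : ∀ t l → neither t ≡ false → t + l + a ≡ m → ∃[ ε ] cnt (irregular t ε) (suc l) ≤ 17 * e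
  shift-by-member t l nt eq with bool? (B t)
  ... | inj₁ Bt = true , (begin
    cnt (irregular t true) (suc l)
      ≤⟨ sum<-mono _ _ (suc l) (λ y _ → taut (B y ∷ B (y + t) ∷ []) (λ p q → χ ((p xor q) xor true)) (λ p q → χ (not (p xor q)))) ⟩
    cnt (λ y → not (B y xor B (y + t))) (suc l)
      ≤⟨ sum<-monoʳ _ (s≤s (m≤m+n l a)) ⟩
    cnt (λ y → not (B y xor B (y + t))) (suc (l + a))
      ≤⟨ flips t (l + a) Bt (trans (sym (+-assoc t l a)) eq) ⟩
    8 * e ≤⟨ *-monoˡ-≤ e {8} {17} (≤ᵇ⇒≤ 8 17 tt) ⟩
    17 * e ∎)
    where open ≤-Reasoning
  ... | inj₂ ¬Bt = false , ≤-trans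
    (sum<-mono _ _ (suc l) (λ y _ → taut (B y ∷ B (y + t) ∷ []) (λ p q → χ ((p xor q) xor false)) (λ p q → χ (p xor q))))
    (preserves t (l + a) l (mirrored nt) (trans (sym (+-assoc t l a)) eq) eq)
    where
    mirrored : neither t ≡ false → B (l + a) ≡ true
    mirrored nt rewrite ¬Bt | ∸-from-+ t (l + a) (trans (sym (+-assoc t l a)) eq) with B (l + a)
    ... | true = refl

  abstract
    -- Of the 4e + 1 candidates at most 2e fail at t and at most 2e at s + t.
    common-member : ∀ s → s + 4 * e ≤ m → ∃[ t ] (t ≤ 4 * e × neither t ≡ false × neither (s + t) ≡ false)
    common-member s s+4e with cnt-witness (λ t → not (neither t) ∧ not (neither (s + t))) (suc (4 * e)) positive
      where
      positive : 0 < cnt (λ t → not (neither t) ∧ not (neither (s + t))) (suc (4 * e))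
      positive = lin (e ∷ cnt neither (suc (4 * e)) ∷ cnt (λ t → neither (s + t)) (suc (4 * e)) ∷ _ ∷ [])
        (λ e x y z → (lit 1 :+ 4 :* e :≤ x :+ y :+ z) ∷ (x :≤ 2 :* e) ∷ (y :≤ 2 :* e) ∷ [] ⊢ lit 1 :≤ z)
        (≤-trans (≤-reflexive (sym (sum<-1 (suc (4 * e))))) (sum<-3 _ (λ t → χ (neither t)) (λ t → χ (neither (s + t))) _ (suc (4 * e)) (λ t _ →
           taut (neither t ∷ neither (s + t) ∷ []) (λ _ _ → 1) (λ x y → χ x + χ y + χ (not x ∧ not y)))))
        (≤-trans (sum<-monoʳ _ (s≤s (≤-trans (m≤n+m (4 * e) s) s+4e))) few-neither)
        (≤-trans (sum<-shift _ s (suc (4 * e)) (suc m) (≤-trans (≤-reflexive (+-suc s (4 * e))) (s≤s s+4e))) few-neither)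
    ... | t , t< , p with ∧-true⁻ {not (neither t)} p
    ...   | p₁ , p₂ = t , ≤-pred t< , not-true p₁ , not-true p₂

  -- Comparing B at y and at y + s with B at y + s + t, where t and s + t are shifts with known
  -- signs, the signs add up. The constant is 17 + 17 + 4: the last t ≤ 4e places of the window are
  -- given up.
  shift-by-any : ∀ s l → s + l + a ≡ m → 4 * e ≤ l → ∃[ ε ] cnt (irregular s ε) (suc l) ≤ 38 * e
  shift-by-any s l eq 4e≤l with common-member s (≤-trans (+-monoʳ-≤ s 4e≤l) (≤-trans (m≤m+n (s + l) a) (≤-reflexive eq)))
  ... | t , t≤4e , nt , nst with m≤n⇒∃[o]m+o≡n (≤-trans t≤4e 4e≤l)
  ...   | l₁ , refl = compose
    (shift-by-member t (l₁ + s) nt (trans (solve 4 (λ s t l a → t ⊹ (l ⊹ s) ⊹ a := s ⊹ (t ⊹ l) ⊹ a) refl s t l₁ a) eq))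
    (shift-by-member (s + t) l₁ nst (trans (solve 4 (λ s t l a → s ⊹ t ⊹ l ⊹ a := s ⊹ (t ⊹ l) ⊹ a) refl s t l₁ a) eq))
    where
    total : ∀ {c X Y u v} → c ≤ X + Y → X ≤ u + v → u ≤ 17 * e → v ≤ 17 * e → Y ≤ t → t ≤ 4 * e → c ≤ 38 * e
    total {c} {X} {Y} {u} {v} = lin (e ∷ t ∷ c ∷ X ∷ Y ∷ u ∷ v ∷ [])
      (λ e t c X Y u v → (c :≤ X :+ Y) ∷ (X :≤ u :+ v) ∷ (u :≤ 17 :* e) ∷ (v :≤ 17 :* e) ∷ (Y :≤ t) ∷ (t :≤ 4 :* e) ∷ [] ⊢ c :≤ 38 :* e)
    pointwise : ∀ ε ε′ y → χ (irregular s (ε xor ε′) y) ≤ χ (irregular t ε (y + s)) + χ (irregular (s + t) ε′ y)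
    pointwise ε ε′ y rewrite +-assoc y s t =
      taut (B y ∷ B (y + s) ∷ B (y + (s + t)) ∷ ε ∷ ε′ ∷ []) (λ p q r ε ε′ → χ ((p xor q) xor (ε xor ε′)))
        (λ p q r ε ε′ → χ ((q xor r) xor ε) + χ ((p xor r) xor ε′))
    compose : ∃[ ε ] cnt (irregular t ε) (suc (l₁ + s)) ≤ 17 * e → ∃[ ε ] cnt (irregular (s + t) ε) (suc l₁) ≤ 17 * e →
      ∃[ ε ] cnt (irregular s ε) (suc (t + l₁)) ≤ 38 * e
    compose (ε , Hε) (ε′ , Hε′) = (ε xor ε′) , total
      (≤-reflexive (trans (cong (cnt (irregular s (ε xor ε′))) (cong suc (+-comm t l₁)))
        (sum<-split (λ y → χ (irregular s (ε xor ε′) y)) (suc l₁) t)))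
      (sum<-2 (λ y → χ (irregular s (ε xor ε′) y)) (λ y → χ (irregular t ε (y + s))) (λ y → χ (irregular (s + t) ε′ y))
        (suc l₁) (λ y _ → pointwise ε ε′ y))
      (≤-trans (sum<-shiftʳ (λ y → χ (irregular t ε y)) s (suc l₁) (suc (l₁ + s)) ≤-refl) Hε)
      Hε′
      (cnt≤ (λ y → irregular s (ε xor ε′) (suc l₁ + y)) t)
      t≤4e

  module _ (ε₁ : Bool) (unit-shift : ∀ l → 1 + l + a ≡ m → cnt (irregular 1 ε₁) (suc l) ≤ 38 * e) where

    -- A window longer than 3 · 38e contains a place that is regular for the shifts s, 1 and s + 1
    -- simultaneously, and there the third sign is the sum of the other two.
    shift-by : ∀ s l → s + l + a ≡ m → 115 * e ≤ l → cnt (irregular s (odd s ∧ ε₁)) (suc l) ≤ 38 * e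
    shift-by zero l eq 115e≤l = ≤-trans (≤-reflexive (cnt-false _ (suc l) (λ y _ → regular y))) z≤n
      where
      regular : ∀ y → irregular 0 false y ≡ false
      regular y rewrite +-identityʳ y with B y
      ... | true = refl
      ... | false = refl
    shift-by (suc s) l eq 115e≤l with shift-by-any (suc s) l eq (≤-trans (*-monoˡ-≤ e {4} {115} (≤ᵇ⇒≤ 4 115 tt)) 115e≤l)
    ... | ε , Hε with bool? (ε xor (not (odd s) ∧ ε₁))
    ...   | inj₂ agree = subst (λ z → cnt (irregular (suc s) z) (suc l) ≤ 38 * e) (xor-≡ ε _ agree) Hε
      where
      xor-≡ : ∀ x y → x xor y ≡ false → x ≡ y
      xor-≡ true true _ = refl
      xor-≡ false false _ = refl
    ...   | inj₁ differ = ⊥-elim (<-irrefl refl (lin (l ∷ e ∷ cnt (irregular (suc s) ε) (suc l) ∷ cnt (irregular s (odd s ∧ ε₁)) (suc l) ∷ cnt (λ y → irregular 1 ε₁ (y + s)) (suc l) ∷ [])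
        (λ l e x y z → (lit 1 :+ l :≤ x :+ y :+ z) ∷ (x :≤ 38 :* e) ∷ (y :≤ 38 :* e) ∷ (z :≤ 38 :* e) ∷ (115 :* e :≤ l) ∷ [] ⊢ lit 1 :+ l :≤ l)
        (≤-trans (≤-reflexive (sym (sum<-1 (suc l)))) (sum<-3 _ _ _ _ (suc l) (λ y _ → pointwise y)))
        Hε
        (≤-trans (sum<-monoʳ _ (s≤s (n≤1+n l))) (shift-by s (suc l) (trans (cong (_+ a) (+-suc s l)) eq) (m≤n⇒m≤1+n 115e≤l)))
        (≤-trans (sum<-shiftʳ _ s (suc l) (suc (s + l)) (≤-reflexive (cong suc (+-comm l s)))) (unit-shift (s + l) eq))
        115e≤l))
      where
      drop : ∀ {x b} → b ≡ true → x + χ (not b) ≤ x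
      drop {x} refl = ≤-reflexive (+-identityʳ x)
      pointwise : ∀ y → 1 ≤ χ (irregular (suc s) ε y) + χ (irregular s (odd s ∧ ε₁) y) + χ (irregular 1 ε₁ (y + s))
      pointwise y rewrite +-suc y s | +-comm (y + s) 1 = ≤-trans
        (taut (B y ∷ B (y + s) ∷ B (suc (y + s)) ∷ ε ∷ odd s ∷ ε₁ ∷ []) (λ p q r ε o ε₁ → 1)
          (λ p q r ε o ε₁ → χ ((p xor r) xor ε) + χ ((p xor q) xor (o ∧ ε₁)) + χ ((q xor r) xor ε₁) + χ (not (ε xor (not o ∧ ε₁)))))
        (drop differ)

    -- By `flips` the shift complements B, so a false sign would leave no place in a long window.
    -- Dually, `mirror-even` uses `preserves`.
    member-odd : ∀ t l → B t ≡ true → t + l + a ≡ m → 115 * e ≤ l → odd t ∧ ε₁ ≡ true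
    member-odd t l Bt eq 115e≤l with bool? (odd t ∧ ε₁)
    ... | inj₁ p = p
    ... | inj₂ p = ⊥-elim (<-irrefl refl (lin (l ∷ e ∷ cnt (irregular t (odd t ∧ ε₁)) (suc l) ∷ cnt (λ y → not (B y xor B (y + t))) (suc l) ∷ [])
        (λ l e x y → (lit 1 :+ l :≤ x :+ y) ∷ (x :≤ 38 :* e) ∷ (y :≤ 8 :* e) ∷ (115 :* e :≤ l) ∷ [] ⊢ lit 1 :+ l :≤ l)
        (≤-trans (≤-reflexive (sym (sum<-1 (suc l)))) (sum<-2 _ _ _ (suc l) (λ y _ → pointwise y)))
        (shift-by t l eq 115e≤l)
        (≤-trans (sum<-monoʳ _ (s≤s (m≤m+n l a))) (flips t (l + a) Bt (trans (sym (+-assoc t l a)) eq)))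
        115e≤l))
      where
      pointwise : ∀ y → 1 ≤ χ (irregular t (odd t ∧ ε₁) y) + χ (not (B y xor B (y + t)))
      pointwise y rewrite p = taut (B y ∷ B (y + t) ∷ []) (λ _ _ → 1) (λ p q → χ ((p xor q) xor false) + χ (not (p xor q)))

    mirror-even : ∀ t u l → B u ≡ true → t + u ≡ m → t + l + a ≡ m → 115 * e ≤ l → odd t ∧ ε₁ ≡ false
    mirror-even t u l Bu t+u eq 115e≤l with bool? (odd t ∧ ε₁)
    ... | inj₂ p = p
    ... | inj₁ p = ⊥-elim (<-irrefl refl (lin (l ∷ e ∷ cnt (irregular t (odd t ∧ ε₁)) (suc l) ∷ cnt (λ y → B y xor B (y + t)) (suc l) ∷ [])
        (λ l e x y → (lit 1 :+ l :≤ x :+ y) ∷ (x :≤ 38 :* e) ∷ (y :≤ 17 :* e) ∷ (115 :* e :≤ l) ∷ [] ⊢ lit 1 :+ l :≤ l)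
        (≤-trans (≤-reflexive (sym (sum<-1 (suc l)))) (sum<-2 _ _ _ (suc l) (λ y _ → pointwise y)))
        (shift-by t l eq 115e≤l)
        (preserves t u l Bu t+u eq)
        115e≤l))
      where
      pointwise : ∀ y → 1 ≤ χ (irregular t (odd t ∧ ε₁) y) + χ (B y xor B (y + t))
      pointwise y rewrite p = taut (B y ∷ B (y + t) ∷ []) (λ _ _ → 1) (λ p q → χ ((p xor q) xor true) + χ (p xor q))

  -- An element a of B well below m / 2 forces translation by t to change B by the parity of t.
  all-odd : 1 ≤ e → 2 * a + 400 * e ≤ m → ∀ t → t ≤ m → B t ≡ true → odd t ≡ true
  all-odd 1≤e small-a = main unit-shift
    where
    room : ∀ t → t + a + 115 * e ≤ m → ∃[ l ] (t + l + a ≡ m × 115 * e ≤ l)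
    room t p with m≤n⇒∃[o]m+o≡n p
    ... | o , eq = 115 * e + o , trans (solve 4 (λ t a e o → t ⊹ (e ⊹ o) ⊹ a := t ⊹ a ⊹ e ⊹ o) refl t a (115 * e) o) eq , m≤m+n _ o

    unit-shift : ∃[ ε ] (∀ l → 1 + l + a ≡ m → cnt (irregular 1 ε) (suc l) ≤ 38 * e)
    unit-shift = proj₁ shift₁ , λ l′ eq′ → subst (λ z → cnt (irregular 1 (proj₁ shift₁)) (suc z) ≤ 38 * e)
        (suc-injective (+-cancelʳ-≡ a _ _ (trans (proj₁ (proj₂ room₁)) (sym eq′)))) (proj₂ shift₁)
      where
      room₁ = room 1 (lin (a ∷ e ∷ m ∷ []) (λ a e m → (lit 1 :≤ e) ∷ (2 :* a :+ 400 :* e :≤ m) ∷ []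
        ⊢ lit 1 :+ a :+ 115 :* e :≤ m) 1≤e small-a)
      shift₁ = shift-by-any 1 (proj₁ room₁) (proj₁ (proj₂ room₁))
        (≤-trans (*-monoˡ-≤ e {4} {115} (≤ᵇ⇒≤ 4 115 tt)) (proj₂ (proj₂ room₁)))

    main : ∃[ ε ] (∀ l → 1 + l + a ≡ m → cnt (irregular 1 ε) (suc l) ≤ 38 * e) → ∀ t → t ≤ m → B t ≡ true → odd t ≡ true
    main (ε₁ , H) = by-parity (bool? (odd m))
      where
      -- The element a is itself small enough for `member-odd`, which makes the unit shift
      -- complement B.
      ε₁-true : ε₁ ≡ true
      ε₁-true = proj₂ (∧-true⁻ {odd a} (member-odd ε₁ H a (proj₁ roomₐ) Ba (proj₁ (proj₂ roomₐ)) (proj₂ (proj₂ roomₐ))))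
        where
        roomₐ = room a (lin (a ∷ e ∷ m ∷ []) (λ a e m → (2 :* a :+ 400 :* e :≤ m) ∷ [] ⊢ a :+ a :+ 115 :* e :≤ m) small-a)

      odd-member : ∀ t → t + a + 115 * e ≤ m → B t ≡ true → odd t ≡ true
      odd-member t p Bt with room t p
      ... | l , eq , 115e≤l = proj₁ (∧-true⁻ (member-odd ε₁ H t l Bt eq 115e≤l))

      even-mirror : ∀ t u → t + u ≡ m → t + a + 115 * e ≤ m → B u ≡ true → odd t ≡ false
      even-mirror t u t+u p Bu with room t p
      ... | l , eq , 115e≤l = trans (sym (trans (cong (odd t ∧_) ε₁-true) (∧-identity (odd t)))) (mirror-even ε₁ H t u l Bu t+u eq 115e≤l)
        where
        ∧-identity : ∀ x → x ∧ true ≡ x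
        ∧-identity true = refl
        ∧-identity false = refl

      by-parity : odd m ≡ true ⊎ odd m ≡ false → ∀ t → t ≤ m → B t ≡ true → odd t ≡ true
      by-parity (inj₁ m-odd) t t≤m Bt with ≤-total (t + a + 115 * e) m
      ... | inj₁ p = odd-member t p Bt
      -- For t close to m the window is too short, but the mirror image u = m - t is small and even,
      -- and m is odd.
      ... | inj₂ p with m≤n⇒∃[o]m+o≡n t≤m
      ...   | u , t+u = xor-false (odd t) (odd u) (trans (sym (odd-+ t u)) (trans (cong odd t+u) m-odd))
            (even-mirror u t (trans (+-comm u t) t+u) (lin (t ∷ u ∷ a ∷ e ∷ m ∷ [])
              (λ t u a e m → (m :≤ t :+ a :+ 115 :* e) ∷ (t :+ u :≤ m) ∷ (2 :* a :+ 400 :* e :≤ m) ∷ [] ⊢ u :+ a :+ 115 :* e :≤ m)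
              p (≤-reflexive t+u) small-a) Bt)
        where
        xor-false : ∀ x y → x xor y ≡ true → y ≡ false → x ≡ true
        xor-false true false _ _ = refl
      -- A central element of B would be odd as a member while its mirror image would be even,
      -- against m even. So all central places are in neither B nor m - B, and 2e + 1 of them are
      -- already too many.
      by-parity (inj₂ m-even) t t≤m Bt = ⊥-elim (<-irrefl refl (≤-trans
        (≤-trans (≤-reflexive (sym (sum<-1 (suc (2 * e))))) (sum<-mono _ _ (suc (2 * e)) (λ j j< → centre (s₀ + j) (m≤m+n s₀ j)
          (lin (j ∷ a ∷ e ∷ m ∷ []) (λ j a e m → (lit 1 :+ j :≤ lit 1 :+ 2 :* e) ∷ (2 :* a :+ 400 :* e :≤ m) ∷ [] ⊢ a :+ 115 :* e :+ j :+ a :+ 115 :* e :≤ m) j< small-a))))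
        (≤-trans (sum<-shift (λ y → χ (neither y)) s₀ (suc (2 * e)) (suc m)
          (lin (a ∷ e ∷ m ∷ []) (λ a e m → (2 :* a :+ 400 :* e :≤ m) ∷ [] ⊢ a :+ 115 :* e :+ (lit 1 :+ 2 :* e) :≤ lit 1 :+ m) small-a)) few-neither)))
        where
        s₀ = a + 115 * e
        both-parities : ∀ x y → x ≡ true → y ≡ false → x xor y ≡ false → ⊥
        both-parities true false _ _ ()
        centre : ∀ y → s₀ ≤ y → y + a + 115 * e ≤ m → 1 ≤ χ (neither y)
        centre y s₀≤y p with m≤n⇒∃[o]m+o≡n {y} {m} (≤-trans (m≤m+n y a) (≤-trans (m≤m+n (y + a) _) p))
        ... | u , y+u rewrite ∸-from-+ y u y+u with bool? (B y) | bool? (B u)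
        ...   | inj₂ ¬By | inj₂ ¬Bu rewrite ¬By | ¬Bu = s≤s z≤n
        ...   | inj₁ By | _ = ⊥-elim (both-parities _ _ (odd-member y p By) (even-mirror u y (trans (+-comm u y) y+u) q By) split)
          where
          q : u + a + 115 * e ≤ m
          q = lin (y ∷ u ∷ a ∷ e ∷ m ∷ []) (λ y u a e m → (a :+ 115 :* e :≤ y) ∷ (y :+ u :≤ m) ∷ [] ⊢ u :+ a :+ 115 :* e :≤ m) s₀≤y (≤-reflexive y+u)
          split : odd y xor odd u ≡ false
          split = trans (sym (odd-+ y u)) (trans (cong odd y+u) m-even)
        ...   | inj₂ _ | inj₁ Bu = ⊥-elim (both-parities _ _ (odd-member u q Bu) (even-mirror y u y+u p Bu) split)
          where
          q : u + a + 115 * e ≤ m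
          q = lin (y ∷ u ∷ a ∷ e ∷ m ∷ []) (λ y u a e m → (a :+ 115 :* e :≤ y) ∷ (y :+ u :≤ m) ∷ [] ⊢ u :+ a :+ 115 :* e :≤ m) s₀≤y (≤-reflexive y+u)
          split : odd u xor odd y ≡ false
          split = trans (sym (odd-+ u y)) (trans (cong odd (trans (+-comm u y) y+u)) m-even)

-- Closeness to the odd numbers or to the upper half.

2*cnt-odd : ∀ n → 2 * cnt odd n + χ (odd n) ≡ n
2*cnt-odd zero = refl
2*cnt-odd (suc n) = trans (step (cnt odd n) (odd n)) (cong suc (2*cnt-odd n))
  where
  step : ∀ c b → 2 * (c + χ b) + χ (not b) ≡ suc (2 * c + χ b)
  step c true = solve 1 (λ c → con 2 ⊛ (c ⊹ con 1) ⊹ con 0 := con 1 ⊹ (con 2 ⊛ c ⊹ con 1)) refl c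
  step c false = solve 1 (λ c → con 2 ⊛ (c ⊹ con 0) ⊹ con 1 := con 1 ⊹ (con 2 ⊛ c ⊹ con 0)) refl c

upper : ℕ → ℕ → Bool
upper n x = suc n ≤ᵇ 2 * x

≤ᵇ-true : ∀ {m n} → (m ≤ᵇ n) ≡ true → m ≤ n
≤ᵇ-true {m} {n} p = ≤ᵇ⇒≤ m n (subst T (sym p) tt)

≤⇒≤ᵇ-true : ∀ {m n} → m ≤ n → (m ≤ᵇ n) ≡ true
≤⇒≤ᵇ-true {m} {n} p with m ≤ᵇ n | ≤⇒≤ᵇ p
... | true | _ = refl

-- The integers x and n - x cannot both exceed n / 2.
2*cnt-upper : ∀ n → 2 * cnt (upper n) (suc n) ≤ suc n
2*cnt-upper n = lin (u ∷ cnt (λ x → upper n (n ∸ x)) (suc n) ∷ sum< (λ _ → 1) (suc n) ∷ sum< (λ _ → 0) (suc n) ∷ n ∷ [])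
  (λ u v s z n → (u :+ v :≤ s :+ z) ∷ (u :≤ v) ∷ (s :≤ lit 1 :+ n) ∷ (z :≤ lit 0) ∷ [] ⊢ 2 :* u :≤ lit 1 :+ n)
  (sum<-2-2 (λ x → χ (upper n x)) (λ x → χ (upper n (n ∸ x))) (λ _ → 1) (λ _ → 0) (suc n) pointwise)
  (≤-reflexive (sym (sum<-reverse (λ x → χ (upper n x)) n)))
  (≤-reflexive (sum<-1 (suc n)))
  (≤-reflexive (trans (sum<-const 0 (suc n)) (*-zeroʳ (suc n))))
  where
  u = cnt (upper n) (suc n)
  pointwise : ∀ x → x < suc n → χ (upper n x) + χ (upper n (n ∸ x)) ≤ 1 + 0
  pointwise x x≤n with bool? (upper n x) | bool? (upper n (n ∸ x))
  ... | inj₂ p | _ rewrite p = taut (upper n (n ∸ x) ∷ []) χ (λ _ → 1)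
  ... | inj₁ p | inj₂ q rewrite p | q = s≤s z≤n
  ... | inj₁ p | inj₁ q = ⊥-elim (<-irrefl refl (lin (n ∷ x ∷ (n ∸ x) ∷ [])
    (λ n x y → (lit 1 :+ n :≤ 2 :* x) ∷ (lit 1 :+ n :≤ 2 :* y) ∷ (x :+ y :≤ n) ∷ [] ⊢ lit 1 :+ n :≤ n)
    (≤ᵇ-true p) (≤ᵇ-true q) (≤-reflexive (m+[n∸m]≡n (≤-pred x≤n)))))

cnt-initial : ∀ p n k → (∀ i → i < n → p i ≡ true → i < k) → cnt p n ≤ k
cnt-initial p n k H with ≤-total n k
... | inj₁ n≤k = ≤-trans (cnt≤ p n) n≤k
... | inj₂ k≤n with m≤n⇒∃[o]m+o≡n k≤n
...   | o , refl = ≤-trans (≤-reflexive (trans (sum<-split (λ i → χ (p i)) k o)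
    (trans (cong (cnt p k +_) (cnt-false (λ i → p (k + i)) o beyond)) (+-identityʳ _)))) (cnt≤ p k)
  where
  beyond : ∀ i → i < o → p (k + i) ≡ false
  beyond i i<o with bool? (p (k + i))
  ... | inj₂ q = q
  ... | inj₁ q = ⊥-elim (<⇒≱ (H (k + i) (+-monoʳ-< k i<o) q) (m≤m+n k i))

sum<-*ˡ : ∀ c f n → sum< (λ i → c * f i) n ≡ c * sum< f n
sum<-*ˡ c f zero = sym (*-zeroʳ c)
sum<-*ˡ c f (suc n) rewrite sum<-*ˡ c f n = sym (*-distribˡ-+ c (sum< f n) (f n))

-- The triangle inequality for symmetric differences through B, together with |B △ Q| = |Q| - |B| +
-- 2 |B outside Q|. It is useful when |B| is close to |Q| and B is nearly contained in Q.
symdiff-≤ : ∀ (A B Q : ℕ → Bool) n → B ⊆ A → cnt (λ x → A x xor Q x) n + cnt B n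
  ≤ cnt Q n + 2 * cnt (λ x → B x ∧ not (Q x)) n + cnt (λ x → A x ∧ not (B x)) n
symdiff-≤ A B Q n B⊆A = ≤-trans (≤-reflexive (sym (sum<-+ _ _ n)))
  (≤-trans (sum<-3 (λ x → χ (A x xor Q x) + χ (B x)) (λ x → χ (Q x)) (λ x → 2 * χ (B x ∧ not (Q x))) (λ x → χ (A x ∧ not (B x))) n
    (λ x _ → pointwise (Q x) (B⊆A x)))
    (≤-reflexive (cong (λ z → cnt Q n + z + cnt (λ x → A x ∧ not (B x)) n) (sum<-*ˡ 2 _ n))))
  where
  pointwise : ∀ {a b} q → (b ≡ true → a ≡ true) → χ (a xor q) + χ b ≤ χ q + 2 * χ (b ∧ not q) + χ (a ∧ not b)
  pointwise {a} {false} q H = taut (a ∷ q ∷ []) (λ a q → χ (a xor q) + 0) (λ a q → χ q + 0 + χ (a ∧ true))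
  pointwise {b = true} q H rewrite H refl = taut (q ∷ []) (λ q → χ (not q) + 1) (λ q → χ q + 2 * χ (not q) + 0)

module _ (A B C : ℕ → Bool) (m h K E : ℕ) (few : FewSums A B C (m + h) K)
  (top : B m ≡ true) (above : ∀ x → m < x → x ≤ m + h → B x ≡ false)
  (large : m + h ≤ cnt B (suc (m + h)) + cnt C (suc (m + h)) + E) where
  open Top A B C m h K E few top above large
  open FewSums few using (B⊆A)

  private
    n = m + h

    A∖B-all : cnt (λ x → A x ∧ not (B x)) (suc n) ≤ 8 * e
    A∖B-all = lin (cnt (λ x → A x ∧ not (B x)) (suc n) ∷ cnt (λ x → A x ∧ not (B x)) (suc m) ∷
        cnt (λ x → A (suc m + x) ∧ not (B (suc m + x))) h ∷ e ∷ h ∷ [])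
      (λ x y z e h → (x :≤ y :+ z) ∷ (y :≤ e) ∷ (z :≤ h) ∷ (h :≤ 7 :* e) ∷ [] ⊢ x :≤ 8 :* e)
      (≤-reflexive (sum<-split (λ x → χ (A x ∧ not (B x))) (suc m) h)) A∖B
      (cnt≤ (λ x → A (suc m + x) ∧ not (B (suc m + x))) h) short-gap

    n≤2B : n ≤ 2 * cnt B (suc n) + 9 * e
    n≤2B = lin (m ∷ h ∷ e ∷ cnt B (suc m) ∷ cnt B (suc n) ∷ [])
      (λ m h e b B → (h :≤ 7 :* e) ∷ (m :≤ 2 :* b :+ 2 :* e) ∷ (b :≤ B) ∷ [] ⊢ m :+ h :≤ 2 :* B :+ 9 :* e)
      short-gap m≤2b (sum<-monoʳ _ (s≤s (m≤m+n m h)))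

    K≤e : K ≤ e
    K≤e = ≤-trans (m≤m+n K E) (n≤1+n _)

  near-odd : ∀ a → B a ≡ true → 2 * a + 400 * e ≤ m → cnt (λ x → A x xor odd x) (suc n) ≤ 13 * e
  near-odd a Ba small = lin (cnt (λ x → A x xor odd x) (suc n) ∷ cnt B (suc n) ∷ cnt odd (suc n) ∷
      cnt (λ x → B x ∧ not (odd x)) (suc n) ∷ cnt (λ x → A x ∧ not (B x)) (suc n) ∷ e ∷ n ∷ [])
    (λ x b o w d e n → (x :+ b :≤ o :+ 2 :* w :+ d) ∷ (2 :* o :≤ lit 1 :+ n) ∷ (w :≤ lit 0) ∷ (d :≤ 8 :* e) ∷ (n :≤ 2 :* b :+ 9 :* e)
      ∷ (lit 1 :≤ e) ∷ [] ⊢ x :≤ 13 :* e)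
    (symdiff-≤ A B odd (suc n) B⊆A)
    (≤-trans (m≤m+n _ _) (≤-reflexive (2*cnt-odd (suc n))))
    (≤-reflexive (cnt-false _ (suc n) (λ x x≤n → B⊆odd x (≤-pred x≤n))))
    A∖B-all n≤2B (s≤s z≤n)
    where
    module P = Parity B m e a Ba (≤-trans (B-differences m top) K≤e) few-neither
      (λ t Bt → ≤-trans (sum<-monoʳ _ (s≤s (m≤m+n m h))) (≤-trans (B-sums t Bt) K≤e))
      (λ t Bt → ≤-trans (B-differences t Bt) K≤e)
    conclude : ∀ {b o} → o ≡ true → b ∧ not o ≡ false
    conclude {false} _ = refl
    conclude {true} refl = refl
    B⊆odd : ∀ x → x ≤ n → B x ∧ not (odd x) ≡ false
    B⊆odd x x≤n with bool? (B x)
    ... | inj₂ ¬Bx rewrite ¬Bx = refl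
    ... | inj₁ Bx with x ≤? m
    ...   | yes x≤m = conclude (P.all-odd (s≤s z≤n) small x x≤m Bx)
    ...   | no x≰m = ⊥-elim (false≢true (trans (sym (above x (≰⇒> x≰m) x≤n)) Bx))

  -- B starts at a ≥ m / 2 - 200e, and m ≥ n - 7e by `short-gap`, so only about 204e places for B
  -- remain up to n / 2.
  near-upper : ∀ a → B a ≡ true → (∀ i → i < a → B i ≡ false) → a ≤ m → m ≤ 2 * a + 400 * e →
    cnt (λ x → A x xor upper n x) (suc n) ≤ 500 * e
  near-upper a Ba below a≤m large-a with m≤n⇒∃[o]m+o≡n (≤-trans (m≤n⇒m≤1+n a≤m) (s≤s (m≤m+n m h)))
  ... | o , a+o = bound
    where
    few-low : cnt (λ x → B x ∧ not (upper n x)) (suc n) ≤ 205 * e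
    few-low = begin
      cnt low (suc n) ≡⟨ cong (cnt low) a+o ⟨
      cnt low (a + o) ≡⟨ sum<-split (λ x → χ (low x)) a o ⟩
      cnt low a + cnt (λ i → low (a + i)) o ≡⟨ cong (_+ cnt (λ i → low (a + i)) o) (cnt-false low a (λ i i<a → cong (_∧ not (upper n i)) (below i i<a))) ⟩
      cnt (λ i → low (a + i)) o ≤⟨ cnt-initial (λ i → low (a + i)) o (205 * e) (λ i _ p → initial i (not-upper (a + i) (proj₂ (∧-true⁻ {B (a + i)} p)))) ⟩
      205 * e ∎
      where
      open ≤-Reasoning
      low : ℕ → Bool
      low x = B x ∧ not (upper n x)
      not-upper : ∀ x → not (upper n x) ≡ true → 2 * x ≤ n
      not-upper x p with 2 * x ≤? n
      ... | yes q = q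
      ... | no q rewrite ≤⇒≤ᵇ-true (≰⇒> q) with p
      ...   | ()
      initial : ∀ i → 2 * (a + i) ≤ n → i < 205 * e
      initial i p = lin (a ∷ i ∷ m ∷ h ∷ e ∷ [])
        (λ a i m h e → (2 :* (a :+ i) :≤ m :+ h) ∷ (m :≤ 2 :* a :+ 400 :* e) ∷ (h :≤ 7 :* e) ∷ (lit 1 :≤ e) ∷ []
          ⊢ lit 1 :+ i :≤ 205 :* e) p large-a short-gap (s≤s z≤n)
    bound : cnt (λ x → A x xor upper n x) (suc n) ≤ 500 * e
    bound = lin (cnt (λ x → A x xor upper n x) (suc n) ∷ cnt B (suc n) ∷ cnt (upper n) (suc n) ∷
        cnt (λ x → B x ∧ not (upper n x)) (suc n) ∷ cnt (λ x → A x ∧ not (B x)) (suc n) ∷ e ∷ n ∷ [])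
      (λ x b u w d e n → (x :+ b :≤ u :+ 2 :* w :+ d) ∷ (2 :* u :≤ lit 1 :+ n) ∷ (w :≤ 205 :* e) ∷ (d :≤ 8 :* e)
        ∷ (n :≤ 2 :* b :+ 9 :* e) ∷ (lit 1 :≤ e) ∷ [] ⊢ x :≤ 500 :* e)
      (symdiff-≤ A B (upper n) (suc n) B⊆A) (2*cnt-upper n) few-low A∖B-all n≤2B (s≤s z≤n)

  near-odd-or-upper : cnt (λ x → A x xor odd x) (suc n) ≤ 500 * e ⊎ cnt (λ x → A x xor upper n x) (suc n) ≤ 500 * e
  near-odd-or-upper with least B m top
  ... | a , a≤m , Ba , below with ≤-total (2 * a + 400 * e) m
  ...   | inj₁ small = inj₁ (≤-trans (near-odd a Ba small) (*-monoˡ-≤ e {13} {500} (≤ᵇ⇒≤ 13 500 tt)))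
  ...   | inj₂ large-a = inj₂ (near-upper a Ba below a≤m large-a)

-- Up to m = max B this is the bound on a + c; above m only C contributes. If the sum is at most n
-- there is nothing to show, so the hypothesis of `Top` is available with E = 0.
|B|+|C|≤n : ∀ A B C n K → FewSums A B C n K → cnt B (suc n) + cnt C (suc n) ≤ 1 + n + K
|B|+|C|≤n A B C n K few with greatest B n
... | inj₁ none = ≤-trans (+-mono-≤ (≤-reflexive (cnt-false B (suc n) (λ i i< → none i (≤-pred i<)))) (cnt≤ C (suc n))) (m≤m+n _ K)
... | inj₂ (m , m≤n , Bm , above) = by-top (m≤n⇒∃[o]m+o≡n m≤n)
  where
  by-top : ∃[ h ] m + h ≡ n → cnt B (suc n) + cnt C (suc n) ≤ 1 + n + K
  by-top (h , refl) with ≤-total (m + h) (cnt B (suc (m + h)) + cnt C (suc (m + h)))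
  ... | inj₂ small = ≤-trans small (≤-trans (n≤1+n _) (m≤m+n _ K))
  ... | inj₁ large = lin (m ∷ h ∷ K ∷ T.a ∷ T.b ∷ T.c ∷ T.c′ ∷ cnt B (suc (m + h)) ∷ cnt C (suc (m + h)) ∷ cnt (λ i → B (suc m + i)) h ∷ [])
    (λ m h K a b c c′ B C b′ → (B :≤ b :+ b′) ∷ (b′ :≤ lit 0) ∷ (C :≤ c :+ c′) ∷ (b :≤ c) ∷ (c :≤ a) ∷ (a :+ c :≤ lit 1 :+ m :+ K) ∷ (c′ :≤ h) ∷ []
      ⊢ B :+ C :≤ lit 1 :+ (m :+ h) :+ K)
    (≤-reflexive (sum<-split (λ x → χ (B x)) (suc m) h))
    (≤-reflexive (cnt-false _ h (λ i i<h → above (suc m + i) (s≤s (m≤m+n m i))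
      (≤-trans (≤-reflexive (sym (+-suc m i))) (+-monoʳ-≤ m i<h)))))
    (≤-reflexive (sum<-split (λ x → χ (C x)) (suc m) h))
    T.b≤c T.c≤a T.a+c T.c′≤h
    where
    module T = Top A B C m h K 0 few Bm above (≤-trans large (≤-reflexive (sym (+-identityʳ _))))

stability : ∀ A B C n K E → FewSums A B C n K → n ≤ cnt B (suc n) + cnt C (suc n) + E →
  (∀ x → x ≤ n → B x ≡ false)
  ⊎ cnt (λ x → A x xor odd x) (suc n) ≤ 500 * (1 + K + E)
  ⊎ cnt (λ x → A x xor upper n x) (suc n) ≤ 500 * (1 + K + E)
stability A B C n K E few large with greatest B n
... | inj₁ none = inj₁ none
... | inj₂ (m , m≤n , Bm , above) = inj₂ (by-top (m≤n⇒∃[o]m+o≡n m≤n))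
  where
  by-top : ∃[ h ] m + h ≡ n → cnt (λ x → A x xor odd x) (suc n) ≤ 500 * (1 + K + E) ⊎ cnt (λ x → A x xor upper n x) (suc n) ≤ 500 * (1 + K + E)
  by-top (h , refl) = near-odd-or-upper A B C m h K E few Bm above large

-- Sums and Boolean search over lists.

sumL : {X : Set} → (X → ℕ) → List X → ℕ
sumL f [] = 0
sumL f (x ∷ xs) = f x + sumL f xs

module _ {X : Set} where
  sumL-mono : ∀ (f g : X → ℕ) xs → (∀ x → x ∈ xs → f x ≤ g x) → sumL f xs ≤ sumL g xs
  sumL-mono f g [] H = z≤n
  sumL-mono f g (x ∷ xs) H = +-mono-≤ (H x (here refl)) (sumL-mono f g xs (λ y y∈ → H y (there y∈)))

  sumL-cong : ∀ (f g : X → ℕ) xs → (∀ x → x ∈ xs → f x ≡ g x) → sumL f xs ≡ sumL g xs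
  sumL-cong f g [] H = refl
  sumL-cong f g (x ∷ xs) H = cong₂ _+_ (H x (here refl)) (sumL-cong f g xs (λ y y∈ → H y (there y∈)))

  sumL-+ : ∀ (f g : X → ℕ) xs → sumL (λ x → f x + g x) xs ≡ sumL f xs + sumL g xs
  sumL-+ f g [] = refl
  sumL-+ f g (x ∷ xs) rewrite sumL-+ f g xs = interchange (f x) (g x) (sumL f xs) (sumL g xs)

  sumL-*ˡ : ∀ c (f : X → ℕ) xs → sumL (λ x → c * f x) xs ≡ c * sumL f xs
  sumL-*ˡ c f [] = sym (*-zeroʳ c)
  sumL-*ˡ c f (x ∷ xs) rewrite sumL-*ˡ c f xs = sym (*-distribˡ-+ c (f x) (sumL f xs))

  sumL-0 : ∀ (xs : List X) → sumL (λ _ → 0) xs ≡ 0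
  sumL-0 [] = refl
  sumL-0 (x ∷ xs) = sumL-0 xs

  sumL-1 : ∀ (xs : List X) → sumL (λ _ → 1) xs ≡ length xs
  sumL-1 [] = refl
  sumL-1 (x ∷ xs) = cong suc (sumL-1 xs)

  sumL-3 : ∀ (f g h k : X → ℕ) xs → (∀ x → x ∈ xs → f x ≤ g x + h x + k x) →
    sumL f xs ≤ sumL g xs + sumL h xs + sumL k xs
  sumL-3 f g h k xs H = ≤-trans (sumL-mono f _ xs H) (≤-reflexive
    (trans (sumL-+ (λ x → g x + h x) k xs) (cong (_+ sumL k xs) (sumL-+ g h xs))))

  term≤sumL : ∀ (f : X → ℕ) {x xs} → x ∈ xs → f x ≤ sumL f xs
  term≤sumL f (here refl) = m≤m+n _ _
  term≤sumL f {xs = y ∷ ys} (there x∈) = ≤-trans (term≤sumL f x∈) (m≤n+m _ (f y))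

  search-list : ∀ (p : X → Bool) xs → (∃[ x ] (x ∈ xs × p x ≡ true)) ⊎ (∀ x → x ∈ xs → p x ≡ false)
  search-list p [] = inj₂ λ x ()
  search-list p (x ∷ xs) with bool? (p x) | search-list p xs
  ... | inj₁ px | _ = inj₁ (x , here refl , px)
  ... | inj₂ _ | inj₁ (y , y∈ , py) = inj₁ (y , there y∈ , py)
  ... | inj₂ ¬px | inj₂ none = inj₂ λ { y (here refl) → ¬px ; y (there y∈) → none y y∈ }

  anyᵇ : (X → Bool) → List X → Bool
  anyᵇ p [] = false
  anyᵇ p (x ∷ xs) = p x ∨ anyᵇ p xs

  anyᵇ-witness : ∀ p xs → anyᵇ p xs ≡ true → ∃[ x ] (x ∈ xs × p x ≡ true)
  anyᵇ-witness p (x ∷ xs) q with bool? (p x)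
  ... | inj₁ px = x , here refl , px
  ... | inj₂ ¬px with anyᵇ-witness p xs (trans (sym (cong (_∨ anyᵇ p xs) ¬px)) q)
  ...   | y , y∈ , py = y , there y∈ , py

  anyᵇ-false : ∀ p xs → anyᵇ p xs ≡ false → ∀ x → x ∈ xs → p x ≡ false
  anyᵇ-false p (x ∷ xs) q y y∈ with bool? (p x)
  ... | inj₁ px = ⊥-elim (false≢true (trans (sym q) (cong (_∨ anyᵇ p xs) px)))
  anyᵇ-false p (x ∷ xs) q y (here refl) | inj₂ ¬px = ¬px
  anyᵇ-false p (x ∷ xs) q y (there y∈) | inj₂ ¬px = anyᵇ-false p xs (trans (sym (cong (_∨ anyᵇ p xs) ¬px)) q) y y∈

  allᵇ-∈ : ∀ (p : X → Bool) {x xs} → allᵇ p xs ≡ true → x ∈ xs → p x ≡ true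
  allᵇ-∈ p q (here refl) = proj₁ (∧-true⁻ q)
  allᵇ-∈ p {xs = y ∷ ys} q (there x∈) = allᵇ-∈ p (proj₂ (∧-true⁻ {p y} q)) x∈

  allᵇ-intro : ∀ (p : X → Bool) xs → (∀ x → x ∈ xs → p x ≡ true) → allᵇ p xs ≡ true
  allᵇ-intro p [] H = refl
  allᵇ-intro p (x ∷ xs) H = ∧-true (H x (here refl)) (allᵇ-intro p xs (λ y y∈ → H y (there y∈)))

sumL-swap : ∀ {X Y : Set} (f : X → Y → ℕ) xs ys →
  sumL (λ x → sumL (f x) ys) xs ≡ sumL (λ y → sumL (λ x → f x y) xs) ys
sumL-swap f [] ys = sym (sumL-0 ys)
sumL-swap f (x ∷ xs) ys rewrite sumL-swap f xs ys = sym (sumL-+ (f x) (λ y → sumL (λ x → f x y) xs) ys)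

sumL-map : ∀ {X Y : Set} (f : Y → ℕ) (h : X → Y) xs → sumL f (map h xs) ≡ sumL (λ x → f (h x)) xs
sumL-map f h [] = refl
sumL-map f h (x ∷ xs) = cong (f (h x) +_) (sumL-map f h xs)

sumL-++ : ∀ {X : Set} (f : X → ℕ) xs ys → sumL f (xs ++ ys) ≡ sumL f xs + sumL f ys
sumL-++ f [] ys = refl
sumL-++ f (x ∷ xs) ys = trans (cong (f x +_) (sumL-++ f xs ys)) (sym (+-assoc (f x) _ _))

sumL-concatMap : ∀ {X Y : Set} (f : Y → ℕ) (h : X → List Y) xs → sumL f (concatMap h xs) ≡ sumL (λ x → sumL f (h x)) xs
sumL-concatMap f h [] = refl
sumL-concatMap f h (x ∷ xs) = trans (sumL-++ f (h x) (concatMap h xs)) (cong (sumL f (h x) +_) (sumL-concatMap f h xs))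

χ-∧ : ∀ x y → χ (x ∧ y) ≡ χ x * χ y
χ-∧ true y = sym (*-identityˡ (χ y))
χ-∧ false y = refl

-- Weights of the branches of the decision tree.

T^-mono : ∀ T n → T ^ n ≤ suc T ^ n
T^-mono T zero = ≤-refl
T^-mono T (suc n) = *-mono-≤ (n≤1+n T) (T^-mono T n)

-- A node with s vertices and budget k is to carry at most ((T+1)/T)^s (T+1)^k M colourings. The
-- answer "no" uses up one vertex and keeps the share T/(T+1); "yes" uses up d vertices, which by
-- the gain hypothesis leaves a share of at most 1/(T+1).
drop-branch : ∀ T M N₁ N₂ s s′ d k → suc s ≡ s′ + d → T ^ d * suc T ≤ suc T ^ d →
  N₁ * T ^ s ≤ suc T ^ (s + k) * M → N₂ * T ^ s′ ≤ suc T ^ (s′ + k) * M →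
  (N₁ + N₂) * T ^ suc s ≤ suc T ^ (suc s + k) * M
drop-branch T M N₁ N₂ s s′ d k eq gain b₁ b₂ = begin
  (N₁ + N₂) * (T * T ^ s) ≡⟨ solve 4 (λ a b t p → (a ⊹ b) ⊛ (t ⊛ p) := t ⊛ (a ⊛ p) ⊹ b ⊛ (t ⊛ p)) refl N₁ N₂ T (T ^ s) ⟩
  T * (N₁ * T ^ s) + N₂ * T ^ suc s ≤⟨ +-mono-≤ (*-monoʳ-≤ T b₁) second ⟩
  T * Z + Z ≡⟨ solve 3 (λ t p m → t ⊛ (p ⊛ m) ⊹ p ⊛ m := (con 1 ⊹ t) ⊛ p ⊛ m) refl T (suc T ^ (s + k)) M ⟩
  suc T ^ (suc s + k) * M ∎
  where
  open ≤-Reasoning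
  Z = suc T ^ (s + k) * M
  second : N₂ * T ^ suc s ≤ Z
  second = *-cancelˡ-≤ (suc T) (begin
    suc T * (N₂ * T ^ suc s) ≡⟨ cong (λ z → suc T * (N₂ * T ^ z)) eq ⟩
    suc T * (N₂ * T ^ (s′ + d)) ≡⟨ cong (λ z → suc T * (N₂ * z)) (^-distribˡ-+-* T s′ d) ⟩
    suc T * (N₂ * (T ^ s′ * T ^ d)) ≡⟨ solve 4 (λ u n p q → u ⊛ (n ⊛ (p ⊛ q)) := (n ⊛ p) ⊛ (q ⊛ u)) refl (suc T) N₂ (T ^ s′) (T ^ d) ⟩
    (N₂ * T ^ s′) * (T ^ d * suc T) ≤⟨ *-mono-≤ b₂ gain ⟩
    suc T ^ (s′ + k) * M * suc T ^ d ≡⟨ solve 3 (λ p m q → p ⊛ m ⊛ q := p ⊛ q ⊛ m) refl (suc T ^ (s′ + k)) M (suc T ^ d) ⟩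
    suc T ^ (s′ + k) * suc T ^ d * M ≡⟨ cong (_* M) (^-distribˡ-+-* (suc T) (s′ + k) d) ⟨
    suc T ^ (s′ + k + d) * M ≡⟨ cong (λ z → suc T ^ z * M) exponents ⟩
    suc T ^ (suc s + k) * M ≡⟨ *-assoc (suc T) (suc T ^ (s + k)) M ⟩
    suc T * Z ∎)
    where
    exponents : s′ + k + d ≡ suc s + k
    exponents = trans (solve 3 (λ a b c → a ⊹ b ⊹ c := a ⊹ c ⊹ b) refl s′ k d) (cong (_+ k) (sym eq))

-- Here "yes" keeps its vertices and gives up a unit of budget, worth exactly a factor T + 1.
budget-branch : ∀ T M N₁ N₂ s k →
  N₁ * T ^ s ≤ suc T ^ (s + suc k) * M → N₂ * T ^ suc s ≤ suc T ^ (suc s + k) * M →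
  (N₁ + N₂) * T ^ suc s ≤ suc T ^ (suc s + suc k) * M
budget-branch T M N₁ N₂ s k b₁ b₂ = begin
  (N₁ + N₂) * (T * T ^ s) ≡⟨ solve 4 (λ a b t p → (a ⊹ b) ⊛ (t ⊛ p) := t ⊛ (a ⊛ p) ⊹ b ⊛ (t ⊛ p)) refl N₁ N₂ T (T ^ s) ⟩
  T * (N₁ * T ^ s) + N₂ * T ^ suc s ≤⟨ +-mono-≤ (*-monoʳ-≤ T b₁) b₂ ⟩
  T * (suc T ^ (s + suc k) * M) + suc T ^ (suc s + k) * M ≡⟨ cong (λ z → T * (suc T ^ (s + suc k) * M) + suc T ^ z * M) (+-suc s k) ⟨
  T * (suc T ^ (s + suc k) * M) + suc T ^ (s + suc k) * M
    ≡⟨ solve 3 (λ t p m → t ⊛ (p ⊛ m) ⊹ p ⊛ m := (con 1 ⊹ t) ⊛ p ⊛ m) refl T (suc T ^ (s + suc k)) M ⟩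
  suc T ^ (suc s + suc k) * M ∎
  where open ≤-Reasoning

leaf-branch : ∀ T M N s k → N ≤ M → N * T ^ s ≤ suc T ^ (s + k) * M
leaf-branch T M N s k N≤M = begin
  N * T ^ s ≤⟨ *-mono-≤ N≤M (T^-mono T s) ⟩
  M * suc T ^ s ≤⟨ *-monoʳ-≤ M (^-monoʳ-≤ (suc T) (m≤m+n s k)) ⟩
  M * suc T ^ (s + k) ≡⟨ *-comm M _ ⟩
  suc T ^ (s + k) * M ∎
  where open ≤-Reasoning

-- Templates and their link graphs.

Vertex : ℕ → Set
Vertex r = ℕ × Fin r

Template : ℕ → Set
Template r = Vertex r → Bool

eqV : ∀ {r} → Vertex r → Vertex r → Bool
eqV (x , a) (y , b) = (x ≡ᵇ y) ∧ ⌊ a Fin.≟ b ⌋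

⌊≟⌋-true : ∀ {r} {a b : Fin r} → ⌊ a Fin.≟ b ⌋ ≡ true → a ≡ b
⌊≟⌋-true {a = a} {b} p with a Fin.≟ b
... | yes q = q

⌊≟⌋-refl : ∀ {r} (a : Fin r) → ⌊ a Fin.≟ a ⌋ ≡ true
⌊≟⌋-refl a with a Fin.≟ a
... | yes _ = refl
... | no q = ⊥-elim (q refl)

≡ᵇ-true : ∀ {x y} → (x ≡ᵇ y) ≡ true → x ≡ y
≡ᵇ-true {x} {y} p = ≡ᵇ⇒≡ x y (subst T (sym p) tt)

≡ᵇ-refl : ∀ x → (x ≡ᵇ x) ≡ true
≡ᵇ-refl zero = refl
≡ᵇ-refl (suc x) = ≡ᵇ-refl x

eqV-true : ∀ {r} {u v : Vertex r} → eqV u v ≡ true → u ≡ v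
eqV-true {u = x , a} {y , b} p with ∧-true⁻ {x ≡ᵇ y} p
... | p₁ , p₂ = cong₂ _,_ (≡ᵇ-true p₁) (⌊≟⌋-true p₂)

eqV-refl : ∀ {r} (u : Vertex r) → eqV u u ≡ true
eqV-refl (x , a) = ∧-true (≡ᵇ-refl x) (⌊≟⌋-refl a)

memᵇ : ∀ {r} → Vertex r → List (Vertex r) → Bool
memᵇ u = anyᵇ (eqV u)

memᵇ-true : ∀ {r} {u : Vertex r} c → memᵇ u c ≡ true → u ∈ c
memᵇ-true {u = u} c p with anyᵇ-witness (eqV u) c p
... | v , v∈c , q = subst (_∈ c) (sym (eqV-true q)) v∈c

colorsAt : ∀ {r} → Template r → ℕ → ℕ
colorsAt {r} V x = sumL (λ a → χ (V (x , a))) (allFin r)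

_≼ᵗ_ : ∀ {r} → Template r → Template r → Set
V′ ≼ᵗ V = ∀ u → V′ u ≡ true → V u ≡ true

split-≼ᵗ : ∀ {r} {V′ V : Template r} → V′ ≼ᵗ V → ∀ u → χ (V′ u) + χ (V u ∧ not (V′ u)) ≡ χ (V u)
split-≼ᵗ {V′ = V′} {V} V′≼V u with bool? (V′ u)
... | inj₁ p rewrite p | V′≼V u p = refl
... | inj₂ p rewrite p with V u
...   | true = refl
...   | false = refl

-- R stands for "forms a rainbow sum", and f₁, f₂, f₃ give the three elements that can complete two
-- given ones. With r colours each, two vertices have at most 3r completions.
module Graphs {r : ℕ} (vs : List (Vertex r)) (R : Vertex r → Vertex r → Vertex r → Bool)
  (R-comm : ∀ s u w → R s u w ≡ R s w u) (f₁ f₂ f₃ : ℕ → ℕ → ℕ)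
  (R-last : ∀ s u w → χ (R s u w) ≤ χ (proj₁ w ≡ᵇ f₁ (proj₁ s) (proj₁ u)) + χ (proj₁ w ≡ᵇ f₂ (proj₁ s) (proj₁ u)) + χ (proj₁ w ≡ᵇ f₃ (proj₁ s) (proj₁ u)))
  (R-first : ∀ s u w → χ (R s u w) ≤ χ (proj₁ s ≡ᵇ f₁ (proj₁ u) (proj₁ w)) + χ (proj₁ s ≡ᵇ f₂ (proj₁ u) (proj₁ w)) + χ (proj₁ s ≡ᵇ f₃ (proj₁ u) (proj₁ w)))
  (multiplicity : ∀ x → sumL (λ w → χ (proj₁ w ≡ᵇ x)) vs ≤ r) where

  size : Template r → ℕ
  size V = sumL (λ u → χ (V u)) vs

  -- The degree of u, with multiplicity, in the graph joining u and w whenever some s in S completes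
  -- them to a triple of R. The later `edges` sums these degrees over V, so each edge is counted
  -- from both ends.
  link : Template r → List (Vertex r) → Vertex r → ℕ
  link V S u = sumL (λ w → sumL (λ s → χ (V w ∧ R s u w)) S) vs

  degree : Template r → Vertex r → ℕ
  degree V v = sumL (λ u → sumL (λ w → χ (V u ∧ V w ∧ R v u w)) vs) vs

  edges : Template r → List (Vertex r) → ℕ
  edges V S = sumL (λ u → sumL (λ w → sumL (λ s → χ (V u ∧ V w ∧ R s u w)) S) vs) vs

  size-split : ∀ {V′ V} → V′ ≼ᵗ V → size V′ + sumL (λ u → χ (V u ∧ not (V′ u))) vs ≡ size V
  size-split {V′} {V} V′≼V = trans (sym (sumL-+ _ _ vs)) (sumL-cong _ _ vs (λ u _ → split-≼ᵗ V′≼V u))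

  size-≤ : ∀ V → size V ≤ length vs
  size-≤ V = ≤-trans (sumL-mono _ (λ _ → 1) vs (λ u _ → taut (V u ∷ []) χ (λ _ → 1))) (≤-reflexive (sumL-1 vs))

  size-drop : ∀ {V′ V u} → V′ ≼ᵗ V → u ∈ vs → V u ≡ true → V′ u ≡ false → suc (size V′) ≤ size V
  size-drop {V′} {V} {u} V′≼V u∈ Vu V′u = begin
    suc (size V′) ≡⟨ +-comm 1 (size V′) ⟩
    size V′ + 1 ≤⟨ +-monoʳ-≤ (size V′) (≤-trans (≤-reflexive (sym (cong₂ (λ x y → χ (x ∧ not y)) Vu V′u)))
                    (term≤sumL (λ u → χ (V u ∧ not (V′ u))) u∈)) ⟩
    size V′ + sumL (λ u → χ (V u ∧ not (V′ u))) vs ≡⟨ size-split V′≼V ⟩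
    size V ∎
    where open ≤-Reasoning

  link-mono : ∀ {V′ V} → V′ ≼ᵗ V → ∀ S u → link V′ S u ≤ link V S u
  link-mono {V′} {V} V′≼V S u = sumL-mono _ _ vs (λ w _ → sumL-mono _ _ S (λ s _ →
    χ-≤ (λ p → ∧-true (V′≼V w (proj₁ (∧-true⁻ p))) (proj₂ (∧-true⁻ {V′ w} p)))))

  edges-∷ : ∀ V v S → edges V (v ∷ S) ≡ degree V v + edges V S
  edges-∷ V v S = trans (sumL-cong _ _ vs (λ u _ → sumL-+ _ _ vs)) (sumL-+ _ _ vs)

  link-∷ : ∀ V v S u → link V (v ∷ S) u ≤ 3 * r + link V S u
  link-∷ V v S u = ≤-trans (≤-reflexive (sumL-+ _ _ vs)) (+-monoˡ-≤ (link V S u) (begin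
    sumL (λ w → χ (V w ∧ R v u w)) vs
      ≤⟨ sumL-3 _ (λ w → χ (proj₁ w ≡ᵇ f₁ (proj₁ v) (proj₁ u))) (λ w → χ (proj₁ w ≡ᵇ f₂ (proj₁ v) (proj₁ u)))
           (λ w → χ (proj₁ w ≡ᵇ f₃ (proj₁ v) (proj₁ u))) vs (λ w _ → ≤-trans (taut (V w ∷ R v u w ∷ []) (λ x y → χ (x ∧ y)) (λ x y → χ y)) (R-last v u w)) ⟩
    sumL (λ w → χ (proj₁ w ≡ᵇ f₁ (proj₁ v) (proj₁ u))) vs + sumL (λ w → χ (proj₁ w ≡ᵇ f₂ (proj₁ v) (proj₁ u))) vs
      + sumL (λ w → χ (proj₁ w ≡ᵇ f₃ (proj₁ v) (proj₁ u))) vs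
      ≤⟨ +-mono-≤ (+-mono-≤ (multiplicity _) (multiplicity _)) (multiplicity _) ⟩
    r + r + r ≡⟨ solve 1 (λ r → r ⊹ r ⊹ r := con 3 ⊛ r) refl r ⟩
    3 * r ∎))
    where open ≤-Reasoning

  edges-≤ : ∀ V S D → (∀ u → u ∈ vs → V u ≡ true → link V S u ≤ D) → edges V S ≤ D * size V
  edges-≤ V S D low = ≤-trans (sumL-mono _ (λ u → D * χ (V u)) vs pointwise) (≤-reflexive (sumL-*ˡ D _ vs))
    where
    pointwise : ∀ u → u ∈ vs → sumL (λ w → sumL (λ s → χ (V u ∧ V w ∧ R s u w)) S) vs ≤ D * χ (V u)
    pointwise u u∈ with bool? (V u)
    ... | inj₁ p rewrite p | *-identityʳ D = low u u∈ p
    ... | inj₂ p rewrite p = ≤-trans (≤-reflexive (trans (sumL-cong _ (λ _ → 0) vs (λ w _ → sumL-0 S)) (sumL-0 vs))) z≤n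

  lost : ∀ (V V′ : Template r) S F → (∀ u → u ∈ vs → V u ≡ true → link V S u ≤ F) →
    sumL (λ u → sumL (λ w → sumL (λ s → χ ((V u ∧ not (V′ u)) ∧ V w ∧ R s u w)) S) vs) vs ≤ F * sumL (λ u → χ (V u ∧ not (V′ u))) vs
  lost V V′ S F low = ≤-trans (sumL-mono _ (λ u → F * χ (V u ∧ not (V′ u))) vs pointwise) (≤-reflexive (sumL-*ˡ F _ vs))
    where
    pointwise : ∀ u → u ∈ vs → sumL (λ w → sumL (λ s → χ ((V u ∧ not (V′ u)) ∧ V w ∧ R s u w)) S) vs ≤ F * χ (V u ∧ not (V′ u))
    pointwise u u∈ with bool? (V u ∧ not (V′ u))
    ... | inj₁ p rewrite p | *-identityʳ F = low u u∈ (proj₁ (∧-true⁻ {V u} p))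
    ... | inj₂ p rewrite p = ≤-trans (≤-reflexive (trans (sumL-cong _ (λ _ → 0) vs (λ w _ → sumL-0 S)) (sumL-0 vs))) z≤n

  -- A lost edge has a deleted end. Each deleted vertex accounts for at most F ordered pairs as
  -- first entry and F as second.
  edges-shrink : ∀ {V′ V} → V′ ≼ᵗ V → ∀ S F → (∀ u → u ∈ vs → V u ≡ true → link V S u ≤ F) →
    edges V S + 2 * F * size V′ ≤ edges V′ S + 2 * F * size V
  edges-shrink {V′} {V} V′≼V S F low = begin
    edges V S + 2 * F * size V′ ≤⟨ +-monoˡ-≤ _ three ⟩
    edges V′ S + L₁ + L₂ + 2 * F * size V′ ≤⟨ +-monoˡ-≤ _ (+-mono-≤ (+-monoʳ-≤ (edges V′ S) (lost V V′ S F low)) (≤-trans (≤-reflexive swapped) (lost V V′ S F low))) ⟩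
    edges V′ S + F * X + F * X + 2 * F * size V′ ≡⟨ solve 4 (λ e f x s → e ⊹ f ⊛ x ⊹ f ⊛ x ⊹ con 2 ⊛ f ⊛ s := e ⊹ con 2 ⊛ f ⊛ (s ⊹ x)) refl (edges V′ S) F X (size V′) ⟩
    edges V′ S + 2 * F * (size V′ + X) ≡⟨ cong (λ z → edges V′ S + 2 * F * z) (size-split V′≼V) ⟩
    edges V′ S + 2 * F * size V ∎
    where
    open ≤-Reasoning
    X = sumL (λ u → χ (V u ∧ not (V′ u))) vs
    e₀ e′ l₁ l₂ : Vertex r → Vertex r → Vertex r → ℕ
    e₀ u w s = χ (V u ∧ V w ∧ R s u w)
    e′ u w s = χ (V′ u ∧ V′ w ∧ R s u w)
    l₁ u w s = χ ((V u ∧ not (V′ u)) ∧ V w ∧ R s u w)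
    l₂ u w s = χ ((V w ∧ not (V′ w)) ∧ V u ∧ R s w u)
    L₁ = sumL (λ u → sumL (λ w → sumL (l₁ u w) S) vs) vs
    L₂ = sumL (λ u → sumL (λ w → sumL (l₂ u w) S) vs) vs
    swapped : L₂ ≡ L₁
    swapped = sumL-swap (λ u w → sumL (l₂ u w) S) vs vs
    pointwise : ∀ u w s → e₀ u w s ≤ e′ u w s + l₁ u w s + l₂ u w s
    pointwise u w s rewrite R-comm s w u = taut (V u ∷ V′ u ∷ V w ∷ V′ w ∷ R s u w ∷ [])
      (λ u u′ w w′ ρ → χ (u ∧ w ∧ ρ)) (λ u u′ w w′ ρ → χ (u′ ∧ w′ ∧ ρ) + χ ((u ∧ not u′) ∧ w ∧ ρ) + χ ((w ∧ not w′) ∧ u ∧ ρ))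
    three : edges V S ≤ edges V′ S + L₁ + L₂
    three = sumL-3 _ (λ u → sumL (λ w → sumL (e′ u w) S) vs) (λ u → sumL (λ w → sumL (l₁ u w) S) vs)
      (λ u → sumL (λ w → sumL (l₂ u w) S) vs) vs (λ u _ →
      sumL-3 _ (λ w → sumL (e′ u w) S) (λ w → sumL (l₁ u w) S) (λ w → sumL (l₂ u w) S) vs (λ w _ →
      sumL-3 _ (e′ u w) (l₁ u w) (l₂ u w) S (λ s _ → pointwise u w s)))

  neighbour : List (Vertex r) → Vertex r → Vertex r → Bool
  neighbour S u w = anyᵇ (λ s → R s u w) S

  -- Given u and w, three elements are possible for s, and S has at most one vertex over each: an
  -- edge has multiplicity at most 3.
  link-≤-neighbours : ∀ V S u → (∀ x → sumL (λ s → χ (proj₁ s ≡ᵇ x)) S ≤ 1) →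
    link V S u ≤ 3 * sumL (λ w → χ (V w ∧ neighbour S u w)) vs
  link-≤-neighbours V S u distinct = ≤-trans (sumL-mono _ (λ w → 3 * χ (V w ∧ neighbour S u w)) vs (λ w _ → pointwise w)) (≤-reflexive (sumL-*ˡ 3 _ vs))
    where
    pointwise : ∀ w → sumL (λ s → χ (V w ∧ R s u w)) S ≤ 3 * χ (V w ∧ neighbour S u w)
    pointwise w with bool? (V w) | bool? (neighbour S u w)
    ... | inj₂ p | _ rewrite p = ≤-reflexive (sumL-0 S)
    ... | inj₁ p | inj₂ q rewrite p | q = ≤-reflexive (trans (sumL-cong _ (λ _ → 0) S (λ s s∈ → cong χ (anyᵇ-false (λ s → R s u w) S q s s∈))) (sumL-0 S))
    ... | inj₁ p | inj₁ q rewrite p | q = ≤-trans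
      (sumL-3 _ (λ s → χ (proj₁ s ≡ᵇ f₁ (proj₁ u) (proj₁ w))) (λ s → χ (proj₁ s ≡ᵇ f₂ (proj₁ u) (proj₁ w))) (λ s → χ (proj₁ s ≡ᵇ f₃ (proj₁ u) (proj₁ w))) S
        (λ s _ → R-first s u w))
      (+-mono-≤ (+-mono-≤ (distinct _) (distinct _)) (distinct _))

-- The decision tree and its containers.

occurs-once : ∀ {m} n (h : Fin n → Fin m) (b : Fin m) → (∀ {i j} → h i ≡ h j → i ≡ j) →
  sumL (λ a → χ ⌊ b Fin.≟ a ⌋) (List.tabulate h) ≤ 1
occurs-once zero h b inj = z≤n
occurs-once (suc n) h b inj with b Fin.≟ h zero
... | no _ = occurs-once n (λ i → h (suc i)) b (λ p → Fin.suc-injective (inj p))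
... | yes refl = ≤-reflexive (cong suc (trans (sumL-cong _ (λ _ → 0) _ elsewhere) (sumL-0 (List.tabulate (λ i → h (suc i))))))
  where
  elsewhere : ∀ a → a ∈ List.tabulate (λ i → h (suc i)) → χ ⌊ h zero Fin.≟ a ⌋ ≡ 0
  elsewhere a a∈ with ∈-tabulate⁻ a∈
  ... | i , refl with h zero Fin.≟ h (suc i)
  ...   | no _ = refl
  ...   | yes p with inj p
  ...     | ()

module Containers {r : ℕ} (vs : List (Vertex r)) (R : Vertex r → Vertex r → Vertex r → Bool)
  (R-comm : ∀ s u w → R s u w ≡ R s w u) (f₁ f₂ f₃ : ℕ → ℕ → ℕ)
  (R-last : ∀ s u w → χ (R s u w) ≤ χ (proj₁ w ≡ᵇ f₁ (proj₁ s) (proj₁ u)) + χ (proj₁ w ≡ᵇ f₂ (proj₁ s) (proj₁ u)) + χ (proj₁ w ≡ᵇ f₃ (proj₁ s) (proj₁ u)))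
  (R-first : ∀ s u w → χ (R s u w) ≤ χ (proj₁ s ≡ᵇ f₁ (proj₁ u) (proj₁ w)) + χ (proj₁ s ≡ᵇ f₂ (proj₁ u) (proj₁ w)) + χ (proj₁ s ≡ᵇ f₃ (proj₁ u) (proj₁ w)))
  (multiplicity : ∀ x → sumL (λ w → χ (proj₁ w ≡ᵇ x)) vs ≤ r)
  (cols : List (List (Vertex r)))
  (functional : ∀ c → c ∈ cols → ∀ x a b → (x , a) ∈ c → (x , b) ∈ c → a ≡ b)
  (D Δ T₀ M budget : ℕ)
  (gain : T₀ ^ suc D * suc T₀ ≤ suc T₀ ^ suc D) where

  open Graphs vs R R-comm f₁ f₂ f₃ R-last R-first multiplicity public

  -- Link sizes stay below F: only vertices with link below 3 * suc D are ever followed by a new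
  -- forced vertex, which adds at most 3 * r.
  F : ℕ
  F = 3 * suc D + 3 * r

  active : Template r → Vertex r → Bool
  active V v = V v ∧ (2 ≤ᵇ colorsAt V (proj₁ v)) ∧ (Δ ≤ᵇ degree V v)

  Terminal : Template r → Set
  Terminal V = ∀ v → v ∈ vs → active V v ≡ false

  -- A node of the tree: Q selects the colourings consistent with the answers so far, S collects the
  -- active vertices answered "yes", k is the budget left. `balance` says that the (budget - k) Δ
  -- edges paid in are still present or were lost with deleted vertices, at most 2F for each.
  record State (V : Template r) (S : List (Vertex r)) (Q : List (Vertex r) → Bool) (k : ℕ) : Set where
    field
      fits : ∀ c → c ∈ cols → Q c ≡ true → ∀ v → v ∈ c → V v ≡ true
      contains : ∀ c → c ∈ cols → Q c ≡ true → ∀ v → v ∈ S → v ∈ c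
      free : ∀ c → c ∈ cols → Q c ≡ true → ∀ u v w → u ∈ c → v ∈ c → w ∈ c → R u v w ≡ false
      distinct : ∀ x → sumL (λ s → χ (proj₁ s ≡ᵇ x)) S ≤ 1
      forced : ∀ s → s ∈ S → ∀ a → V (proj₁ s , a) ≡ true → a ≡ proj₂ s
      low : ∀ u → u ∈ vs → V u ≡ true → link V S u ≤ F
      balance : budget * Δ + 2 * F * size V ≤ edges V S + 2 * F * length vs + k * Δ
  open State

  balance-step : ∀ {V V′ S} k → V′ ≼ᵗ V → (∀ u → u ∈ vs → V u ≡ true → link V S u ≤ F) →
    budget * Δ + 2 * F * size V ≤ edges V S + 2 * F * length vs + k * Δ →
    budget * Δ + 2 * F * size V′ ≤ edges V′ S + 2 * F * length vs + k * Δ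
  balance-step {V} {V′} {S} k V′≼V low bal = lin (budget * Δ ∷ 2 * F * size V ∷ 2 * F * size V′ ∷ edges V S ∷ edges V′ S ∷ 2 * F * length vs ∷ k * Δ ∷ [])
    (λ b s s′ e e′ l k → (b :+ s :≤ e :+ l :+ k) ∷ (e :+ s′ :≤ e′ :+ s) ∷ [] ⊢ b :+ s′ :≤ e′ :+ l :+ k)
    bal (edges-shrink {V′} {V} V′≼V S F low)

  restrict : ∀ {V V′ S Q Q′ k} → State V S Q k → V′ ≼ᵗ V →
    (∀ c → c ∈ cols → Q′ c ≡ true → Q c ≡ true) →
    (∀ c → c ∈ cols → Q′ c ≡ true → ∀ v → v ∈ c → V′ v ≡ true) → State V′ S Q′ k
  restrict {V} {V′} {S} {k = k} st V′≼V Q′⇒Q fits′ = record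
    { fits = fits′
    ; contains = λ c c∈ q → contains st c c∈ (Q′⇒Q c c∈ q)
    ; free = λ c c∈ q → free st c c∈ (Q′⇒Q c c∈ q)
    ; distinct = distinct st
    ; forced = λ s s∈ a p → forced st s s∈ a (V′≼V _ p)
    ; low = λ u u∈ p → ≤-trans (link-mono {V′} {V} V′≼V S u) (low st u u∈ (V′≼V u p))
    ; balance = balance-step {V} {V′} {S} k V′≼V (low st) (balance st)
    }

  remove : Vertex r → Template r → Template r
  remove u V v = V v ∧ not (eqV u v)

  remove-≼ᵗ : ∀ u V → remove u V ≼ᵗ V
  remove-≼ᵗ u V v p = proj₁ (∧-true⁻ p)

  remove-self : ∀ u V → remove u V u ≡ false
  remove-self u V rewrite eqV-refl u with V u
  ... | true = refl
  ... | false = refl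

  without : ∀ {V S Q k} u → State V S Q k → State (remove u V) S (λ c → Q c ∧ not (memᵇ u c)) k
  without {Q = Q} u st = restrict st (remove-≼ᵗ u _) (λ c _ q → proj₁ (∧-true⁻ q))
    (λ c c∈ q v v∈ → ∧-true (fits st c c∈ (proj₁ (∧-true⁻ q)) v v∈)
      (not-false (anyᵇ-false (eqV u) c (not-true (proj₂ (∧-true⁻ {Q c} q))) v v∈)))

  delete-neighbours : List (Vertex r) → Vertex r → Template r → Template r
  delete-neighbours S u V w = V w ∧ not (neighbour S u w)

  -- A colouring that uses u and all of S cannot use a neighbour of u, which would complete a
  -- forbidden triple.
  with-hub : ∀ {V S Q k} u → State V S Q k → State (delete-neighbours S u V) S (λ c → Q c ∧ memᵇ u c) k
  with-hub {V} {S} {Q} u st = restrict st (λ v p → proj₁ (∧-true⁻ p)) (λ c _ q → proj₁ (∧-true⁻ q))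
    (λ c c∈ q v v∈ → let Qc = proj₁ (∧-true⁻ q) in ∧-true (fits st c c∈ Qc v v∈)
      (not-false (no-neighbour c c∈ Qc (memᵇ-true c (proj₂ (∧-true⁻ {Q c} q))) v v∈)))
    where
    no-neighbour : ∀ c → c ∈ cols → Q c ≡ true → u ∈ c → ∀ v → v ∈ c → neighbour S u v ≡ false
    no-neighbour c c∈ Qc u∈ v v∈ with bool? (neighbour S u v)
    ... | inj₂ p = p
    ... | inj₁ p with anyᵇ-witness (λ s → R s u v) S p
    ...   | s , s∈ , ρ = ⊥-elim (false≢true (trans (sym (free st c c∈ Qc s u v (contains st c c∈ Qc s s∈) u∈ v∈)) ρ))

  hub-drop : ∀ {V S Q k} u → State V S Q k → 3 * suc D ≤ link V S u → size (delete-neighbours S u V) + suc D ≤ size V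
  hub-drop {V} {S} u st large = begin
    size V′ + suc D ≤⟨ +-monoʳ-≤ (size V′) (*-cancelˡ-≤ 3 (≤-trans large (link-≤-neighbours V S u (distinct st)))) ⟩
    size V′ + sumL (λ w → χ (V w ∧ neighbour S u w)) vs ≤⟨ +-monoʳ-≤ (size V′) (sumL-mono _ _ vs (λ w _ → taut (V w ∷ neighbour S u w ∷ []) (λ x y → χ (x ∧ y)) (λ x y → χ (x ∧ not (x ∧ not y))))) ⟩
    size V′ + sumL (λ w → χ (V w ∧ not (V′ w))) vs ≡⟨ size-split {V′} {V} (λ v p → proj₁ (∧-true⁻ p)) ⟩
    size V ∎
    where
    open ≤-Reasoning
    V′ = delete-neighbours S u V

  pin : Vertex r → Template r → Template r
  pin (x , a) V (y , b) = V (y , b) ∧ (not (x ≡ᵇ y) ∨ ⌊ a Fin.≟ b ⌋)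

  pinned : ∀ v V a → pin v V (proj₁ v , a) ≡ true → a ≡ proj₂ v
  pinned (x , b) V a p rewrite ≡ᵇ-refl x = sym (⌊≟⌋-true (proj₂ (∧-true⁻ {V (x , a)} p)))

  colorsAt-≤1 : ∀ V x b → (∀ a → V (x , a) ≡ true → a ≡ b) → colorsAt V x ≤ 1
  colorsAt-≤1 V x b H = ≤-trans (sumL-mono _ (λ a → χ ⌊ b Fin.≟ a ⌋) (allFin r) (λ a _ → χ-≤ (λ p →
    trans (cong (λ z → ⌊ b Fin.≟ z ⌋) (H a p)) (⌊≟⌋-refl b)))) (occurs-once r id b (λ p → p))

  -- Elements of S have been pinned to a single colour. This is why active vertices must have an
  -- alternative colour: S then never gets two vertices over one element.
  unpinned : ∀ {V S Q k} → State V S Q k → ∀ x → 2 ≤ colorsAt V x → sumL (λ s → χ (proj₁ s ≡ᵇ x)) S ≡ 0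
  unpinned {V} {S} st x two = trans (sumL-cong _ (λ _ → 0) S other) (sumL-0 S)
    where
    other : ∀ s → s ∈ S → χ (proj₁ s ≡ᵇ x) ≡ 0
    other s s∈ with bool? (proj₁ s ≡ᵇ x)
    ... | inj₂ p = cong χ p
    ... | inj₁ p with ≡ᵇ-true {proj₁ s} {x} p
    ...   | refl = ⊥-elim (<⇒≱ two (colorsAt-≤1 V (proj₁ s) (proj₂ s) (forced st s s∈)))

  -- The degree of v enters the link graph as at least Δ new edges, which pay for the unit of
  -- budget. Links grow by at most 3r from at most 3 (D + 1), hence stay below F.
  with-pin : ∀ {V S Q k} v → v ∈ vs → State V S Q (suc k) → 2 ≤ colorsAt V (proj₁ v) → Δ ≤ degree V v →
    (∀ u → u ∈ vs → V u ≡ true → link V S u ≤ 3 * suc D) →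
    State (pin v V) (v ∷ S) (λ c → Q c ∧ memᵇ v c) k
  with-pin {V} {S} {Q} {k} v v∈ st two Δ≤ low′ = record
    { fits = λ c c∈ q w w∈ → let Qc = proj₁ (∧-true⁻ q) in
        ∧-true (fits st c c∈ Qc w w∈) (agree c c∈ (memᵇ-true c (proj₂ (∧-true⁻ {Q c} q))) w w∈)
    ; contains = λ { c c∈ q s (here refl) → memᵇ-true c (proj₂ (∧-true⁻ {Q c} q))
                   ; c c∈ q s (there s∈) → contains st c c∈ (proj₁ (∧-true⁻ q)) s s∈ }
    ; free = λ c c∈ q → free st c c∈ (proj₁ (∧-true⁻ q))
    ; distinct = distinct′
    ; forced = λ { s (here refl) a p → pinned v V a p
                 ; s (there s∈) a p → forced st s s∈ a (proj₁ (∧-true⁻ p)) }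
    ; low = λ u u∈ p → ≤-trans (link-mono {pin v V} {V} (λ w q → proj₁ (∧-true⁻ q)) (v ∷ S) u) (low₁ u u∈ (proj₁ (∧-true⁻ p)))
    ; balance = balance-step {V} {pin v V} {v ∷ S} k (λ w q → proj₁ (∧-true⁻ q)) low₁ balance₁
    }
    where
    agree : ∀ c → c ∈ cols → v ∈ c → ∀ w → w ∈ c → not (proj₁ v ≡ᵇ proj₁ w) ∨ ⌊ proj₂ v Fin.≟ proj₂ w ⌋ ≡ true
    agree c c∈ v∈ w w∈ with bool? (proj₁ v ≡ᵇ proj₁ w)
    ... | inj₂ p rewrite p = refl
    ... | inj₁ p rewrite p = same (≡ᵇ-true p)
      where
      same : proj₁ v ≡ proj₁ w → ⌊ proj₂ v Fin.≟ proj₂ w ⌋ ≡ true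
      same refl rewrite functional c c∈ (proj₁ v) (proj₂ v) (proj₂ w) v∈ w∈ = ⌊≟⌋-refl (proj₂ w)
    distinct′ : ∀ x → sumL (λ s → χ (proj₁ s ≡ᵇ x)) (v ∷ S) ≤ 1
    distinct′ x with bool? (proj₁ v ≡ᵇ x)
    ... | inj₂ p rewrite p = distinct st x
    ... | inj₁ p rewrite p with ≡ᵇ-true {proj₁ v} {x} p
    ...   | refl = ≤-reflexive (cong suc (unpinned st (proj₁ v) two))
    low₁ : ∀ u → u ∈ vs → V u ≡ true → link V (v ∷ S) u ≤ F
    low₁ u u∈ p = ≤-trans (link-∷ V v S u) (≤-trans (+-monoʳ-≤ (3 * r) (low′ u u∈ p)) (≤-reflexive (+-comm (3 * r) (3 * suc D))))
    balance₁ : budget * Δ + 2 * F * size V ≤ edges V (v ∷ S) + 2 * F * length vs + k * Δ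
    balance₁ = lin (budget * Δ ∷ 2 * F * size V ∷ edges V S ∷ degree V v ∷ edges V (v ∷ S) ∷ 2 * F * length vs ∷ k * Δ ∷ Δ ∷ [])
      (λ b s e d e′ l k δ → (b :+ s :≤ e :+ l :+ (δ :+ k)) ∷ (δ :≤ d) ∷ (d :+ e :≤ e′) ∷ [] ⊢ b :+ s :≤ e′ :+ l :+ k)
      (balance st) Δ≤ (≤-reflexive (sym (edges-∷ V v S)))

  -- With the budget spent, `balance` asks for more edges than small links and deleted vertices can
  -- account for.
  out-of-budget : ∀ {V S Q} → State V S Q 0 → (3 * suc D + 2 * F) * length vs < budget * Δ →
    (∀ u → u ∈ vs → V u ≡ true → link V S u ≤ 3 * suc D) → ⊥
  out-of-budget {V} {S} st enough low′ = <-irrefl refl (≤-trans enough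
    (lin (budget * Δ ∷ 2 * F * size V ∷ edges V S ∷ 2 * F * length vs ∷ 3 * suc D * length vs ∷ (3 * suc D + 2 * F) * length vs ∷ [])
      (λ b s e l d t → (b :+ s :≤ e :+ l :+ lit 0) ∷ (e :≤ d) ∷ (d :+ l :≤ t) ∷ [] ⊢ b :≤ t)
      (balance st) (≤-trans (edges-≤ V S (3 * suc D) low′) (*-monoʳ-≤ (3 * suc D) (size-≤ V)))
      (≤-reflexive (sym (*-distribʳ-+ (length vs) (3 * suc D) (2 * F))))))

  branch : ∀ (Q : List (Vertex r) → Bool) u → sumL (λ c → χ (Q c)) cols
    ≡ sumL (λ c → χ (Q c ∧ not (memᵇ u c))) cols + sumL (λ c → χ (Q c ∧ memᵇ u c)) cols
  branch Q u = trans (sumL-cong _ _ cols (λ c _ → pointwise (Q c) (memᵇ u c))) (sumL-+ _ _ cols)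
    where
    pointwise : ∀ x y → χ x ≡ χ (x ∧ not y) + χ (x ∧ y)
    pointwise true true = refl
    pointwise true false = refl
    pointwise false y = refl

  module _ (leaf : ∀ V → Terminal V → sumL (λ c → χ (allᵇ V c)) cols ≤ M)
    (enough : (3 * suc D + 2 * F) * length vs < budget * Δ) where

    Bound : (List (Vertex r) → Bool) → ℕ → ℕ → Set
    Bound Q s k = sumL (λ c → χ (Q c)) cols * T₀ ^ s ≤ suc T₀ ^ (s + k) * M

    -- Hubs are asked about first, so that all links are small whenever a vertex is pinned. Every
    -- answer lowers s + k, which `fuel` dominates.
    few-colorings : ∀ fuel V S Q k s → State V S Q k → size V ≤ s → s + k < fuel → Bound Q s k

    on-hub : ∀ fuel V S Q k s u → State V S Q k → size V ≤ s → s + k < suc fuel →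
      u ∈ vs → V u ≡ true → 3 * suc D ≤ link V S u → Bound Q s k
    on-hub fuel V S Q k zero u st size≤ s+k< u∈ Vu large = ⊥-elim (<⇒≱ (size-drop {remove u V} {V} (remove-≼ᵗ u V) u∈ Vu (remove-self u V)) (≤-trans size≤ z≤n))
    on-hub fuel V S Q k (suc s) u st size≤ s+k< u∈ Vu large =
      subst (λ z → z * T₀ ^ suc s ≤ suc T₀ ^ (suc s + k) * M) (sym (branch Q u))
        (drop-branch T₀ M (sumL (λ c → χ (Q c ∧ not (memᵇ u c))) cols) (sumL (λ c → χ (Q c ∧ memᵇ u c)) cols) s s′ (suc D) k (sym s′+d) gain
          (few-colorings fuel _ S _ k s (without u st)
            (≤-pred (≤-trans (size-drop {remove u V} {V} (remove-≼ᵗ u V) u∈ Vu (remove-self u V)) size≤)) (≤-pred s+k<))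
          (few-colorings fuel _ S _ k s′ (with-hub u st)
            (+-cancelʳ-≤ (suc D) _ _ (≤-trans (≤-trans (hub-drop u st large) size≤) (≤-reflexive (sym s′+d))))
            (≤-trans (s≤s (+-monoˡ-≤ k s′≤s)) (≤-pred s+k<))))
      where
      s′ = suc s ∸ suc D
      s′+d : s′ + suc D ≡ suc s
      s′+d = m∸n+n≡m (≤-trans (m≤n+m (suc D) _) (≤-trans (hub-drop u st large) size≤))
      s′≤s : s′ ≤ s
      s′≤s = m∸n≤m s D

    on-active : ∀ fuel V S Q k s v → State V S Q k → size V ≤ s → s + k < suc fuel →
      (∀ u → u ∈ vs → V u ≡ true → link V S u ≤ 3 * suc D) →
      v ∈ vs → V v ≡ true → 2 ≤ colorsAt V (proj₁ v) → Δ ≤ degree V v → Bound Q s k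
    on-active fuel V S Q k zero v st size≤ s+k< low′ v∈ Vv two Δ≤ = ⊥-elim (<⇒≱ (size-drop {remove v V} {V} (remove-≼ᵗ v V) v∈ Vv (remove-self v V)) (≤-trans size≤ z≤n))
    on-active fuel V S Q zero (suc s) v st size≤ s+k< low′ v∈ Vv two Δ≤ = ⊥-elim (out-of-budget st enough low′)
    on-active fuel V S Q (suc k) (suc s) v st size≤ s+k< low′ v∈ Vv two Δ≤ =
      subst (λ z → z * T₀ ^ suc s ≤ suc T₀ ^ (suc s + suc k) * M) (sym (branch Q v))
        (budget-branch T₀ M (sumL (λ c → χ (Q c ∧ not (memᵇ v c))) cols) (sumL (λ c → χ (Q c ∧ memᵇ v c)) cols) s k
          (few-colorings fuel _ S _ (suc k) s (without v st)
            (≤-pred (≤-trans (size-drop {remove v V} {V} (remove-≼ᵗ v V) v∈ Vv (remove-self v V)) size≤)) (≤-pred s+k<))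
          (few-colorings fuel _ (v ∷ S) _ k (suc s) (with-pin v v∈ st two Δ≤ low′)
            (≤-trans (sumL-mono _ _ vs (λ w _ → χ-≤ (λ p → proj₁ (∧-true⁻ p)))) size≤)
            (≤-trans (≤-reflexive (sym (cong suc (+-suc s k)))) (≤-pred s+k<))))

    few-colorings (suc fuel) V S Q k s st size≤ s+k< with search-list (λ u → V u ∧ (3 * suc D ≤ᵇ link V S u)) vs
    ... | inj₁ (u , u∈ , p) = on-hub fuel V S Q k s u st size≤ s+k< u∈ (proj₁ (∧-true⁻ p)) (≤ᵇ-true (proj₂ (∧-true⁻ {V u} p)))
    ... | inj₂ no-hub with search-list (active V) vs
    ...   | inj₁ (v , v∈ , p) = on-active fuel V S Q k s v st size≤ s+k< low′ v∈ (proj₁ (∧-true⁻ p))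
              (≤ᵇ-true (proj₁ (∧-true⁻ (proj₂ (∧-true⁻ {V v} p)))))
              (≤ᵇ-true (proj₂ (∧-true⁻ {2 ≤ᵇ colorsAt V (proj₁ v)} (proj₂ (∧-true⁻ {V v} p)))))
      where
      low′ : ∀ u → u ∈ vs → V u ≡ true → link V S u ≤ 3 * suc D
      low′ u u∈ Vu with ≤-total (link V S u) (3 * suc D)
      ... | inj₁ q = q
      ... | inj₂ q = ⊥-elim (false≢true (trans (sym (no-hub u u∈)) (∧-true Vu (≤⇒≤ᵇ-true q))))
    ...   | inj₂ terminal = leaf-branch T₀ M _ s k (≤-trans
              (sumL-mono _ _ cols (λ c c∈ → χ-≤ (λ q → allᵇ-intro V c (fits st c c∈ q)))) (leaf V terminal))

-- Subsets as predicates, colourings as lists of vertices.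

elemsFrom : ∀ {k} → Vec Bool k → ℕ → List ℕ
elemsFrom [] _ = []
elemsFrom (true ∷ v) m = m ∷ elemsFrom v (suc m)
elemsFrom (false ∷ v) m = elemsFrom v (suc m)

-- The left-hand side is the local function of elems; it cannot be named, so it is
-- inferred from the use in elems-false, where all its arguments have been abstracted.
local≡elemsFrom : ∀ n (p : Vec Bool n) k (v : Vec Bool k) m → _ ≡ elemsFrom v m

elems-false : ∀ {k} (v : Vec Bool k) → elems (false ∷ v) ≡ elemsFrom v 2
elems-false {k} v with suc k | Vec._∷_ false v | 2
... | n | p | m = local≡elemsFrom n p k v m

local≡elemsFrom n p zero [] m = refl
local≡elemsFrom n p (suc k) (true ∷ v) m = cong (m ∷_) (local≡elemsFrom n p k v (suc m))
local≡elemsFrom n p (suc k) (false ∷ v) m = local≡elemsFrom n p k v (suc m)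

elems≡elemsFrom : ∀ {n} (A : Vec Bool n) → elems A ≡ elemsFrom A 1
elems≡elemsFrom A = local≡elemsFrom _ A _ A 1

at : ∀ {k} → Vec Bool k → ℕ → Bool
at [] _ = false
at (b ∷ v) zero = b
at (b ∷ v) (suc i) = at v i

-- Translates the index i of the vector into the integer i + 1. The integer 0 becomes a non-member,
-- which matches counts up to `suc n`.
indicator : ∀ {n} → Vec Bool n → ℕ → Bool
indicator A zero = false
indicator A (suc i) = at A i

at-beyond : ∀ {k} (v : Vec Bool k) i → k ≤ i → at v i ≡ false
at-beyond [] i _ = refl
at-beyond (b ∷ v) (suc i) (s≤s p) = at-beyond v i p

indicator-≤ : ∀ {n} (A : Vec Bool n) x → indicator A x ≡ true → x ≤ n
indicator-≤ {n} A (suc i) p with ≤-total (suc i) n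
... | inj₁ q = q
... | inj₂ q with m≤n⇒m<n∨m≡n q
...   | inj₂ r = ≤-reflexive (sym r)
...   | inj₁ r = ⊥-elim (false≢true (trans (sym (at-beyond A i (≤-pred r))) p))

indicator-pos : ∀ {n} (A : Vec Bool n) x → indicator A x ≡ true → 1 ≤ x
indicator-pos A (suc i) p = s≤s z≤n

sumL-elemsFrom : ∀ {k} (v : Vec Bool k) m f → sumL f (elemsFrom v m) ≡ sum< (λ i → χ (at v i) * f (m + i)) k
sumL-elemsFrom [] m f = refl
sumL-elemsFrom {suc k} (b ∷ v) m f = trans (head b) (sym (sum<-suc (λ i → χ (at (b ∷ v) i) * f (m + i)) k))
  where
  rest : sumL f (elemsFrom v (suc m)) ≡ sum< (λ i → χ (at v i) * f (m + suc i)) k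
  rest = trans (sumL-elemsFrom v (suc m) f) (sum<-cong _ _ k (λ i _ → cong (λ z → χ (at v i) * f z) (sym (+-suc m i))))
  head : ∀ b → sumL f (elemsFrom (b ∷ v) m) ≡ χ b * f (m + 0) + sum< (λ i → χ (at v i) * f (m + suc i)) k
  head true = cong₂ _+_ (trans (cong f (sym (+-identityʳ m))) (sym (+-identityʳ _))) rest
  head false = rest

sumL-elems : ∀ {n} (A : Vec Bool n) f → sumL f (elems A) ≡ sum< (λ x → χ (indicator A x) * f x) (suc n)
sumL-elems {n} A f = trans (cong (sumL f) (elems≡elemsFrom A)) (trans (sumL-elemsFrom A 1 f)
  (sym (sum<-suc (λ x → χ (indicator A x) * f x) n)))

∈-elemsFrom : ∀ {k} (v : Vec Bool k) m x → x ∈ elemsFrom v m → ∃[ i ] (x ≡ m + i × at v i ≡ true)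
∈-elemsFrom (true ∷ v) m x (here refl) = 0 , sym (+-identityʳ m) , refl
∈-elemsFrom (true ∷ v) m x (there p) with ∈-elemsFrom v (suc m) x p
... | i , q , a = suc i , trans q (sym (+-suc m i)) , a
∈-elemsFrom (false ∷ v) m x p with ∈-elemsFrom v (suc m) x p
... | i , q , a = suc i , trans q (sym (+-suc m i)) , a

∈-elemsFrom⁺ : ∀ {k} (v : Vec Bool k) m i → at v i ≡ true → m + i ∈ elemsFrom v m
∈-elemsFrom⁺ (true ∷ v) m zero p = here (+-identityʳ m)
∈-elemsFrom⁺ (true ∷ v) m (suc i) p = there (subst (_∈ elemsFrom v (suc m)) (sym (+-suc m i)) (∈-elemsFrom⁺ v (suc m) i p))
∈-elemsFrom⁺ (false ∷ v) m (suc i) p = subst (_∈ elemsFrom v (suc m)) (sym (+-suc m i)) (∈-elemsFrom⁺ v (suc m) i p)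

∈-elems : ∀ {n} (A : Vec Bool n) x → x ∈ elems A → indicator A x ≡ true
∈-elems A x x∈ with ∈-elemsFrom A 1 x (subst (x ∈_) (elems≡elemsFrom A) x∈)
... | i , refl , p = p

∈-elems⁺ : ∀ {n} (A : Vec Bool n) x → indicator A x ≡ true → x ∈ elems A
∈-elems⁺ A (suc i) p = subst (suc i ∈_) (sym (elems≡elemsFrom A)) (∈-elemsFrom⁺ A 1 i p)

Distinct : List ℕ → Set
Distinct [] = ⊤
Distinct (x ∷ xs) = (∀ y → y ∈ xs → x ≡ y → ⊥) × Distinct xs

distinct-elemsFrom : ∀ {k} (v : Vec Bool k) m → Distinct (elemsFrom v m)
distinct-elemsFrom [] m = tt
distinct-elemsFrom (true ∷ v) m = fresh , distinct-elemsFrom v (suc m)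
  where
  fresh : ∀ y → y ∈ elemsFrom v (suc m) → m ≡ y → ⊥
  fresh y y∈ refl with ∈-elemsFrom v (suc m) m y∈
  ... | i , q , _ = <-irrefl q (s≤s (m≤m+n m i))
distinct-elemsFrom (false ∷ v) m = distinct-elemsFrom v (suc m)

distinct-elems : ∀ {n} (A : Vec Bool n) → Distinct (elems A)
distinct-elems A = subst Distinct (sym (elems≡elemsFrom A)) (distinct-elemsFrom A 1)

distinct-occurs : ∀ xs → Distinct xs → ∀ x → sumL (λ y → χ (y ≡ᵇ x)) xs ≤ 1
distinct-occurs [] d x = z≤n
distinct-occurs (y ∷ ys) (fresh , d) x with bool? (y ≡ᵇ x)
... | inj₂ p rewrite p = distinct-occurs ys d x
... | inj₁ p rewrite p = ≤-reflexive (cong suc (trans (sumL-cong _ (λ _ → 0) ys elsewhere) (sumL-0 ys)))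
  where
  elsewhere : ∀ z → z ∈ ys → χ (z ≡ᵇ x) ≡ 0
  elsewhere z z∈ with bool? (z ≡ᵇ x)
  ... | inj₂ q = cong χ q
  ... | inj₁ q = ⊥-elim (fresh z z∈ (trans (≡ᵇ-true {y} p) (sym (≡ᵇ-true {z} q))))

vertices : ∀ r → List ℕ → List (Vertex r)
vertices r X = concatMap (λ x → map (x ,_) (allFin r)) X

sumL-vertices : ∀ r X (f : Vertex r → ℕ) → sumL f (vertices r X) ≡ sumL (λ x → sumL (λ a → f (x , a)) (allFin r)) X
sumL-vertices r X f = trans (sumL-concatMap f (λ x → map (x ,_) (allFin r)) X)
  (sumL-cong _ _ X (λ x _ → sumL-map f (x ,_) (allFin r)))

sumL-const-allFin : ∀ r c → sumL (λ _ → c) (allFin r) ≡ r * c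
sumL-const-allFin r c = begin
  sumL (λ _ → c) (allFin r) ≡⟨ sumL-cong _ (λ _ → c * 1) (allFin r) (λ _ _ → sym (*-identityʳ c)) ⟩
  sumL (λ _ → c * 1) (allFin r) ≡⟨ sumL-*ˡ c (λ _ → 1) (allFin r) ⟩
  c * sumL (λ _ → 1) (allFin r) ≡⟨ cong (c *_) (trans (sumL-1 (allFin r)) (length-tabulate {n = r} id)) ⟩
  c * r ≡⟨ *-comm c r ⟩
  r * c ∎
  where open ≡-Reasoning

multiplicity-vertices : ∀ r X → Distinct X → ∀ x → sumL (λ w → χ (proj₁ w ≡ᵇ x)) (vertices r X) ≤ r
multiplicity-vertices r X d x = begin
  sumL (λ w → χ (proj₁ w ≡ᵇ x)) (vertices r X) ≡⟨ sumL-vertices r X _ ⟩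
  sumL (λ y → sumL (λ _ → χ (y ≡ᵇ x)) (allFin r)) X ≡⟨ sumL-cong _ _ X (λ y _ → sumL-const-allFin r (χ (y ≡ᵇ x))) ⟩
  sumL (λ y → r * χ (y ≡ᵇ x)) X ≡⟨ sumL-*ˡ r _ X ⟩
  r * sumL (λ y → χ (y ≡ᵇ x)) X ≤⟨ *-monoʳ-≤ r (distinct-occurs X d x) ⟩
  r * 1 ≡⟨ *-identityʳ r ⟩
  r ∎
  where open ≤-Reasoning

length-vertices : ∀ r X → length (vertices r X) ≡ length X * r
length-vertices r X = trans (sym (sumL-1 (vertices r X))) (trans (sumL-vertices r X (λ _ → 1))
  (trans (sumL-cong _ (λ _ → r * 1) X (λ _ _ → sumL-const-allFin r 1))
  (trans (sumL-*ˡ r (λ _ → 1) X) (trans (cong (r *_) (sumL-1 X)) (*-comm r (length X))))))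

∈-vertices : ∀ r X x a → x ∈ X → (x , a) ∈ vertices r X
∈-vertices r X x a x∈ = ∈-concatMap⁺ (λ x → map (x ,_) (allFin r)) (lose x∈ (∈-map⁺ (x ,_) (∈-allFin a)))

∈-allColorings : ∀ r x xs c → c ∈ allColorings r (x ∷ xs) → ∃[ a ] ∃[ c′ ] (c ≡ (x , a) ∷ c′ × c′ ∈ allColorings r xs)
∈-allColorings r x xs c c∈ with find (∈-concatMap⁻ (λ a → map ((x , a) ∷_) (allColorings r xs)) {xs = allFin r} c∈)
... | a , _ , p with ∈-map⁻ ((x , a) ∷_) p
...   | c′ , c′∈ , q = a , c′ , q , c′∈

coloring-domain : ∀ r X c → c ∈ allColorings r X → ∀ x a → (x , a) ∈ c → x ∈ X
coloring-domain r [] c (here refl) x a ()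
coloring-domain r (y ∷ ys) c c∈ x a p with ∈-allColorings r y ys c c∈
coloring-domain r (y ∷ ys) c c∈ x a (here refl) | b , c′ , refl , c′∈ = here refl
coloring-domain r (y ∷ ys) c c∈ x a (there p) | b , c′ , refl , c′∈ = there (coloring-domain r ys c′ c′∈ x a p)

coloring-functional : ∀ r X → Distinct X → ∀ c → c ∈ allColorings r X → ∀ x a b → (x , a) ∈ c → (x , b) ∈ c → a ≡ b
coloring-functional r [] d c (here refl) x a b ()
coloring-functional r (y ∷ ys) (fresh , d) c c∈ x a b p q with ∈-allColorings r y ys c c∈
coloring-functional r (y ∷ ys) (fresh , d) c c∈ x a b (here refl) (here refl) | _ , c′ , refl , c′∈ = refl
coloring-functional r (y ∷ ys) (fresh , d) c c∈ x a b (here refl) (there q) | _ , c′ , refl , c′∈ =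
  ⊥-elim (fresh x (coloring-domain r ys c′ c′∈ x b q) refl)
coloring-functional r (y ∷ ys) (fresh , d) c c∈ x a b (there p) (here refl) | _ , c′ , refl , c′∈ =
  ⊥-elim (fresh x (coloring-domain r ys c′ c′∈ x a p) refl)
coloring-functional r (y ∷ ys) (fresh , d) c c∈ x a b (there p) (there q) | _ , c′ , refl , c′∈ =
  coloring-functional r ys d c′ c′∈ x a b p q

productL : (ℕ → ℕ) → List ℕ → ℕ
productL f [] = 1
productL f (x ∷ xs) = f x * productL f xs

count-fitting : ∀ r (V : Template r) X → sumL (λ c → χ (allᵇ V c)) (allColorings r X) ≡ productL (colorsAt V) X
count-fitting r V [] = refl
count-fitting r V (x ∷ xs) = begin
  sumL (λ c → χ (allᵇ V c)) (allColorings r (x ∷ xs)) ≡⟨ sumL-concatMap _ (λ a → map ((x , a) ∷_) (allColorings r xs)) (allFin r) ⟩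
  sumL (λ a → sumL (λ c → χ (allᵇ V c)) (map ((x , a) ∷_) (allColorings r xs))) (allFin r)
    ≡⟨ sumL-cong _ _ (allFin r) (λ a _ → trans (sumL-map _ ((x , a) ∷_) (allColorings r xs)) (trans
         (sumL-cong _ _ (allColorings r xs) (λ c _ → χ-∧ (V (x , a)) (allᵇ V c)))
         (trans (sumL-*ˡ (χ (V (x , a))) _ (allColorings r xs)) (*-comm (χ (V (x , a))) N)))) ⟩
  sumL (λ a → N * χ (V (x , a))) (allFin r) ≡⟨ sumL-*ˡ N _ (allFin r) ⟩
  N * colorsAt V x ≡⟨ *-comm N (colorsAt V x) ⟩
  colorsAt V x * N ≡⟨ cong (colorsAt V x *_) (count-fitting r V xs) ⟩
  colorsAt V x * productL (colorsAt V) xs ∎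
  where
  open ≡-Reasoning
  N = sumL (λ c → χ (allᵇ V c)) (allColorings r xs)

length-filterᵇ : ∀ {X : Set} (p : X → Bool) xs → length (filterᵇ p xs) ≡ sumL (λ x → χ (p x)) xs
length-filterᵇ p [] = refl
length-filterᵇ p (x ∷ xs) with p x
... | true = cong suc (length-filterᵇ p xs)
... | false = length-filterᵇ p xs

-- Rainbow sums as a symmetric ternary relation.

χ-injective : ∀ {x y} → χ x ≡ χ y → x ≡ y
χ-injective {true} {true} _ = refl
χ-injective {false} {false} _ = refl

rainbow : ∀ {r} → Vertex r → Vertex r → Vertex r → Bool
rainbow u v w = isRainbowSum u v w ∨ isRainbowSum u w v ∨ isRainbowSum v u w ∨ isRainbowSum v w u
  ∨ isRainbowSum w u v ∨ isRainbowSum w v u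

taut-≡ : ∀ {n} (ρ : Vec Bool n) (f g : N-ary n Bool ℕ) → {T (tautᵇ n f g)} → {T (tautᵇ n g f)} → (f $ⁿ ρ) ≡ (g $ⁿ ρ)
taut-≡ ρ f g {s} {t} = ≤-antisym (taut ρ f g {s}) (taut ρ g f {t})

rainbow-comm : ∀ {r} (s u w : Vertex r) → rainbow s u w ≡ rainbow s w u
rainbow-comm s u w = χ-injective (taut-≡ (isRainbowSum s u w ∷ isRainbowSum s w u ∷ isRainbowSum u s w ∷ isRainbowSum u w s ∷ isRainbowSum w s u ∷ isRainbowSum w u s ∷ [])
  (λ a b c d e f → χ (a ∨ b ∨ c ∨ d ∨ e ∨ f)) (λ a b c d e f → χ (b ∨ a ∨ e ∨ f ∨ c ∨ d)))

rainbow-rotate : ∀ {r} (s u w : Vertex r) → rainbow s u w ≡ rainbow u w s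
rainbow-rotate s u w = χ-injective (taut-≡ (isRainbowSum s u w ∷ isRainbowSum s w u ∷ isRainbowSum u s w ∷ isRainbowSum u w s ∷ isRainbowSum w s u ∷ isRainbowSum w u s ∷ [])
  (λ a b c d e f → χ (a ∨ b ∨ c ∨ d ∨ e ∨ f)) (λ a b c d e f → χ (d ∨ c ∨ f ∨ e ∨ a ∨ b)))

isRainbowSum-sum : ∀ {r} (u v w : Vertex r) → isRainbowSum u v w ≡ true → proj₁ u + proj₁ v ≡ proj₁ w
isRainbowSum-sum (x , a) (y , b) (z , d) p =
  ≡ᵇ-true (proj₁ (∧-true⁻ (proj₂ (∧-true⁻ {y ≠ℕ z} (proj₂ (∧-true⁻ {x ≠ℕ z} (proj₂ (∧-true⁻ {x ≠ℕ y} p))))))))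

∨-true : ∀ {x y} → x ∨ y ≡ true → x ≡ true ⊎ y ≡ true
∨-true {true} p = inj₁ refl
∨-true {false} p = inj₂ p

rainbow-cases : ∀ {r} (s u w : Vertex r) → rainbow s u w ≡ true →
  proj₁ w ≡ proj₁ s + proj₁ u ⊎ proj₁ w ≡ proj₁ u ∸ proj₁ s ⊎ proj₁ w ≡ proj₁ s ∸ proj₁ u
rainbow-cases s u w p with ∨-true {isRainbowSum s u w} p
... | inj₁ q = inj₁ (sym (isRainbowSum-sum s u w q))
... | inj₂ p with ∨-true {isRainbowSum s w u} p
...   | inj₁ q = inj₂ (inj₁ (sym (∸-from-+ (proj₁ s) (proj₁ w) (isRainbowSum-sum s w u q))))
...   | inj₂ p with ∨-true {isRainbowSum u s w} p
...     | inj₁ q = inj₁ (sym (trans (+-comm (proj₁ s) (proj₁ u)) (isRainbowSum-sum u s w q)))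
...     | inj₂ p with ∨-true {isRainbowSum u w s} p
...       | inj₁ q = inj₂ (inj₂ (sym (∸-from-+ (proj₁ u) (proj₁ w) (isRainbowSum-sum u w s q))))
...       | inj₂ p with ∨-true {isRainbowSum w s u} p
...         | inj₁ q = inj₂ (inj₁ (sym (∸-from-+ (proj₁ s) (proj₁ w) (trans (+-comm (proj₁ s) (proj₁ w)) (isRainbowSum-sum w s u q)))))
...         | inj₂ q = inj₂ (inj₂ (sym (∸-from-+ (proj₁ u) (proj₁ w) (trans (+-comm (proj₁ u) (proj₁ w)) (isRainbowSum-sum w u s q)))))

≡⇒≡ᵇ-true : ∀ {x y} → x ≡ y → (x ≡ᵇ y) ≡ true
≡⇒≡ᵇ-true {x} refl = ≡ᵇ-refl x

-- The missing element is a sum or one of two differences. Truncation at 0 can only add a candidate,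
-- which is harmless in an upper bound.
rainbow-last : ∀ {r} (s u w : Vertex r) → χ (rainbow s u w) ≤
  χ (proj₁ w ≡ᵇ proj₁ s + proj₁ u) + χ (proj₁ w ≡ᵇ proj₁ u ∸ proj₁ s) + χ (proj₁ w ≡ᵇ proj₁ s ∸ proj₁ u)
rainbow-last s u w with bool? (rainbow s u w)
... | inj₂ p rewrite p = z≤n
... | inj₁ p rewrite p with rainbow-cases s u w p
...   | inj₁ q rewrite ≡⇒≡ᵇ-true q = s≤s z≤n
...   | inj₂ (inj₁ q) rewrite ≡⇒≡ᵇ-true q = ≤-trans (m≤n+m 1 (χ (proj₁ w ≡ᵇ proj₁ s + proj₁ u))) (m≤m+n _ _)
...   | inj₂ (inj₂ q) rewrite ≡⇒≡ᵇ-true q = m≤n+m 1 _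

rainbow-first : ∀ {r} (s u w : Vertex r) → χ (rainbow s u w) ≤
  χ (proj₁ s ≡ᵇ proj₁ u + proj₁ w) + χ (proj₁ s ≡ᵇ proj₁ w ∸ proj₁ u) + χ (proj₁ s ≡ᵇ proj₁ u ∸ proj₁ w)
rainbow-first s u w = ≤-trans (≤-reflexive (cong χ (rainbow-rotate s u w))) (rainbow-last u w s)

rainbow-free : ∀ {r} (c : List (Vertex r)) → rainbowSumFree c ≡ true → ∀ u v w → u ∈ c → v ∈ c → w ∈ c → rainbow u v w ≡ false
rainbow-free c free u v w u∈ v∈ w∈ = none (absent u v w u∈ v∈ w∈) (absent u w v u∈ w∈ v∈) (absent v u w v∈ u∈ w∈) (absent v w u v∈ w∈ u∈)
    (absent w u v w∈ u∈ v∈) (absent w v u w∈ v∈ u∈)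
  where
  absent : ∀ u v w → u ∈ c → v ∈ c → w ∈ c → isRainbowSum u v w ≡ false
  absent u v w u∈ v∈ w∈ = not-true (allᵇ-∈ _ (allᵇ-∈ _ (allᵇ-∈ _ free u∈) v∈) w∈)
  none : ∀ {a b c d e f} → a ≡ false → b ≡ false → c ≡ false → d ≡ false → e ≡ false → f ≡ false → a ∨ b ∨ c ∨ d ∨ e ∨ f ≡ false
  none refl refl refl refl refl refl = refl

-- From templates of low degree to sets with few sums.

sumL-witness : ∀ {X : Set} (p : X → Bool) xs → 1 ≤ sumL (λ x → χ (p x)) xs → ∃[ x ] (x ∈ xs × p x ≡ true)
sumL-witness p xs pos with search-list p xs
... | inj₁ w = w
... | inj₂ none = ⊥-elim (<⇒≱ pos (≤-reflexive (trans (sumL-cong _ (λ _ → 0) xs (λ x x∈ → cong χ (none x x∈))) (sumL-0 xs))))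

avoid : ∀ {r} (p : Fin r → Bool) (d : Fin r) k → suc k ≤ sumL (λ a → χ (p a)) (allFin r) →
  k ≤ sumL (λ a → χ (p a ∧ not ⌊ d Fin.≟ a ⌋)) (allFin r)
avoid {r} p d k many = ≤-pred (begin
  suc k ≤⟨ many ⟩
  sumL (λ a → χ (p a)) (allFin r) ≤⟨ sumL-mono _ _ (allFin r) (λ a _ → taut (p a ∷ ⌊ d Fin.≟ a ⌋ ∷ []) (λ x y → χ x) (λ x y → χ y + χ (x ∧ not y))) ⟩
  sumL (λ a → χ ⌊ d Fin.≟ a ⌋ + χ (p a ∧ not ⌊ d Fin.≟ a ⌋)) (allFin r) ≡⟨ sumL-+ _ _ (allFin r) ⟩
  sumL (λ a → χ ⌊ d Fin.≟ a ⌋) (allFin r) + sumL (λ a → χ (p a ∧ not ⌊ d Fin.≟ a ⌋)) (allFin r)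
    ≤⟨ +-monoˡ-≤ _ (occurs-once r id d (λ q → q)) ⟩
  1 + sumL (λ a → χ (p a ∧ not ⌊ d Fin.≟ a ⌋)) (allFin r) ∎)
  where open ≤-Reasoning

flip-≠F : ∀ {r} (a b : Fin r) → a ≠F b ≡ true → b ≠F a ≡ true
flip-≠F a b p with b Fin.≟ a
... | no _ = refl
... | yes refl rewrite ⌊≟⌋-refl a = p

-- The tightest element chooses first: z freely, y avoiding one colour, x avoiding two.
distinct-colours : ∀ {r} (V : Template r) x y z → 3 ≤ colorsAt V x → 2 ≤ colorsAt V y → 1 ≤ colorsAt V z →
  ∃[ a ] ∃[ b ] ∃[ d ] (V (x , a) ≡ true × V (y , b) ≡ true × V (z , d) ≡ true
    × a ≠F b ≡ true × a ≠F d ≡ true × b ≠F d ≡ true)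
distinct-colours {r} V x y z 3≤ 2≤ 1≤ = from-z (sumL-witness (λ d → V (z , d)) (allFin r) 1≤)
  where
  from-z : ∃[ d ] (d ∈ allFin r × V (z , d) ≡ true) → _
  from-z (d , _ , Vz) = from-y (sumL-witness (λ b → V (y , b) ∧ not ⌊ d Fin.≟ b ⌋) (allFin r) (avoid (λ b → V (y , b)) d 1 2≤))
    where
    from-y : ∃[ b ] (b ∈ allFin r × V (y , b) ∧ not ⌊ d Fin.≟ b ⌋ ≡ true) → _
    from-y (b , _ , p) = from-x (sumL-witness _ (allFin r) (avoid _ b 1 (avoid (λ a → V (x , a)) d 2 3≤)))
      where
      from-x : ∃[ a ] (a ∈ allFin r × (V (x , a) ∧ not ⌊ d Fin.≟ a ⌋) ∧ not ⌊ b Fin.≟ a ⌋ ≡ true) →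
        ∃[ a ] ∃[ b ] ∃[ d ] (V (x , a) ≡ true × V (y , b) ≡ true × V (z , d) ≡ true
          × a ≠F b ≡ true × a ≠F d ≡ true × b ≠F d ≡ true)
      from-x (a , _ , q) = a , b , d , proj₁ (∧-true⁻ (proj₁ (∧-true⁻ q))) , proj₁ (∧-true⁻ p) , Vz ,
        flip-≠F b a (proj₂ (∧-true⁻ {V (x , a) ∧ not ⌊ d Fin.≟ a ⌋} q)) ,
        flip-≠F d a (proj₂ (∧-true⁻ {V (x , a)} (proj₁ (∧-true⁻ q)))) ,
        flip-≠F d b (proj₂ (∧-true⁻ {V (y , b)} p))

sumL-sum< : ∀ {X : Set} (f : X → ℕ → ℕ) xs n → sum< (λ y → sumL (λ a → f a y) xs) n ≡ sumL (λ a → sum< (f a) n) xs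
sumL-sum< f xs zero = sym (sumL-0 xs)
sumL-sum< f xs (suc n) rewrite sumL-sum< f xs n = sym (sumL-+ _ _ xs)

sum<-≤-χ : ∀ (P diag : ℕ → Bool) f n → (∀ y → y < n → P y ≡ true → diag y ≡ false → 1 ≤ f y) → cnt P n ≤ sum< f n + cnt diag n
sum<-≤-χ P diag f n H = sum<-2 (λ y → χ (P y)) f (λ y → χ (diag y)) n pointwise
  where
  pointwise : ∀ y → y < n → χ (P y) ≤ f y + χ (diag y)
  pointwise y y<n with bool? (P y) | bool? (diag y)
  ... | inj₂ p | _ rewrite p = z≤n
  ... | inj₁ p | inj₁ q rewrite p | q = m≤n+m 1 (f y)
  ... | inj₁ p | inj₂ q rewrite p | q = ≤-trans (H y y<n p q) (m≤m+n (f y) 0)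

cnt-hits : ∀ (f : ℕ → ℕ) b n → (∀ {i j} → f i ≡ f j → i ≡ j) → cnt (λ i → f i ≡ᵇ b) n ≤ 1
cnt-hits f b zero inj = z≤n
cnt-hits f b (suc n) inj with bool? (f n ≡ᵇ b)
... | inj₂ p rewrite p = ≤-trans (≤-reflexive (+-identityʳ _)) (cnt-hits f b n inj)
... | inj₁ p rewrite p = ≤-reflexive (cong (_+ 1) (cnt-false (λ i → f i ≡ᵇ b) n earlier))
  where
  earlier : ∀ i → i < n → (f i ≡ᵇ b) ≡ false
  earlier i i<n with bool? (f i ≡ᵇ b)
  ... | inj₂ q = q
  ... | inj₁ q = ⊥-elim (<-irrefl (inj (trans (≡ᵇ-true {f i} q) (sym (≡ᵇ-true {f n} p)))) i<n)

≢⇒≠ℕ : ∀ {x y} → (x ≡ y → ⊥) → x ≠ℕ y ≡ true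
≢⇒≠ℕ {x} {y} ne with bool? (x ≡ᵇ y)
... | inj₁ p = ⊥-elim (ne (≡ᵇ-true p))
... | inj₂ p rewrite p = refl

isRainbowSum-intro : ∀ {r} (u v w : Vertex r) → (proj₁ u ≡ proj₁ v → ⊥) → 1 ≤ proj₁ u → 1 ≤ proj₁ v → proj₁ u + proj₁ v ≡ proj₁ w →
  proj₂ u ≠F proj₂ v ≡ true → proj₂ u ≠F proj₂ w ≡ true → proj₂ v ≠F proj₂ w ≡ true → isRainbowSum u v w ≡ true
isRainbowSum-intro (x , a) (y , b) (z , d) x≢y 1≤x 1≤y x+y≡z p q s =
  ∧-true (≢⇒≠ℕ x≢y) (∧-true (≢⇒≠ℕ x≢z) (∧-true (≢⇒≠ℕ y≢z) (∧-true (≡⇒≡ᵇ-true x+y≡z) (∧-true p (∧-true q s)))))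
  where
  x≢z : x ≡ z → ⊥
  x≢z refl = <-irrefl (sym x+y≡z) (m<m+n x 1≤y)
  y≢z : y ≡ z → ⊥
  y≢z refl = <-irrefl (sym x+y≡z) (m<n+m y 1≤x)

∨-trueˡ : ∀ {x y} → x ≡ true → x ∨ y ≡ true
∨-trueˡ refl = refl

∨-trueʳ : ∀ {x y} → y ≡ true → x ∨ y ≡ true
∨-trueʳ {true} _ = refl
∨-trueʳ {false} p = p

length-elems : ∀ {n} (A : Vec Bool n) → length (elems A) ≤ n
length-elems {n} A = ≤-trans (≤-reflexive (trans (sym (sumL-1 (elems A))) (trans (sumL-elems A (λ _ → 1)) (sum<-suc _ n))))
  (≤-trans (sum<-mono _ (λ _ → 1) n (λ i _ → ≤-trans (≤-reflexive (*-identityʳ _)) (taut (at A i ∷ []) χ (λ _ → 1)))) (≤-reflexive (sum<-1 n)))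

module Leaf {r n : ℕ} (A : Vec Bool n) (V : Template r) (Δ : ℕ)
  (nonempty : ∀ x → x ∈ elems A → 1 ≤ colorsAt V x)
  (low-degree : ∀ v → v ∈ vertices r (elems A) → V v ≡ true → 2 ≤ colorsAt V (proj₁ v) →
    sumL (λ u → sumL (λ w → χ (V u ∧ V w ∧ rainbow v u w)) (vertices r (elems A))) (vertices r (elems A)) ≤ Δ) where

  X : List ℕ
  X = elems A

  vs : List (Vertex r)
  vs = vertices r X

  A₁ A₂ A₃ : ℕ → Bool
  A₁ = indicator A
  A₂ x = indicator A x ∧ (2 ≤ᵇ colorsAt V x)
  A₃ x = indicator A x ∧ (3 ≤ᵇ colorsAt V x)

  -- The number of allowed rainbow triples through b and y, over all colours of both. Summed over y
  -- it becomes a sum of the degrees of the vertices over b.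
  links : ℕ → ℕ → ℕ
  links b y = sumL (λ a → χ (V (b , a)) * (χ (A₁ y) *
    sumL (λ a′ → sumL (λ w → χ (V (y , a′) ∧ V w ∧ rainbow (b , a) (y , a′) w)) vs) (allFin r))) (allFin r)

  few-links : ∀ b → A₃ b ≡ true → sum< (links b) (suc n) ≤ r * Δ
  few-links b A₃b = begin
    sum< (links b) (suc n) ≡⟨ sumL-sum< (λ a y → χ (V (b , a)) * (χ (A₁ y) * H a y)) (allFin r) (suc n) ⟩
    sumL (λ a → sum< (λ y → χ (V (b , a)) * (χ (A₁ y) * H a y)) (suc n)) (allFin r) ≤⟨ sumL-mono _ (λ _ → Δ) (allFin r) (λ a _ → per-colour a) ⟩
    sumL (λ _ → Δ) (allFin r) ≡⟨ sumL-const-allFin r Δ ⟩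
    r * Δ ∎
    where
    open ≤-Reasoning
    H : Fin r → ℕ → ℕ
    H a y = sumL (λ a′ → sumL (λ w → χ (V (y , a′) ∧ V w ∧ rainbow (b , a) (y , a′) w)) vs) (allFin r)
    degree : Fin r → ℕ
    degree a = sumL (λ u → sumL (λ w → χ (V u ∧ V w ∧ rainbow (b , a) u w)) vs) vs
    by-colour : ∀ a → V (b , a) ≡ true ⊎ V (b , a) ≡ false → χ (V (b , a)) * sumL (λ u → sumL (λ w → χ (V u ∧ V w ∧ rainbow (b , a) u w)) vs) vs ≤ Δ
    by-colour a (inj₂ p) = ≤-trans (≤-reflexive (cong (λ z → χ z * degree a) p)) z≤n
    by-colour a (inj₁ p) = ≤-trans (≤-reflexive (trans (cong (λ z → χ z * degree a) p) (*-identityˡ (degree a))))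
      (low-degree (b , a) (∈-vertices r X b a (∈-elems⁺ A b (proj₁ (∧-true⁻ A₃b)))) p
        (≤-trans (n≤1+n 2) (≤ᵇ-true (proj₂ (∧-true⁻ {A₁ b} A₃b)))))
    per-colour : ∀ a → sum< (λ y → χ (V (b , a)) * (χ (A₁ y) * H a y)) (suc n) ≤ Δ
    per-colour a = begin
      sum< (λ y → χ (V (b , a)) * (χ (A₁ y) * H a y)) (suc n) ≡⟨ sum<-*ˡ (χ (V (b , a))) _ (suc n) ⟩
      χ (V (b , a)) * sum< (λ y → χ (A₁ y) * H a y) (suc n) ≡⟨ cong (χ (V (b , a)) *_) (sumL-elems A (H a)) ⟨
      χ (V (b , a)) * sumL (H a) X ≡⟨ cong (χ (V (b , a)) *_) (sumL-vertices r X (λ u → sumL (λ w → χ (V u ∧ V w ∧ rainbow (b , a) u w)) vs)) ⟨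
      χ (V (b , a)) * sumL (λ u → sumL (λ w → χ (V u ∧ V w ∧ rainbow (b , a) u w)) vs) vs ≤⟨ by-colour a (bool? (V (b , a))) ⟩
      Δ ∎

  linked : ∀ b y z → A₃ b ≡ true → A₂ y ≡ true → A₁ z ≡ true →
    (∀ a a′ a″ → a ≠F a′ ≡ true → a ≠F a″ ≡ true → a′ ≠F a″ ≡ true → rainbow (b , a) (y , a′) (z , a″) ≡ true) → 1 ≤ links b y
  linked b y z A₃b A₂y A₁z is-rainbow = conclude (distinct-colours V b y z (≤ᵇ-true (proj₂ (∧-true⁻ {A₁ b} A₃b)))
      (≤ᵇ-true (proj₂ (∧-true⁻ {A₁ y} A₂y))) (nonempty z (∈-elems⁺′ A₁z)))
    where
    ∈-elems⁺′ : A₁ z ≡ true → z ∈ X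
    ∈-elems⁺′ = ∈-elems⁺ A z
    conclude : ∃[ a ] ∃[ a′ ] ∃[ a″ ] (V (b , a) ≡ true × V (y , a′) ≡ true × V (z , a″) ≡ true
      × a ≠F a′ ≡ true × a ≠F a″ ≡ true × a′ ≠F a″ ≡ true) → 1 ≤ links b y
    conclude (a , a′ , a″ , p , q , s , d₁ , d₂ , d₃) = begin
      1 ≡⟨ cong χ (∧-true q (∧-true s (is-rainbow a a′ a″ d₁ d₂ d₃))) ⟨
      χ (V (y , a′) ∧ V (z , a″) ∧ rainbow (b , a) (y , a′) (z , a″)) ≤⟨ term≤sumL (λ w → χ (V (y , a′) ∧ V w ∧ rainbow (b , a) (y , a′) w)) (∈-vertices r X z a″ (∈-elems⁺′ A₁z)) ⟩
      sumL (λ w → χ (V (y , a′) ∧ V w ∧ rainbow (b , a) (y , a′) w)) vs ≤⟨ term≤sumL (λ a′ → sumL (λ w → χ (V (y , a′) ∧ V w ∧ rainbow (b , a) (y , a′) w)) vs) (∈-allFin a′) ⟩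
      H ≡⟨ trans (cong₂ (λ x z → χ x * (χ z * H)) p (proj₁ (∧-true⁻ {A₁ y} A₂y))) (trans (*-identityˡ (1 * H)) (*-identityˡ H)) ⟨
      χ (V (b , a)) * (χ (A₁ y) * H) ≤⟨ term≤sumL (λ a → χ (V (b , a)) * (χ (A₁ y) * sumL (λ a′ → sumL (λ w → χ (V (y , a′) ∧ V w ∧ rainbow (b , a) (y , a′) w)) vs) (allFin r))) (∈-allFin a) ⟩
      links b y ∎
      where
      open ≤-Reasoning
      H = sumL (λ a′ → sumL (λ w → χ (V (y , a′) ∧ V w ∧ rainbow (b , a) (y , a′) w)) vs) (allFin r)

  -- Each sum yields a rainbow triple counted by `links`, at most Δ for each of the r colours of b.
  -- The extra 1 pays for the single y with y + y = b, or y = b, where two terms coincide.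
  few-sums : FewSums A₁ A₃ A₂ n (r * Δ + 1)
  few-sums = record
    { B⊆C = λ x p → ∧-true (proj₁ (∧-true⁻ {A₁ x} p)) (≤⇒≤ᵇ-true {2} {colorsAt V x} (≤-trans (n≤1+n 2) (≤ᵇ-true (proj₂ (∧-true⁻ {A₁ x} p)))))
    ; C⊆A = λ x p → proj₁ (∧-true⁻ p)
    ; differences = λ b A₃b → ≤-trans
        (sum<-≤-χ (λ y → A₂ y ∧ A₁ (b ∸ y)) (λ y → y + y ≡ᵇ b) (links b) (suc b) (λ y y≤b p d → difference b A₃b y (≤-pred y≤b) p d))
        (+-mono-≤ (≤-trans (sum<-monoʳ (links b) (s≤s (indicator-≤ A b (proj₁ (∧-true⁻ A₃b))))) (few-links b A₃b))
          (cnt-hits (λ y → y + y) b (suc b) (λ {i} {j} → double-injective {i} {j})))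
    ; sums = λ b A₃b → ≤-trans
        (sum<-≤-χ (λ y → A₂ y ∧ A₁ (y + b)) (λ y → y ≡ᵇ b) (links b) (suc n) (λ y _ p d → sum b A₃b y p d))
        (+-mono-≤ (few-links b A₃b) (cnt-hits (λ y → y) b (suc n) (λ p → p)))
    }
    where
    double-injective : ∀ {i j} → i + i ≡ j + j → i ≡ j
    double-injective {i} {j} p = *-cancelˡ-≡ i j 2 (trans (solve 1 (λ i → con 2 ⊛ i := i ⊹ i) refl i) (trans p (solve 1 (λ i → i ⊹ i := con 2 ⊛ i) refl j)))
    difference : ∀ b → A₃ b ≡ true → ∀ y → y ≤ b → A₂ y ∧ A₁ (b ∸ y) ≡ true → (y + y ≡ᵇ b) ≡ false → 1 ≤ links b y
    difference b A₃b y y≤b p d = linked b y (b ∸ y) A₃b (proj₁ (∧-true⁻ p)) A₁z (λ a a′ a″ d₁ d₂ d₃ →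
      ∨-trueʳ {isRainbowSum (b , a) (y , a′) (b ∸ y , a″)} (∨-trueʳ {isRainbowSum (b , a) (b ∸ y , a″) (y , a′)}
      (∨-trueʳ {isRainbowSum (y , a′) (b , a) (b ∸ y , a″)} (∨-trueˡ (isRainbowSum-intro (y , a′) (b ∸ y , a″) (b , a) off-diagonal
        (indicator-pos A y (proj₁ (∧-true⁻ (proj₁ (∧-true⁻ p))))) (indicator-pos A (b ∸ y) A₁z) (m+[n∸m]≡n y≤b) d₃ (flip-≠F a a′ d₁) (flip-≠F a a″ d₂))))))
      where
      A₁z = proj₂ (∧-true⁻ {A₂ y} p)
      off-diagonal : y ≡ b ∸ y → ⊥
      off-diagonal q = false≢true (trans (sym d) (≡⇒≡ᵇ-true (trans (cong (y +_) q) (m+[n∸m]≡n y≤b))))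
    sum : ∀ b → A₃ b ≡ true → ∀ y → A₂ y ∧ A₁ (y + b) ≡ true → (y ≡ᵇ b) ≡ false → 1 ≤ links b y
    sum b A₃b y p d = linked b y (y + b) A₃b (proj₁ (∧-true⁻ p)) (proj₂ (∧-true⁻ {A₂ y} p)) (λ a a′ a″ d₁ d₂ d₃ →
      ∨-trueˡ (isRainbowSum-intro (b , a) (y , a′) (y + b , a″) off-diagonal
        (indicator-pos A b (proj₁ (∧-true⁻ A₃b))) (indicator-pos A y (proj₁ (∧-true⁻ (proj₁ (∧-true⁻ p))))) (+-comm b y) d₁ d₂ d₃))
      where
      off-diagonal : b ≡ y → ⊥
      off-diagonal q = false≢true (trans (sym d) (≡⇒≡ᵇ-true (sym q)))

  -- After squaring, two colours contribute 4 ≤ r and three or more at most r², which is the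
  -- exponent counted by A₂ and A₃ together.
  productL-squared : 4 ≤ r → ∀ xs → productL (colorsAt V) xs * productL (colorsAt V) xs
    ≤ r ^ sumL (λ x → χ (3 ≤ᵇ colorsAt V x) + χ (2 ≤ᵇ colorsAt V x)) xs
  productL-squared 4≤r [] = s≤s z≤n
  productL-squared 4≤r (x ∷ xs) = begin
    k * P * (k * P) ≡⟨ solve 2 (λ k p → k ⊛ p ⊛ (k ⊛ p) := k ⊛ k ⊛ (p ⊛ p)) refl k P ⟩
    k * k * (P * P) ≤⟨ *-mono-≤ (factor k k≤r) (productL-squared 4≤r xs) ⟩
    r ^ w * r ^ W ≡⟨ ^-distribˡ-+-* r w W ⟨
    r ^ (w + W) ∎
    where
    open ≤-Reasoning
    k = colorsAt V x
    P = productL (colorsAt V) xs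
    w = χ (3 ≤ᵇ colorsAt V x) + χ (2 ≤ᵇ colorsAt V x)
    W = sumL (λ x → χ (3 ≤ᵇ colorsAt V x) + χ (2 ≤ᵇ colorsAt V x)) xs
    k≤r : k ≤ r
    k≤r = ≤-trans (sumL-mono _ (λ _ → 1) (allFin r) (λ a _ → taut (V (x , a) ∷ []) χ (λ _ → 1))) (≤-reflexive (trans (sumL-const-allFin r 1) (*-identityʳ r)))
    factor : ∀ k → k ≤ r → k * k ≤ r ^ (χ (3 ≤ᵇ k) + χ (2 ≤ᵇ k))
    factor 0 _ = z≤n
    factor 1 _ = s≤s z≤n
    factor 2 _ = ≤-trans 4≤r (≤-reflexive (sym (*-identityʳ r)))
    factor (suc (suc (suc k))) k≤r = *-mono-≤ k≤r (≤-trans k≤r (≤-reflexive (sym (*-identityʳ r))))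

  weight-squared : 4 ≤ r → productL (colorsAt V) X * productL (colorsAt V) X ≤ r ^ (cnt A₃ (suc n) + cnt A₂ (suc n))
  weight-squared 4≤r = ≤-trans (productL-squared 4≤r X) (≤-reflexive (cong (r ^_) (trans (sumL-elems A _)
    (trans (sum<-cong _ _ (suc n) (λ x _ → distribute (A₁ x) (3 ≤ᵇ colorsAt V x) (2 ≤ᵇ colorsAt V x))) (sum<-+ _ _ (suc n))))))
    where
    distribute : ∀ a x y → χ a * (χ x + χ y) ≡ χ (a ∧ x) + χ (a ∧ y)
    distribute true x y = *-identityˡ _
    distribute false x y = refl

  weight-two : (∀ x → x ≤ n → A₃ x ≡ false) → productL (colorsAt V) X ≤ 2 ^ n
  weight-two none = ≤-trans (bounded X (λ x x∈ → two x (∈-elems A x x∈))) (^-monoʳ-≤ 2 (length-elems A))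
    where
    two : ∀ x → A₁ x ≡ true → colorsAt V x ≤ 2
    two x p with ≤-total (colorsAt V x) 2
    ... | inj₁ q = q
    ... | inj₂ q with m≤n⇒m<n∨m≡n q
    ...   | inj₂ e = ≤-reflexive (sym e)
    ...   | inj₁ e = ⊥-elim (false≢true (trans (sym (none x (indicator-≤ A x p))) (∧-true p (≤⇒≤ᵇ-true e))))
    bounded : ∀ xs → (∀ x → x ∈ xs → colorsAt V x ≤ 2) → productL (colorsAt V) xs ≤ 2 ^ length xs
    bounded [] H = ≤-refl
    bounded (x ∷ xs) H = *-mono-≤ (H x (here refl)) (bounded xs (λ y y∈ → H y (there y∈)))

-- Powers of 1 + 1/τ.

-- Bernoulli's inequality (1 + 1/τ)^N ≥ 1 + N/τ with denominators cleared.
bernoulli : ∀ τ N → τ ^ N * (τ + N) ≤ suc τ ^ N * τ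
bernoulli τ zero = ≤-reflexive (cong (1 *_) (+-identityʳ τ))
bernoulli τ (suc N) = begin
  τ * τ ^ N * (τ + suc N) ≤⟨ lin (τ * τ ^ N * (τ + suc N) ∷ suc τ * (τ ^ N * (τ + N)) ∷ τ ^ N * N ∷ [])
    (λ x y z → (x :+ z :≤ y) ∷ [] ⊢ x :≤ y) (≤-reflexive (solve 3 (λ t p n → t ⊛ p ⊛ (t ⊹ (con 1 ⊹ n)) ⊹ p ⊛ n := (con 1 ⊹ t) ⊛ (p ⊛ (t ⊹ n))) refl τ (τ ^ N) N)) ⟩
  suc τ * (τ ^ N * (τ + N)) ≤⟨ *-monoʳ-≤ (suc τ) (bernoulli τ N) ⟩
  suc τ * (suc τ ^ N * τ) ≡⟨ *-assoc (suc τ) (suc τ ^ N) τ ⟨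
  suc τ * suc τ ^ N * τ ∎
  where open ≤-Reasoning

-- Bernoulli with N = τ². It fixes the number of vertices a hub has to eliminate.
square-gain : ∀ t → let τ = suc t in τ ^ (τ * τ) * suc τ ≤ suc τ ^ (τ * τ)
square-gain t = *-cancelʳ-≤ _ _ τ (begin
  τ ^ (τ * τ) * suc τ * τ ≡⟨ solve 2 (λ p t → p ⊛ (con 1 ⊹ t) ⊛ t := p ⊛ (t ⊹ t ⊛ t)) refl (τ ^ (τ * τ)) τ ⟩
  τ ^ (τ * τ) * (τ + τ * τ) ≤⟨ bernoulli τ (τ * τ) ⟩
  suc τ ^ (τ * τ) * τ ∎)
  where
  open ≤-Reasoning
  τ = suc t

-- In fractions, (1 + 1/τ)^i ≤ τ / (τ - i); the induction step is (τ + 1) o ≤ τ (o + 1), true for o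
-- ≤ τ.
reverse-bernoulli : ∀ τ i o → i + o ≡ τ → suc τ ^ i * o ≤ τ ^ i * τ
reverse-bernoulli τ zero o refl = ≤-refl
reverse-bernoulli τ (suc i) o eq = begin
  suc τ * suc τ ^ i * o ≡⟨ solve 3 (λ s p o → s ⊛ p ⊛ o := p ⊛ (s ⊛ o)) refl (suc τ) (suc τ ^ i) o ⟩
  suc τ ^ i * (o + τ * o) ≤⟨ *-monoʳ-≤ (suc τ ^ i) (+-monoˡ-≤ (τ * o) (≤-trans (m≤n+m o (suc i)) (≤-reflexive eq))) ⟩
  suc τ ^ i * (τ + τ * o) ≡⟨ solve 3 (λ p t o → p ⊛ (t ⊹ t ⊛ o) := t ⊛ (p ⊛ (con 1 ⊹ o))) refl (suc τ ^ i) τ o ⟩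
  τ * (suc τ ^ i * suc o) ≤⟨ *-monoʳ-≤ τ (reverse-bernoulli τ i (suc o) (trans (+-suc i o) eq)) ⟩
  τ * (τ ^ i * τ) ≡⟨ *-assoc τ (τ ^ i) τ ⟨
  τ * τ ^ i * τ ∎
  where open ≤-Reasoning

growth-≤2 : ∀ i → let τ = 2 + 2 * i in suc τ ^ i ≤ 2 * τ ^ i
growth-≤2 i = *-cancelʳ-≤ _ _ τ (begin
  suc τ ^ i * τ ≡⟨ cong (suc τ ^ i *_) (solve 1 (λ i → con 2 ⊹ con 2 ⊛ i := con 2 ⊛ (con 1 ⊹ i)) refl i) ⟩
  suc τ ^ i * (2 * (1 + i)) ≡⟨ solve 2 (λ p i → p ⊛ (con 2 ⊛ i) := con 2 ⊛ (p ⊛ i)) refl (suc τ ^ i) (1 + i) ⟩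
  2 * (suc τ ^ i * (1 + i)) ≤⟨ *-monoʳ-≤ 2 (*-monoʳ-≤ (suc τ ^ i) (n≤1+n (1 + i))) ⟩
  2 * (suc τ ^ i * (2 + i)) ≤⟨ *-monoʳ-≤ 2 (reverse-bernoulli τ i (2 + i) (solve 1 (λ i → i ⊹ (con 2 ⊹ i) := con 2 ⊹ con 2 ⊛ i) refl i)) ⟩
  2 * (τ ^ i * τ) ≡⟨ *-assoc 2 (τ ^ i) τ ⟨
  2 * τ ^ i * τ ∎)
  where
  open ≤-Reasoning
  τ = 2 + 2 * i

*-^ : ∀ m n k → (m * n) ^ k ≡ m ^ k * n ^ k
*-^ m n zero = refl
*-^ m n (suc k) rewrite *-^ m n k = solve 4 (λ m n p q → m ⊛ n ⊛ (p ⊛ q) := m ⊛ p ⊛ (n ⊛ q)) refl m n (m ^ k) (n ^ k)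

n<2^n : ∀ n → n < 2 ^ n
n<2^n zero = s≤s z≤n
n<2^n (suc n) = begin-strict
  suc n ≤⟨ n<2^n n ⟩
  2 ^ n <⟨ m<m+n (2 ^ n) (m^n>0 2 n) ⟩
  2 ^ n + 2 ^ n ≡⟨ solve 1 (λ x → x ⊹ x := con 2 ⊛ x) refl (2 ^ n) ⟩
  2 * 2 ^ n ∎
  where open ≤-Reasoning

^-≤-2^ : ∀ τ c n → suc τ * c ≤ n → τ ^ c ≤ 2 ^ n
^-≤-2^ τ c n p = begin
  τ ^ c ≤⟨ ^-monoˡ-≤ c (≤-trans (n≤1+n τ) (<⇒≤ (n<2^n (suc τ)))) ⟩
  (2 ^ suc τ) ^ c ≡⟨ ^-*-assoc 2 (suc τ) c ⟩
  2 ^ (suc τ * c) ≤⟨ ^-monoʳ-≤ 2 p ⟩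
  2 ^ n ∎
  where open ≤-Reasoning

-- Raising g τ ^ s ≤ (τ + 1) ^ (s + k) M to the p-th power, with s = n r and τ = 2 + 2 (r p).
absorb : ∀ r p n k g M → let τ = 2 + 2 * (r * p) in 4 ≤ r → (2 + τ) * (k * p) ≤ n →
  g * τ ^ (n * r) ≤ suc τ ^ (n * r + k) * M → g ^ p ≤ r ^ n * M ^ p
absorb r p n k g M 4≤r large bound = *-cancelʳ-≤ _ _ (τ ^ (n * r * p)) {{m^n≢0 τ (n * r * p)}} (begin
  g ^ p * τ ^ (n * r * p) ≡⟨ cong (g ^ p *_) (^-*-assoc τ (n * r) p) ⟨
  g ^ p * (τ ^ (n * r)) ^ p ≡⟨ *-^ g (τ ^ (n * r)) p ⟨
  (g * τ ^ (n * r)) ^ p ≤⟨ ^-monoˡ-≤ p bound ⟩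
  (suc τ ^ (n * r + k) * M) ^ p ≡⟨ *-^ (suc τ ^ (n * r + k)) M p ⟩
  (suc τ ^ (n * r + k)) ^ p * M ^ p ≡⟨ cong (λ z → z ^ p * M ^ p) (^-distribˡ-+-* (suc τ) (n * r) k) ⟩
  (suc τ ^ (n * r) * suc τ ^ k) ^ p * M ^ p ≡⟨ cong (_* M ^ p) (*-^ (suc τ ^ (n * r)) (suc τ ^ k) p) ⟩
  (suc τ ^ (n * r)) ^ p * (suc τ ^ k) ^ p * M ^ p ≤⟨ *-monoˡ-≤ (M ^ p) (*-mono-≤ main extra) ⟩
  2 ^ n * τ ^ (n * r * p) * 2 ^ n * M ^ p ≡⟨ solve 3 (λ x t m → x ⊛ t ⊛ x ⊛ m := x ⊛ x ⊛ m ⊛ t) refl (2 ^ n) (τ ^ (n * r * p)) (M ^ p) ⟩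
  -- One factor 2^n comes from the vertices, the other from the budget; together they are at most
  -- r^n.
  2 ^ n * 2 ^ n * M ^ p * τ ^ (n * r * p) ≤⟨ *-monoˡ-≤ (τ ^ (n * r * p)) (*-monoˡ-≤ (M ^ p) (≤-trans (≤-reflexive (sym (*-^ 2 2 n))) (^-monoˡ-≤ n 4≤r))) ⟩
  r ^ n * M ^ p * τ ^ (n * r * p) ∎)
  where
  open ≤-Reasoning
  τ = 2 + 2 * (r * p)
  main : (suc τ ^ (n * r)) ^ p ≤ 2 ^ n * τ ^ (n * r * p)
  main = begin
    (suc τ ^ (n * r)) ^ p ≡⟨ ^-*-assoc (suc τ) (n * r) p ⟩
    suc τ ^ (n * r * p) ≡⟨ cong (suc τ ^_) (solve 3 (λ n r p → n ⊛ r ⊛ p := r ⊛ p ⊛ n) refl n r p) ⟩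
    suc τ ^ (r * p * n) ≡⟨ ^-*-assoc (suc τ) (r * p) n ⟨
    (suc τ ^ (r * p)) ^ n ≤⟨ ^-monoˡ-≤ n (growth-≤2 (r * p)) ⟩
    (2 * τ ^ (r * p)) ^ n ≡⟨ *-^ 2 (τ ^ (r * p)) n ⟩
    2 ^ n * (τ ^ (r * p)) ^ n ≡⟨ cong (2 ^ n *_) (^-*-assoc τ (r * p) n) ⟩
    2 ^ n * τ ^ (r * p * n) ≡⟨ cong (λ z → 2 ^ n * τ ^ z) (solve 3 (λ n r p → r ⊛ p ⊛ n := n ⊛ r ⊛ p) refl n r p) ⟩
    2 ^ n * τ ^ (n * r * p) ∎
  extra : (suc τ ^ k) ^ p ≤ 2 ^ n
  extra = ≤-trans (≤-reflexive (^-*-assoc (suc τ) k p)) (^-≤-2^ (suc τ) (k * p) n large)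

-- Counting rainbow sum-free colourings.

record LowDegree {r n} (A : Vec Bool n) (Δ : ℕ) (V : Template r) : Set where
  field
    nonempty : ∀ x → x ∈ elems A → 1 ≤ colorsAt V x
    low-degree : ∀ v → v ∈ vertices r (elems A) → V v ≡ true → 2 ≤ colorsAt V (proj₁ v) →
      sumL (λ u → sumL (λ w → χ (V u ∧ V w ∧ rainbow v u w)) (vertices r (elems A))) (vertices r (elems A)) ≤ Δ

productL-0 : ∀ (f : ℕ → ℕ) {x xs} → x ∈ xs → f x ≡ 0 → productL f xs ≡ 0
productL-0 f {xs = x ∷ xs} (here refl) fx rewrite fx = refl
productL-0 f {xs = y ∷ xs} (there x∈) fx rewrite productL-0 f x∈ fx = *-zeroʳ (f y)

module _ {r n : ℕ} (A : Vec Bool n) (Δ M t budget : ℕ)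
  (leaf : ∀ V → LowDegree {r} A Δ V → productL (colorsAt V) (elems A) ≤ M) where
  private
    T₀ = suc t
    module 𝒞 = Containers (vertices r (elems A)) rainbow rainbow-comm _+_ (λ x y → y ∸ x) _∸_
      rainbow-last rainbow-first (multiplicity-vertices r (elems A) (distinct-elems A))
      (allColorings r (elems A)) (coloring-functional r (elems A) (distinct-elems A))
      -- The successor of this D is T₀ * T₀, the exponent in `square-gain`.
      (t + t * suc t) Δ T₀ M budget (square-gain t)

  -- An element left without colours makes the product vanish; otherwise termination is exactly what
  -- `LowDegree` asks for.
  terminal-bound : ∀ V → 𝒞.Terminal V → sumL (λ c → χ (allᵇ V c)) (allColorings r (elems A)) ≤ M
  terminal-bound V terminal = ≤-trans (≤-reflexive (count-fitting r V (elems A))) (by-empty (search-list (λ x → colorsAt V x ≡ᵇ 0) (elems A)))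
    where
    low : ∀ v → v ∈ vertices r (elems A) → V v ≡ true → 2 ≤ colorsAt V (proj₁ v) → 𝒞.degree V v ≤ Δ
    low v v∈ Vv two with ≤-total (𝒞.degree V v) Δ
    ... | inj₁ q = q
    ... | inj₂ q = ⊥-elim (false≢true (trans (sym (terminal v v∈)) (∧-true Vv (∧-true (≤⇒≤ᵇ-true two) (≤⇒≤ᵇ-true q)))))
    positive : ∀ k → (k ≡ᵇ 0) ≡ false → 1 ≤ k
    positive (suc k) _ = s≤s z≤n
    by-empty : _ → productL (colorsAt V) (elems A) ≤ M
    by-empty (inj₁ (x , x∈ , p)) = ≤-trans (≤-reflexive (productL-0 (colorsAt V) x∈ (≡ᵇ-true p))) z≤n
    by-empty (inj₂ none) = leaf V (record { nonempty = λ x x∈ → positive _ (none x x∈) ; low-degree = low })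

  initial : 𝒞.State (λ _ → true) [] rainbowSumFree budget
  initial = record
    { fits = λ _ _ _ _ _ → refl
    ; contains = λ _ _ _ _ ()
    ; free = λ c _ → rainbow-free c
    ; distinct = λ _ → z≤n
    ; forced = λ _ ()
    ; low = λ u _ _ → ≤-trans (≤-reflexive (sumL-0 (vertices r (elems A)))) z≤n
    ; balance = ≤-trans (≤-trans (≤-reflexive (+-comm (budget * Δ) _)) (+-monoˡ-≤ (budget * Δ) (*-monoʳ-≤ (2 * 𝒞.F) (𝒞.size-≤ (λ _ → true)))))
        (+-monoˡ-≤ (budget * Δ) (m≤n+m _ (𝒞.edges (λ _ → true) [])))
    }

  count-bound : (3 * (T₀ * T₀) + 2 * (3 * (T₀ * T₀) + 3 * r)) * (n * r) < budget * Δ →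
    g A r * T₀ ^ (n * r) ≤ suc T₀ ^ (n * r + budget) * M
  count-bound enough = ≤-trans (≤-reflexive (cong (_* T₀ ^ (n * r)) (length-filterᵇ rainbowSumFree (allColorings r (elems A)))))
    (𝒞.few-colorings terminal-bound (≤-<-trans (*-monoʳ-≤ (3 * (T₀ * T₀) + 2 * (3 * (T₀ * T₀) + 3 * r)) vertices≤) enough)
      (suc (n * r + budget)) _ [] _ budget (n * r) initial (≤-trans (𝒞.size-≤ (λ _ → true)) vertices≤) ≤-refl)
    where
    vertices≤ : length (vertices r (elems A)) ≤ n * r
    vertices≤ = ≤-trans (≤-reflexive (length-vertices r (elems A))) (*-monoˡ-≤ r (length-elems A))

-- The choice Δ = n / (q + 1) is linear in n, so the budget depends on r, p and q only. The
-- conclusion reads g(A, r) ≤ r^(n/p) M: containers cost a factor with arbitrarily small exponent.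
container-bound : ∀ r p q → 4 ≤ r → ∃[ n₀ ] (∀ n → n₀ ≤ n → ∃[ Δ ] (suc q * Δ ≤ n × n ≤ 2 * (suc q * Δ) ×
  (∀ (A : Vec Bool n) M → (∀ V → LowDegree {r} A Δ V → productL (colorsAt V) (elems A) ≤ M) → g A r ^ p ≤ r ^ n * M ^ p)))
container-bound r p q 4≤r = n₀ , λ n n₀≤n → Δ n , qΔ≤n n , n≤2qΔ n (≤-trans (m≤m+n _ _) n₀≤n) ,
    λ A M leaf → absorb r p n budget (g A r) M 4≤r (≤-trans (m≤n+m _ (suc q)) n₀≤n)
      (count-bound A (Δ n) M (suc (2 * (r * p))) budget leaf (enough n (≤-trans (m≤m+n _ _) n₀≤n)))
  where
  T₀ = 2 + 2 * (r * p)
  W = 3 * (T₀ * T₀) + 2 * (3 * (T₀ * T₀) + 3 * r)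
  budget = suc (W * (2 * suc q * r))
  n₀ = suc q + (2 + T₀) * (budget * p)
  Δ : ℕ → ℕ
  Δ n = n / suc q
  qΔ≤n : ∀ n → suc q * Δ n ≤ n
  qΔ≤n n = ≤-trans (≤-reflexive (*-comm (suc q) (Δ n))) (m/n*n≤m n (suc q))
  Δ≥1 : ∀ n → suc q ≤ n → 1 ≤ Δ n
  Δ≥1 n q<n = m≥n⇒m/n>0 q<n
  n≤2qΔ : ∀ n → suc q ≤ n → n ≤ 2 * (suc q * Δ n)
  n≤2qΔ n q<n = lin (n ∷ n % suc q ∷ Δ n * suc q ∷ suc q * Δ n ∷ suc q ∷ [])
    (λ n m x y q → (n :≤ m :+ x) ∷ (lit 1 :+ m :≤ q) ∷ (q :≤ y) ∷ (x :≤ y) ∷ [] ⊢ n :≤ 2 :* y)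
    (≤-reflexive (m≡m%n+[m/n]*n n (suc q))) (m%n<n n (suc q))
    (≤-trans (≤-reflexive (sym (*-identityʳ (suc q)))) (*-monoʳ-≤ (suc q) (Δ≥1 n q<n))) (≤-reflexive (*-comm (Δ n) (suc q)))
  enough : ∀ n → suc q ≤ n → W * (n * r) < budget * Δ n
  enough n q<n = begin-strict
    W * (n * r) ≤⟨ *-monoʳ-≤ W (*-monoˡ-≤ r (n≤2qΔ n q<n)) ⟩
    W * (2 * (suc q * Δ n) * r) ≡⟨ solve 4 (λ w q d r → w ⊛ (con 2 ⊛ (q ⊛ d) ⊛ r) := w ⊛ (con 2 ⊛ q ⊛ r) ⊛ d) refl W (suc q) (Δ n) r ⟩
    W * (2 * suc q * r) * Δ n <⟨ m<n+m _ (Δ≥1 n q<n) ⟩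
    Δ n + W * (2 * suc q * r) * Δ n ∎
    where open ≤-Reasoning

-- Symmetric differences as counts.

∣∣≡cnt : ∀ {n} (v : Subset n) → ∣ v ∣ ≡ cnt (at v) n
∣∣≡cnt [] = refl
∣∣≡cnt {suc n} (true ∷ v) = trans (cong suc (∣∣≡cnt v)) (sym (sum<-suc (λ i → χ (at (true ∷ v) i)) n))
∣∣≡cnt {suc n} (false ∷ v) = trans (∣∣≡cnt v) (sym (sum<-suc (λ i → χ (at (false ∷ v) i)) n))

at-zipWith : ∀ {n} (v w : Vec Bool n) i → at (zipWith _xor_ v w) i ≡ at v i xor at w i
at-zipWith [] [] i = refl
at-zipWith (a ∷ v) (b ∷ w) zero = refl
at-zipWith (a ∷ v) (b ∷ w) (suc i) = at-zipWith v w i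

at-tabulate : ∀ n (h : ℕ → Bool) i → i < n → at (tabulate {n = n} (λ j → h (toℕ j))) i ≡ h i
at-tabulate (suc n) h zero _ = refl
at-tabulate (suc n) h (suc i) (s≤s i<n) = at-tabulate n (λ j → h (suc j)) i i<n

bool-ext : ∀ {x y} → (x ≡ true → y ≡ true) → (y ≡ true → x ≡ true) → x ≡ y
bool-ext {true} {y} f g = sym (f refl)
bool-ext {false} {true} f g = g refl
bool-ext {false} {false} f g = refl

%2≡odd : ∀ i → ((i % 2) ≡ᵇ 0) ≡ odd (suc i)
%2≡odd zero = refl
%2≡odd (suc zero) = refl
%2≡odd (suc (suc i)) = trans (cong (_≡ᵇ 0) (trans (cong (_% 2) (+-comm 2 i)) ([m+n]%n≡m%n i 2)))
  (trans (%2≡odd i) (not-involutive (odd i)))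
  where
  not-involutive : ∀ x → not x ≡ not (not (not x))
  not-involutive true = refl
  not-involutive false = refl

/2≡upper : ∀ n i → ((n / 2) ≤ᵇ i) ≡ upper n (suc i)
/2≡upper n i = bool-ext
  (λ p → ≤⇒≤ᵇ-true (lin (n ∷ i ∷ n / 2 ∷ n % 2 ∷ n / 2 * 2 ∷ 2 * suc i ∷ [])
    (λ n i h m t s → (h :≤ i) ∷ (n :≤ m :+ t) ∷ (lit 1 :+ m :≤ lit 2) ∷ (t :≤ 2 :* h) ∷ (2 :* (lit 1 :+ i) :≤ s) ∷ [] ⊢ lit 1 :+ n :≤ s)
    (≤ᵇ-true p) (≤-reflexive (m≡m%n+[m/n]*n n 2)) (m%n<n n 2) (≤-reflexive (*-comm (n / 2) 2)) ≤-refl))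
  (λ p → ≤⇒≤ᵇ-true (lin (n ∷ i ∷ n / 2 ∷ n / 2 * 2 ∷ 2 * suc i ∷ [])
    (λ n i h t s → (lit 1 :+ n :≤ s) ∷ (t :≤ n) ∷ (2 :* h :≤ t) ∷ (s :≤ 2 :* (lit 1 :+ i)) ∷ [] ⊢ h :≤ i)
    (≤ᵇ-true p) (m/n*n≤m n 2) (≤-reflexive (*-comm 2 (n / 2))) ≤-refl))

∣△∣ : ∀ {n} (A : Subset n) (h : ℕ → Bool) (f : ℕ → Bool) → (∀ i → f i ≡ h (suc i)) → h 0 ≡ false →
  ∣ A △ tabulate (λ j → f (toℕ j)) ∣ ≡ cnt (λ x → indicator A x xor h x) (suc n)
∣△∣ {n} A h f f≡h h0 = begin
  ∣ A △ tabulate (λ j → f (toℕ j)) ∣ ≡⟨ ∣∣≡cnt (A △ tabulate (λ j → f (toℕ j))) ⟩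
  cnt (at (A △ tabulate (λ j → f (toℕ j)))) n ≡⟨ sum<-cong _ (λ i → χ (at A i xor h (suc i))) n (λ i i<n → cong χ
    (trans (at-zipWith A (tabulate (λ j → f (toℕ j))) i) (cong (at A i xor_) (trans (at-tabulate n f i i<n) (f≡h i))))) ⟩
  cnt (λ i → at A i xor h (suc i)) n ≡⟨ cong (λ z → χ z + cnt (λ i → at A i xor h (suc i)) n) h0 ⟨
  χ (h 0) + cnt (λ i → at A i xor h (suc i)) n ≡⟨ sum<-suc (λ x → χ (indicator A x xor h x)) n ⟨
  cnt (λ x → indicator A x xor h x) (suc n) ∎
  where open ≡-Reasoning

∣△oddSet∣ : ∀ {n} (A : Subset n) → ∣ A △ oddSet n ∣ ≡ cnt (λ x → indicator A x xor odd x) (suc n)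
∣△oddSet∣ A = ∣△∣ A odd (λ i → (i % 2) ≡ᵇ 0) %2≡odd refl

∣△I₀∣ : ∀ {n} (A : Subset n) → ∣ A △ I₀ n ∣ ≡ cnt (λ x → indicator A x xor upper n x) (suc n)
∣△I₀∣ {n} A = ∣△∣ A (upper n) (λ i → (n / 2) ≤ᵇ i) (/2≡upper n) refl

∣△fullSet∣ : ∀ {n} (A : Subset n) → ∣ A △ fullSet n ∣ + cnt (indicator A) (suc n) ≡ n
∣△fullSet∣ {n} A = begin
  ∣ A △ fullSet n ∣ + cnt (indicator A) (suc n) ≡⟨ cong₂ _+_ (∣∣≡cnt (A △ fullSet n)) (sum<-suc (λ x → χ (indicator A x)) n) ⟩
  cnt (at (A △ fullSet n)) n + cnt (at A) n ≡⟨ cong (_+ cnt (at A) n) (sum<-cong _ (λ i → χ (not (at A i))) n (λ i i<n → cong χ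
     (trans (at-zipWith A (fullSet n) i) (trans (cong (at A i xor_) (at-tabulate n (λ _ → true) i i<n)) (xor-true (at A i)))))) ⟩
  cnt (λ i → not (at A i)) n + cnt (at A) n ≡⟨ +-comm _ (cnt (at A) n) ⟩
  cnt (at A) n + cnt (λ i → not (at A i)) n ≡⟨ cnt-not (at A) n ⟩
  n ∎
  where
  open ≡-Reasoning
  xor-true : ∀ x → x xor true ≡ not x
  xor-true true = refl
  xor-true false = refl

-- The maximum over all subsets, and the odd numbers as an example.

∈-allSubsets : ∀ n (A : Subset n) → A ∈ allSubsets n
∈-allSubsets zero [] = here refl
∈-allSubsets (suc n) (b ∷ A) = ∈-concatMap⁺ (λ v → (true ∷ v) ∷ (false ∷ v) ∷ []) (lose (∈-allSubsets n A) (extend b))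
  where
  extend : ∀ b → b ∷ A ∈ (true ∷ A) ∷ (false ∷ A) ∷ []
  extend true = here refl
  extend false = there (here refl)

g≤gMax : ∀ n r (A : Subset n) → g A r ≤ gMax n r
g≤gMax n r A = go (allSubsets n) (∈-allSubsets n A)
  where
  go : ∀ l → A ∈ l → g A r ≤ foldr _⊔_ 0 (map (λ A → g A r) l)
  go (B ∷ l) (here refl) = m≤m⊔n (g B r) _
  go (B ∷ l) (there p) = ≤-trans (go l p) (m≤n⊔m (g B r) _)

gMax-bound : ∀ n r e Y → 1 ≤ Y → (∀ A → g {n} A r ^ suc e ≤ Y) → gMax n r ^ suc e ≤ Y
gMax-bound n r e Y 1≤Y H = go (allSubsets n)
  where
  go : ∀ l → foldr _⊔_ 0 (map (λ A → g A r) l) ^ suc e ≤ Y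
  go [] = z≤n
  go (A ∷ l) with ≤-total (g A r) (foldr _⊔_ 0 (map (λ A → g A r) l))
  ... | inj₁ p rewrite m≤n⇒m⊔n≡n p = go l
  ... | inj₂ p rewrite m≥n⇒m⊔n≡m p = H A

length-allColorings : ∀ r X → length (allColorings r X) ≡ r ^ length X
length-allColorings r X = begin
  length (allColorings r X) ≡⟨ sumL-1 (allColorings r X) ⟨
  sumL (λ _ → 1) (allColorings r X) ≡⟨ sumL-cong _ (λ c → χ (allᵇ (λ _ → true) c)) (allColorings r X) (λ c _ → cong χ (sym (allᵇ-intro (λ _ → true) c (λ _ _ → refl)))) ⟩
  sumL (λ c → χ (allᵇ (λ _ → true) c)) (allColorings r X) ≡⟨ count-fitting r (λ _ → true) X ⟩
  productL (colorsAt {r} (λ _ → true)) X ≡⟨ constant X ⟩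
  r ^ length X ∎
  where
  open ≡-Reasoning
  constant : ∀ X → productL (colorsAt {r} (λ _ → true)) X ≡ r ^ length X
  constant [] = refl
  constant (x ∷ X) = cong₂ _*_ (trans (sumL-const-allFin r 1) (*-identityʳ r)) (constant X)

indicator-oddSet : ∀ n x → x ≤ n → indicator (oddSet n) x ≡ odd x
indicator-oddSet n zero _ = refl
indicator-oddSet n (suc i) i<n = trans (at-tabulate n (λ i → (i % 2) ≡ᵇ 0) i i<n) (%2≡odd i)

oddSet-rainbowSumFree : ∀ n r c → c ∈ allColorings r (elems (oddSet n)) → rainbowSumFree c ≡ true
oddSet-rainbowSumFree n r c c∈ = allᵇ-intro _ c (λ u u∈ → allᵇ-intro _ c (λ v v∈ → allᵇ-intro _ c (λ w w∈ → no-sum u v w u∈ v∈ w∈)))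
  where
  is-odd : ∀ u → u ∈ c → odd (proj₁ u) ≡ true
  is-odd (x , a) u∈ = trans (sym (indicator-oddSet n x (indicator-≤ (oddSet n) x p))) p
    where p = ∈-elems (oddSet n) x (coloring-domain r (elems (oddSet n)) c c∈ x a u∈)
  not-all-odd : ∀ x y z → x + y ≡ z → odd x ≡ true → odd y ≡ true → odd z ≡ true → ⊥
  not-all-odd x y z refl p q s = false≢true (trans (sym (cong₂ _xor_ p q)) (trans (sym (odd-+ x y)) s))
  no-sum : ∀ u v w → u ∈ c → v ∈ c → w ∈ c → not (isRainbowSum u v w) ≡ true
  no-sum u v w u∈ v∈ w∈ with bool? (isRainbowSum u v w)
  ... | inj₂ p = cong not p
  ... | inj₁ p = ⊥-elim (not-all-odd (proj₁ u) (proj₁ v) (proj₁ w) (isRainbowSum-sum u v w p) (is-odd u u∈) (is-odd v v∈) (is-odd w w∈))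

g-oddSet : ∀ n r → g (oddSet n) r ≡ r ^ length (elems (oddSet n))
g-oddSet n r = begin
  g (oddSet n) r ≡⟨ length-filterᵇ rainbowSumFree cols ⟩
  sumL (λ c → χ (rainbowSumFree c)) cols ≡⟨ sumL-cong _ (λ _ → 1) cols (λ c c∈ → cong χ (oddSet-rainbowSumFree n r c c∈)) ⟩
  sumL (λ _ → 1) cols ≡⟨ sumL-1 cols ⟩
  length cols ≡⟨ length-allColorings r (elems (oddSet n)) ⟩
  r ^ length (elems (oddSet n)) ∎
  where
  open ≡-Reasoning
  cols = allColorings r (elems (oddSet n))

n≤2∣oddSet∣ : ∀ n → n ≤ 2 * length (elems (oddSet n))
n≤2∣oddSet∣ n = lin (n ∷ cnt odd (suc n) ∷ length (elems (oddSet n)) ∷ χ (odd (suc n)) ∷ [])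
  (λ n c l o → (lit 1 :+ n :≤ 2 :* c :+ o) ∷ (c :≤ l) ∷ (o :≤ lit 1) ∷ [] ⊢ n :≤ 2 :* l)
  (≤-reflexive (sym (2*cnt-odd (suc n))))
  (≤-reflexive (trans (sum<-cong _ (λ x → χ (indicator (oddSet n) x) * 1) (suc n) (λ x x≤n → trans (cong χ (sym (indicator-oddSet n x (≤-pred x≤n)))) (sym (*-identityʳ _))))
    (trans (sym (sumL-elems (oddSet n) (λ _ → 1))) (sumL-1 (elems (oddSet n))))))
  (taut (odd (suc n) ∷ []) χ (λ _ → 1))

-- The asymptotic value of the maximum.

^-cancel-≤ : ∀ r x y → 2 ≤ r → r ^ x ≤ r ^ y → x ≤ y
^-cancel-≤ r x y 2≤r p with ≤-total x y
... | inj₁ q = q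
... | inj₂ q with m≤n⇒m<n∨m≡n q
...   | inj₂ refl = ≤-refl
...   | inj₁ y<x = ⊥-elim (<⇒≱ (^-monoʳ-< r 2≤r y<x) p)

half : ∀ x → ∃[ h ] (x ≤ 2 * h × 2 * h ≤ suc x)
half zero = 0 , z≤n , z≤n
half (suc x) with half x
... | h , p , q with m≤n⇒m<n∨m≡n p
...   | inj₁ r = h , r , ≤-trans q (n≤1+n _)
...   | inj₂ refl = suc h , ≤-trans (n≤1+n _) (≤-reflexive (sym eq)) , ≤-reflexive eq
  where
  eq : 2 * suc h ≡ suc (suc (2 * h))
  eq = solve 1 (λ h → con 2 ⊛ (con 1 ⊹ h) := con 2 ⊹ con 2 ⊛ h) refl h

sqrt-≤ : ∀ r h k W → .{{NonZero r}} → k ≤ 2 * h → W * W ≤ r ^ k → W ≤ r ^ h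
sqrt-≤ r h k W k≤2h p with ≤-total W (r ^ h)
... | inj₁ q = q
... | inj₂ q with m≤n⇒m<n∨m≡n q
...   | inj₂ e = ≤-reflexive (sym e)
...   | inj₁ q< = ⊥-elim (<⇒≱ (*-mono-< q< q<) (≤-trans p (≤-trans (^-monoʳ-≤ r k≤2h) (≤-reflexive
        (trans (cong (r ^_) (solve 1 (λ h → con 2 ⊛ h := h ⊹ h) refl h)) (^-distribˡ-+-* r h h))))))

r^n*[r^h]^p : ∀ r n h p → r ^ n * (r ^ h) ^ p ≡ r ^ (n + h * p)
r^n*[r^h]^p r n h p = trans (cong (r ^ n *_) (^-*-assoc r h p)) (sym (^-distribˡ-+-* r n (h * p)))

4≤⇒nonZero : ∀ {r} → 4 ≤ r → NonZero r
4≤⇒nonZero 4≤r = >-nonZero (≤-trans (s≤s z≤n) 4≤r)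

4≤⇒2≤ : ∀ {r} → 4 ≤ r → 2 ≤ r
4≤⇒2≤ 4≤r = ≤-trans (s≤s (s≤s z≤n)) 4≤r

weight-bound : ∀ {r n} (A : Subset n) Δ V → 4 ≤ r → LowDegree {r} A Δ V →
  productL (colorsAt V) (elems A) * productL (colorsAt V) (elems A) ≤ r ^ (1 + n + (r * Δ + 1))
weight-bound {r} {n} A Δ V 4≤r low = ≤-trans (L.weight-squared 4≤r)
    (^-monoʳ-≤ r {{4≤⇒nonZero 4≤r}} (|B|+|C|≤n L.A₁ L.A₃ L.A₂ n (r * Δ + 1) L.few-sums))
  where module L = Leaf A V Δ (LowDegree.nonempty low) (LowDegree.low-degree low)

-- With b now the successor, the exponent is at most n + bn + 3b + brΔ: n from the containers, the
-- rest from the templates. The parameter q = 2br and n ≥ 6b make each of the last two terms at most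
-- n / 2.
upper-bound : ∀ r b → 4 ≤ r → ∃[ n₀ ] (∀ n → n₀ ≤ n → gMax n r ^ (2 * suc b) ≤ r ^ (n * (suc b + 2)))
upper-bound r b₀ 4≤r = n₀ , bound
  where
  b = suc b₀
  CB = container-bound r (2 * b) (2 * b * r) 4≤r
  n₀ = proj₁ CB + 6 * b
  bound : ∀ n → n₀ ≤ n → gMax n r ^ (2 * b) ≤ r ^ (n * (b + 2))
  bound n n₀≤n = gMax-bound n r (b₀ + (b + 0)) (r ^ (n * (b + 2))) (m^n>0 r {{4≤⇒nonZero 4≤r}} (n * (b + 2))) (λ A → begin
      g A r ^ (2 * b) ≤⟨ proj₂ (proj₂ (proj₂ C)) A (r ^ h) (λ V low →
        sqrt-≤ r h (1 + n + (r * Δ + 1)) (productL (colorsAt V) (elems A)) {{4≤⇒nonZero 4≤r}} (proj₁ (proj₂ H)) (weight-bound A Δ V 4≤r low)) ⟩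
      r ^ n * (r ^ h) ^ (2 * b) ≡⟨ r^n*[r^h]^p r n h (2 * b) ⟩
      r ^ (n + h * (2 * b)) ≤⟨ ^-monoʳ-≤ r {{4≤⇒nonZero 4≤r}} exponent ⟩
      r ^ (n * (b + 2)) ∎)
    where
    open ≤-Reasoning
    C = proj₂ CB n (≤-trans (m≤m+n _ _) n₀≤n)
    Δ = proj₁ C
    H = half (1 + n + (r * Δ + 1))
    h = proj₁ H
    scaled : b * (2 * h) ≤ b * (2 + n + (r * Δ + 1))
    scaled = *-monoʳ-≤ b (proj₂ (proj₂ H))
    exponent : n + h * (2 * b) ≤ n * (b + 2)
    exponent = lin (n ∷ n + h * (2 * b) ∷ n * (b + 2) ∷ b * (2 * h) ∷ b * (2 + n + (r * Δ + 1)) ∷ b * n ∷ b * (r * Δ) ∷ b ∷ suc (2 * b * r) * Δ ∷ [])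
      (λ n x y s t p q b w → (x :≤ n :+ s) ∷ (2 :* n :+ p :≤ y) ∷ (s :≤ t) ∷ (t :≤ 3 :* b :+ p :+ q) ∷ (2 :* q :≤ w) ∷ (w :≤ n)
        ∷ (6 :* b :≤ n) ∷ [] ⊢ x :≤ y)
      (≤-reflexive (solve 3 (λ n h b → n ⊹ h ⊛ (con 2 ⊛ b) := n ⊹ b ⊛ (con 2 ⊛ h)) refl n h b))
      (≤-reflexive (solve 2 (λ n b → con 2 ⊛ n ⊹ b ⊛ n := n ⊛ (b ⊹ con 2)) refl n b))
      scaled
      (≤-reflexive (solve 3 (λ n b q → b ⊛ (con 2 ⊹ n ⊹ (q ⊹ con 1)) := con 3 ⊛ b ⊹ b ⊛ n ⊹ b ⊛ q) refl n b (r * Δ)))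
      (≤-trans (≤-reflexive (solve 3 (λ b r d → con 2 ⊛ (b ⊛ (r ⊛ d)) := con 2 ⊛ b ⊛ r ⊛ d) refl b r Δ)) (m≤n+m _ Δ))
      (proj₁ (proj₂ C))
      (≤-trans (m≤n+m _ (proj₁ CB)) n₀≤n)

lower-bound : ∀ r n b → 4 ≤ r → r ^ (n * b) ≤ gMax n r ^ (2 * b)
lower-bound r n b 4≤r = begin
  r ^ (n * b) ≤⟨ ^-monoʳ-≤ r {{4≤⇒nonZero 4≤r}} (≤-trans (*-monoˡ-≤ b (n≤2∣oddSet∣ n))
     (≤-reflexive (solve 2 (λ l b → con 2 ⊛ l ⊛ b := l ⊛ (con 2 ⊛ b)) refl l b))) ⟩
  r ^ (l * (2 * b)) ≡⟨ ^-*-assoc r l (2 * b) ⟨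
  (r ^ l) ^ (2 * b) ≡⟨ cong (_^ (2 * b)) (g-oddSet n r) ⟨
  g (oddSet n) r ^ (2 * b) ≤⟨ ^-monoˡ-≤ (2 * b) (g≤gMax n r (oddSet n)) ⟩
  gMax n r ^ (2 * b) ∎
  where
  open ≤-Reasoning
  l = length (elems (oddSet n))

-- Stability.

-- By Bernoulli (5/4)^(4r) exceeds r, so each block of 4r factors 4 saves one factor r when r ≥ 5.
4^4r≤r^[4r-1] : ∀ r q → 5 ≤ r → suc q ≡ 4 * r → 4 ^ suc q ≤ r ^ q
4^4r≤r^[4r-1] r q 5≤r eq = *-cancelʳ-≤ _ _ (suc q) (begin
  4 ^ suc q * suc q ≤⟨ *-monoʳ-≤ (4 ^ suc q) (m≤n+m (suc q) 4) ⟩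
  4 ^ suc q * (4 + suc q) ≤⟨ bernoulli 4 (suc q) ⟩
  5 ^ suc q * 4 ≤⟨ *-monoˡ-≤ 4 (^-monoˡ-≤ (suc q) 5≤r) ⟩
  r * r ^ q * 4 ≡⟨ solve 2 (λ r p → r ⊛ p ⊛ con 4 := p ⊛ (con 4 ⊛ r)) refl r (r ^ q) ⟩
  r ^ q * (4 * r) ≡⟨ cong (r ^ q *_) eq ⟨
  r ^ q * suc q ∎)
  where open ≤-Reasoning

4^n≤r^[n∸E] : ∀ r n E → 5 ≤ r → 4 * r * E ≤ n → 4 ^ n ≤ r ^ (n ∸ E)
4^n≤r^[n∸E] r@(suc r₀) n E 5≤r 4rE≤n with m≤n⇒∃[o]m+o≡n 4rE≤n
... | t , refl = begin
  4 ^ (4 * r * E + t) ≡⟨ ^-distribˡ-+-* 4 (4 * r * E) t ⟩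
  4 ^ (4 * r * E) * 4 ^ t ≡⟨ cong (_* 4 ^ t) (^-*-assoc 4 (4 * r) E) ⟨
  (4 ^ (4 * r)) ^ E * 4 ^ t ≤⟨ *-mono-≤ (^-monoˡ-≤ E (4^4r≤r^[4r-1] r q 5≤r refl)) (^-monoˡ-≤ t (≤-trans (n≤1+n 4) 5≤r)) ⟩
  (r ^ q) ^ E * r ^ t ≡⟨ cong (_* r ^ t) (^-*-assoc r q E) ⟩
  r ^ (q * E) * r ^ t ≡⟨ ^-distribˡ-+-* r (q * E) t ⟨
  r ^ (q * E + t) ≡⟨ cong (r ^_) (trans (cong (_∸ E) (+-assoc E (q * E) t)) (m+n∸m≡n E (q * E + t))) ⟨
  r ^ (4 * r * E + t ∸ E) ∎
  where
  open ≤-Reasoning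
  q = r₀ + (r + (r + (r + 0)))

module _ {r n : ℕ} (A : Subset n) (Δ : ℕ) (4≤r : 4 ≤ r) where
  errorBound : ℕ
  errorBound = 1 + (r * Δ + 1) + Δ

  -- The threshold is |A₂| + |A₃| = n - Δ: below it the squared weight is small, above it
  -- `stability` applies with E = Δ. If A₃ is empty, A₂ alone has n - Δ elements, so A is nearly
  -- everything.
  light-or-structured : ∀ V → LowDegree {r} A Δ V →
    productL (colorsAt V) (elems A) * productL (colorsAt V) (elems A) ≤ r ^ (n ∸ Δ)
    ⊎ (productL (colorsAt V) (elems A) ≤ 2 ^ n × ∣ A △ fullSet n ∣ ≤ Δ)
    ⊎ ∣ A △ oddSet n ∣ ≤ 500 * errorBound
    ⊎ ∣ A △ I₀ n ∣ ≤ 500 * errorBound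
  light-or-structured V low with ≤-total n (cnt L.A₃ (suc n) + cnt L.A₂ (suc n) + Δ)
    where module L = Leaf A V Δ (LowDegree.nonempty low) (LowDegree.low-degree low)
  ... | inj₂ small = inj₁ (≤-trans (L.weight-squared 4≤r) (^-monoʳ-≤ r {{4≤⇒nonZero 4≤r}} (m+n≤o⇒m≤o∸n (cnt L.A₃ (suc n) + cnt L.A₂ (suc n)) small)))
    where module L = Leaf A V Δ (LowDegree.nonempty low) (LowDegree.low-degree low)
  ... | inj₁ large = inj₂ (from-stability (stability L.A₁ L.A₃ L.A₂ n (r * Δ + 1) Δ L.few-sums large))
    where
    module L = Leaf A V Δ (LowDegree.nonempty low) (LowDegree.low-degree low)
    from-stability : _ → _
    from-stability (inj₁ none) = inj₁ (L.weight-two none , lin (∣ A △ fullSet n ∣ ∷ cnt L.A₁ (suc n) ∷ cnt L.A₂ (suc n) ∷ cnt L.A₃ (suc n) ∷ n ∷ Δ ∷ [])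
      (λ s a c b n d → (s :+ a :≤ n) ∷ (c :≤ a) ∷ (n :≤ b :+ c :+ d) ∷ (b :≤ lit 0) ∷ [] ⊢ s :≤ d)
      (≤-reflexive (∣△fullSet∣ A)) (cnt-≤χ (suc n) (FewSums.C⊆A L.few-sums)) large
      (≤-reflexive (cnt-false L.A₃ (suc n) (λ x x≤n → none x (≤-pred x≤n)))))
    from-stability (inj₂ (inj₁ p)) = inj₂ (inj₁ (≤-trans (≤-reflexive (∣△oddSet∣ A)) p))
    from-stability (inj₂ (inj₂ p)) = inj₂ (inj₂ (≤-trans (≤-reflexive (∣△I₀∣ A)) p))

module _ {r n : ℕ} (A : Subset n) (Δ q d h b : ℕ) (4≤r : 4 ≤ r) (d≡ : d ≡ 8 * suc q) (qΔ≤n : suc q * Δ ≤ n) (n≤2qΔ : n ≤ 2 * (suc q * Δ))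
  (b-small : 2000 * (b * r) ≤ q) (b<n : 4000 * b ≤ n) where

  -- The part of the error linear in Δ is at most n / 2 by q ≥ 2000br, the constant part at most n /
  -- 4 by n ≥ 4000b.
  scaled-error : b * (500 * errorBound A Δ 4≤r) ≤ n
  scaled-error = lin (b * (500 * errorBound A Δ 4≤r) ∷ b * errorBound A Δ 4≤r ∷ b ∷ b * (r * Δ) ∷ b * Δ ∷ n ∷ [])
    (λ x e b p s n → (x :≤ 500 :* e) ∷ (e :≤ 2 :* b :+ p :+ s) ∷ (s :≤ p) ∷ (2000 :* p :≤ n) ∷ (4000 :* b :≤ n) ∷ [] ⊢ x :≤ n)
    (≤-reflexive (trans (sym (*-assoc b 500 _)) (trans (cong (_* errorBound A Δ 4≤r) (*-comm b 500)) (*-assoc 500 b _))))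
    (≤-reflexive (solve 3 (λ b p d → b ⊛ (con 1 ⊹ (p ⊹ con 1) ⊹ d) := con 2 ⊛ b ⊹ b ⊛ p ⊹ b ⊛ d) refl b (r * Δ) Δ))
    (*-monoʳ-≤ b (m≤n*m Δ r {{4≤⇒nonZero 4≤r}}))
    (begin
      2000 * (b * (r * Δ)) ≡⟨ cong (2000 *_) (*-assoc b r Δ) ⟨
      2000 * (b * r * Δ) ≡⟨ *-assoc 2000 (b * r) Δ ⟨
      2000 * (b * r) * Δ ≤⟨ *-monoˡ-≤ Δ (≤-trans b-small (n≤1+n q)) ⟩
      suc q * Δ ≤⟨ qΔ≤n ⟩
      n ∎)
    b<n
    where open ≤-Reasoning

  -- The hypotheses give dΔ ≤ 3n + d, while d = 8 (q + 1) makes dΔ at least 4n; hence n ≤ d.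
  too-few : d < n → 2 * h ≤ suc (n ∸ Δ) → n * (d ∸ 2) ≤ n + h * (2 * d) → ⊥
  too-few d<n h≤ p = <-irrefl refl (lin (n ∷ d ∷ n * (d ∸ 2) ∷ h * (2 * d) ∷ n * d ∷ d * (n ∸ Δ) ∷ d * Δ ∷ suc q * Δ ∷ [])
    (λ n d x y z u v w → (lit 1 :+ d :≤ n) ∷ (x :≤ n :+ y) ∷ (z :≤ x :+ 2 :* n) ∷ (y :≤ d :+ u) ∷ (u :+ v :≤ z) ∷ (8 :* w :≤ v) ∷ (n :≤ 2 :* w)
       ∷ [] ⊢ lit 1 :+ n :≤ n)
    d<n p
    (≤-trans (*-monoʳ-≤ n (m≤n+m∸n d 2)) (≤-reflexive (trans (*-distribˡ-+ n 2 (d ∸ 2)) (trans (+-comm (n * 2) _) (cong (n * (d ∸ 2) +_) (*-comm n 2))))))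
    (≤-trans (≤-reflexive (solve 2 (λ h d → h ⊛ (con 2 ⊛ d) := d ⊛ (con 2 ⊛ h)) refl h d)) (≤-trans (*-monoʳ-≤ d h≤) (≤-reflexive (*-suc d (n ∸ Δ)))))
    (≤-reflexive (trans (sym (*-distribˡ-+ d (n ∸ Δ) Δ)) (trans (cong (d *_) (m∸n+n≡m Δ≤n)) (*-comm d n))))
    (≤-reflexive (trans (sym (*-assoc 8 (suc q) Δ)) (cong (_* Δ) (sym d≡))))
    n≤2qΔ)
    where
    Δ≤n : Δ ≤ n
    Δ≤n = ≤-trans (m≤n*m Δ (suc q)) qΔ≤n

-- If A is far from the extremal sets, all its templates are light and it has too few colourings.
-- The bounds on q serve, in order, the error of the structured cases, the loss 4^n ≤ r^(n - Δ) for
-- r ≥ 5, and bΔ ≤ n for r = 4.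
stability-with : ∀ r a b q d → 4 ≤ r → 1 ≤ a → d ≡ 8 * suc q → 2000 * (b * r) ≤ q → 4 * r ≤ q → b ≤ q →
  ∃[ n₀ ] (0 < n₀ × (∀ n → n₀ ≤ n → (A : Subset n) →
  r ^ (n * (d ∸ 2)) ≤ g A r ^ (2 * d) →
  (5 ≤ r → (b * ∣ A △ oddSet n ∣ ≤ a * n) ⊎ (b * ∣ A △ I₀ n ∣ ≤ a * n))
  × (r ≡ 4 → (b * ∣ A △ fullSet n ∣ ≤ a * n) ⊎ (b * ∣ A △ oddSet n ∣ ≤ a * n) ⊎ (b * ∣ A △ I₀ n ∣ ≤ a * n))))
stability-with r a b q d 4≤r 1≤a d≡ b-small r-small b≤q = n₀ , ≤-trans (≤-trans (s≤s z≤n) (m≤n+m (suc d) (4000 * b))) (m≤n+m (4000 * b + suc d) (proj₁ CB)) , λ n n₀≤n A heavy →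
    (λ 5≤r → large-r n n₀≤n A heavy 5≤r (a * n <? b * ∣ A △ oddSet n ∣) (a * n <? b * ∣ A △ I₀ n ∣)) ,
    (λ r≡4 → four n n₀≤n A heavy (a * n <? b * ∣ A △ fullSet n ∣) (a * n <? b * ∣ A △ oddSet n ∣) (a * n <? b * ∣ A △ I₀ n ∣))
  where
  CB = container-bound r (2 * d) q 4≤r
  n₀ = proj₁ CB + (4000 * b + suc d)
  module _ (n : ℕ) (n₀≤n : n₀ ≤ n) (A : Subset n) (heavy : r ^ (n * (d ∸ 2)) ≤ g A r ^ (2 * d)) where
    C = proj₂ CB n (≤-trans (m≤m+n _ _) n₀≤n)
    Δ = proj₁ C
    H = half (n ∸ Δ)
    h = proj₁ H
    b<n : 4000 * b ≤ n
    b<n = ≤-trans (m≤m+n (4000 * b) (suc d)) (≤-trans (m≤n+m _ (proj₁ CB)) n₀≤n)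
    qΔ≤n : suc q * Δ ≤ n
    qΔ≤n = proj₁ (proj₂ C)
    n≤a*n : n ≤ a * n
    n≤a*n = ≤-trans (≤-reflexive (sym (*-identityˡ n))) (*-monoˡ-≤ n 1≤a)

    all-light : (∀ V → LowDegree {r} A Δ V → productL (colorsAt V) (elems A) * productL (colorsAt V) (elems A) ≤ r ^ (n ∸ Δ)) → ⊥
    all-light light = too-few A Δ q d h b 4≤r d≡ qΔ≤n (proj₁ (proj₂ (proj₂ C))) b-small b<n
      (≤-trans (m≤n+m (suc d) (4000 * b)) (≤-trans (m≤n+m _ (proj₁ CB)) n₀≤n)) (proj₂ (proj₂ H))
      (^-cancel-≤ r (n * (d ∸ 2)) (n + h * (2 * d)) (4≤⇒2≤ 4≤r) (≤-trans heavy (≤-trans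
        (proj₂ (proj₂ (proj₂ C)) A (r ^ h) (λ V low → sqrt-≤ r h (n ∸ Δ) (productL (colorsAt V) (elems A)) {{4≤⇒nonZero 4≤r}} (proj₁ (proj₂ H)) (light V low)))
        (≤-reflexive (r^n*[r^h]^p r n h (2 * d))))))

    far : ∀ S → a * n < b * S → S ≤ 500 * errorBound A Δ 4≤r → ⊥
    far S p q = <⇒≱ p (≤-trans (≤-trans (*-monoʳ-≤ b q) (scaled-error A Δ _ d h b 4≤r d≡ qΔ≤n (proj₁ (proj₂ (proj₂ C))) b-small b<n)) n≤a*n)

    light-if : a * n < b * ∣ A △ oddSet n ∣ → a * n < b * ∣ A △ I₀ n ∣ →
      (∀ W → W ≤ 2 ^ n → ∣ A △ fullSet n ∣ ≤ Δ → W * W ≤ r ^ (n ∸ Δ)) → ⊥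
    light-if far-odd far-I₀ two = all-light (λ V low → choose (light-or-structured A Δ 4≤r V low))
      where
      choose : ∀ {W} → W * W ≤ r ^ (n ∸ Δ) ⊎ (W ≤ 2 ^ n × ∣ A △ fullSet n ∣ ≤ Δ) ⊎ ∣ A △ oddSet n ∣ ≤ 500 * errorBound A Δ 4≤r
        ⊎ ∣ A △ I₀ n ∣ ≤ 500 * errorBound A Δ 4≤r → W * W ≤ r ^ (n ∸ Δ)
      choose (inj₁ p) = p
      choose (inj₂ (inj₁ (p , s))) = two _ p s
      choose (inj₂ (inj₂ (inj₁ p))) = ⊥-elim (far _ far-odd p)
      choose (inj₂ (inj₂ (inj₂ p))) = ⊥-elim (far _ far-I₀ p)

    large-r : 5 ≤ r → Dec (a * n < b * ∣ A △ oddSet n ∣) → Dec (a * n < b * ∣ A △ I₀ n ∣) →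
      (b * ∣ A △ oddSet n ∣ ≤ a * n) ⊎ (b * ∣ A △ I₀ n ∣ ≤ a * n)
    large-r 5≤r (no p) _ = inj₁ (≮⇒≥ p)
    large-r 5≤r (yes _) (no p) = inj₂ (≮⇒≥ p)
    -- For r ≥ 5 templates with at most two colours per element are light as well.
    large-r 5≤r (yes p) (yes s) = ⊥-elim (light-if p s (λ W W≤ _ → ≤-trans (*-mono-≤ W≤ W≤) (≤-trans (≤-reflexive (sym (*-^ 2 2 n)))
      (4^n≤r^[n∸E] r n Δ 5≤r (≤-trans (*-monoˡ-≤ Δ (≤-trans r-small (n≤1+n q))) qΔ≤n)))))

    four : Dec (a * n < b * ∣ A △ fullSet n ∣) → Dec (a * n < b * ∣ A △ oddSet n ∣) → Dec (a * n < b * ∣ A △ I₀ n ∣) →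
      (b * ∣ A △ fullSet n ∣ ≤ a * n) ⊎ (b * ∣ A △ oddSet n ∣ ≤ a * n) ⊎ (b * ∣ A △ I₀ n ∣ ≤ a * n)
    four (no p) _ _ = inj₁ (≮⇒≥ p)
    four (yes _) (no p) _ = inj₂ (inj₁ (≮⇒≥ p))
    four (yes _) (yes _) (no p) = inj₂ (inj₂ (≮⇒≥ p))
    -- For r = 4 such templates may be heavy, but then A is within Δ of [n].
    four (yes p) (yes s) (yes t) = ⊥-elim (light-if s t (λ W _ full → ⊥-elim (<⇒≱ p
      (≤-trans (*-monoʳ-≤ b full) (≤-trans (*-monoˡ-≤ Δ (≤-trans b≤q (n≤1+n q))) (≤-trans qΔ≤n n≤a*n))))))

abstract
  modulus : ∀ r b → ∃[ q ] ∃[ d ] (d ≡ 8 * suc q × 0 < d × 2000 * (b * r) ≤ q × 4 * r ≤ q × b ≤ q)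
  modulus r b = 2000 * (b * r) + (4 * r + b) , _ , refl , s≤s z≤n , m≤m+n (2000 * (b * r)) (4 * r + b) ,
    ≤-trans (m≤m+n (4 * r) b) (m≤n+m (4 * r + b) (2000 * (b * r))) , ≤-trans (m≤n+m b (4 * r)) (m≤n+m (4 * r + b) (2000 * (b * r)))

stability-bound : ∀ r a b → 4 ≤ r → 1 ≤ a → ∃[ d ] ∃[ n₀ ] (0 < d × 0 < n₀ × (∀ n → n₀ ≤ n → (A : Subset n) →
  r ^ (n * (d ∸ 2)) ≤ g A r ^ (2 * d) →
  (5 ≤ r → (b * ∣ A △ oddSet n ∣ ≤ a * n) ⊎ (b * ∣ A △ I₀ n ∣ ≤ a * n))
  × (r ≡ 4 → (b * ∣ A △ fullSet n ∣ ≤ a * n) ⊎ (b * ∣ A △ oddSet n ∣ ≤ a * n) ⊎ (b * ∣ A △ I₀ n ∣ ≤ a * n))))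
stability-bound r a b 4≤r 1≤a = d , proj₁ S , proj₁ (proj₂ (proj₂ (proj₂ N))) , proj₁ (proj₂ S) , proj₂ (proj₂ S)
  where
  N = modulus r b
  d = proj₁ (proj₂ N)
  S = stability-with r a b (proj₁ N) d 4≤r 1≤a (proj₁ (proj₂ (proj₂ N))) (proj₁ (proj₂ (proj₂ (proj₂ (proj₂ N)))))
    (proj₁ (proj₂ (proj₂ (proj₂ (proj₂ (proj₂ N)))))) (proj₂ (proj₂ (proj₂ (proj₂ (proj₂ (proj₂ N))))))

-- The fraction a/b plays the role of ε, and of the error in the exponent; c/d plays that of δ.
-- Raising to the powers 2b and 2d makes the exponents n/2 ± (a/b) n and n/2 - (c/d) n integral.
mainTheorem4 : (r : ℕ) → 4 ≤ r →
    ((a b : ℕ) → 0 < a → 0 < b →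
    ∃[ n₀ ] ((n : ℕ) → n₀ ≤ n →
    (r ^ (n * (b ∸ 2 * a)) ≤ gMax n r ^ (2 * b))
    × (gMax n r ^ (2 * b) ≤ r ^ (n * (b + 2 * a)))))
    × ((a b : ℕ) → 0 < a → 0 < b →
    ∃[ c ] ∃[ d ] ∃[ n₀ ] (0 < c × 0 < d × 0 < n₀ ×
    ((n : ℕ) → n₀ ≤ n → (A : Subset n) →
    r ^ (n * (d ∸ 2 * c)) ≤ g A r ^ (2 * d) →
    ((5 ≤ r →
    (b * ∣ A △ oddSet n ∣ ≤ a * n) ⊎ (b * ∣ A △ I₀ n ∣ ≤ a * n))
    × (r ≡ 4 →
    (b * ∣ A △ fullSet n ∣ ≤ a * n)
    ⊎ (b * ∣ A △ oddSet n ∣ ≤ a * n)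
    ⊎ (b * ∣ A △ I₀ n ∣ ≤ a * n))))))
mainTheorem4 r 4≤r = asymptotics , structure
  where
  asymptotics : (a b : ℕ) → 0 < a → 0 < b → ∃[ n₀ ] ((n : ℕ) → n₀ ≤ n →
    (r ^ (n * (b ∸ 2 * a)) ≤ gMax n r ^ (2 * b)) × (gMax n r ^ (2 * b) ≤ r ^ (n * (b + 2 * a))))
  asymptotics a (suc b) 0<a _ = proj₁ U , λ n n₀≤n →
    ≤-trans (^-monoʳ-≤ r {{4≤⇒nonZero 4≤r}} (*-monoʳ-≤ n (m∸n≤m (suc b) (2 * a)))) (lower-bound r n (suc b) 4≤r) ,
    ≤-trans (proj₂ U n n₀≤n) (^-monoʳ-≤ r {{4≤⇒nonZero 4≤r}} (*-monoʳ-≤ n (+-monoʳ-≤ (suc b) (*-monoʳ-≤ 2 0<a))))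
    where U = upper-bound r b 4≤r
  structure : (a b : ℕ) → 0 < a → 0 < b → _
  -- Here δ = 1/d, so 2c is the 2 of `stability-bound`.
  structure a b 0<a _ = 1 , proj₁ S , proj₁ (proj₂ S) , s≤s z≤n , proj₁ (proj₂ (proj₂ S)) , proj₁ (proj₂ (proj₂ (proj₂ S))) , proj₂ (proj₂ (proj₂ (proj₂ S)))
    where S = stability-bound r a b 4≤r 0<a
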